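{- Let $\varepsilon>0$ be fixed. There is $p_0$ depending only on $\varepsilon$ such that the following holds for every prime $p\ge p_0$. Let $A\in\operatorname{SL}(2,p)$ have characteristic polynomial irreducible over $\mathbb F_p$, and suppose its multiplicative order $\tau$ satisfies $\tau\ge p^{5/11+\varepsilon}$. Then for every nonzero row vector $\mathbf a\in\mathbb F_p^2$ and every integer $$k>\max\left\{\frac{45}{11}\varepsilon^{ -1}-3,\ 6\right\}$$ we have $k\left(\mathbf a\langle A\rangle\right)=\mathbb F_p^2$.
   Context: $\operatorname{SL}(2,p)$ is the group of $2\times2$ matrices over $\mathbb F_p$ of determinant $1$; the multiplicative order of $A$ is the least $\tau\ge1$ with $A^\tau=I$. The orbit is $\mathbf a\langle A\rangle=\{\mathbf aA^x:\ x=1,\ldots,\tau\}$, and for $\mathcal S\subseteq\mathbb F_p^2$ and integer $k\ge1$, $k\mathcal S=\{\mathbf s_1+\cdots+\mathbf s_k:\ \mathbf s_i\in\mathcal S\}$. -}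

module Defs where

open import Data.Nat using (ℕ; zero; suc; _+_; _*_; _≤_; NonZero)
open import Data.Nat.DivMod using (_mod_)
open import Data.Fin using (Fin; toℕ)
open import Data.Product using (_×_; _,_; Σ; ∃)
open import Relation.Binary.PropositionalEquality using (_≡_; _≢_)

F : ℕ → Set
F p = Fin p

module _ (p : ℕ) .{{_ : NonZero p}} where

  0F : F p
  0F = 0 mod p

  1F : F p
  1F = 1 mod p

  addF : F p → F p → F p
  addF x y = (toℕ x + toℕ y) mod p

  mulF : F p → F p → F p
  mulF x y = (toℕ x * toℕ y) mod p

  Vec2 : Set
  Vec2 = F p × F p

  0V : Vec2
  0V = 0F , 0F

  addV : Vec2 → Vec2 → Vec2
  addV (x₁ , x₂) (y₁ , y₂) = addF x₁ y₁ , addF x₂ y₂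

  -- 2×2 matrices ((α , β) , (γ , δ)) = [[α β] [γ δ]] (rows)
  Mat2 : Set
  Mat2 = Vec2 × Vec2

  I2 : Mat2
  I2 = (1F , 0F) , (0F , 1F)

  mulM : Mat2 → Mat2 → Mat2
  mulM ((a , b) , (c , d)) ((e , f) , (g , h)) =
    (addF (mulF a e) (mulF b g) , addF (mulF a f) (mulF b h)) ,
    (addF (mulF c e) (mulF d g) , addF (mulF c f) (mulF d h))

  vecMul : Vec2 → Mat2 → Vec2
  vecMul (x₁ , x₂) ((α , β) , (γ , δ)) =
    addF (mulF x₁ α) (mulF x₂ γ) , addF (mulF x₁ β) (mulF x₂ δ)

  powM : Mat2 → ℕ → Mat2
  powM A zero = I2
  powM A (suc n) = mulM (powM A n) A

  det : Mat2 → F p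
  det ((α , β) , (γ , δ)) = addF (mulF α δ) ((toℕ (mulF β γ) * (p Data.Nat.∸ 1)) mod p)

  trace : Mat2 → F p
  trace ((α , _) , (_ , δ)) = addF α δ

  InSL2 : Mat2 → Set
  InSL2 A = det A ≡ 1F

  -- The characteristic polynomial X² - tr(A) X + det(A) is reducible over F_p
  -- iff it factors as (X - r)(X - s) with r, s ∈ F_p, i.e. r + s = tr A, r s = det A.
  CharPolyReducible : Mat2 → Set
  CharPolyReducible A =
    Σ (F p) λ r → Σ (F p) λ s → (addF r s ≡ trace A) × (mulF r s ≡ det A)

  CharPolyIrreducible : Mat2 → Set
  CharPolyIrreducible A = CharPolyReducible A → Data.Empty.⊥
    where import Data.Empty

  IsOrder : Mat2 → ℕ → Set
  IsOrder A τ = (1 ≤ τ) × (powM A τ ≡ I2) × (∀ t → 1 ≤ t → t Data.Nat.< τ → powM A t ≢ I2)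

  InOrbit : Vec2 → Mat2 → ℕ → Vec2 → Set
  InOrbit a A τ v = Σ ℕ λ x → (1 ≤ x) × (x ≤ τ) × (vecMul a (powM A x) ≡ v)

  sumV : (k : ℕ) → (Fin k → Vec2) → Vec2
  sumV zero s = 0V
  sumV (suc k) s = addV (s Fin.zero) (sumV k λ i → s (Fin.suc i))
    where import Data.Fin as Fin

  InSumset : ℕ → (Vec2 → Set) → Vec2 → Set
  InSumset k S v = Σ (Fin k → Vec2) λ s → ((i : Fin k) → S (s i)) × (sumV k s ≡ v)

{-# OPTIONS --safe #-}
module Submission where

-- Identify row vectors with the field K = F_p[t]/(t² - T t + 1) of q = p² elements, T = tr A, so that A acts as
-- multiplication by t and the orbit becomes the group G = ⟨t⟩ of order τ, on which conjugation is inversion. A sum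
-- u + v ≠ 0 with u, v ∈ G determines {u, v}, so |2G| ≥ τ²/3. Stepanov's method bounds the number of representations
-- of a point as a sum of three elements of G, which gives |3G| ≫ τ^(9/4), more than p when τ ≥ p^(5/11).
-- Since two lines y = a b + c meet at most once, sets A, B, C ⊆ K satisfy
-- |A| |B| |C| q ≤ |A B + C| (q² + |A| |B| |C|). For orders beyond p^(1/2) iterating Y ↦ Y + 2G·2G covers K with at
-- most 28 terms; otherwise Glibichuk's argument shows that eight products of elements of 2G (or of 3G) cover K,
-- using 32 (or 72) terms. In each range of k the hypothesis on k turns into a lower bound for τ by a power of p.

-- Because G is closed under products, a sum of i terms times a sum of j terms expands to a sum of i
-- j terms. This is how estimates for products yield sums, and why 2G and 3G lead to 2 (2 + 2)² = 32
-- and 2 (3 + 3)² = 72 terms. The obstacle is the order p^(1/2). A step Y ↦ Y + 2G·2G multiplies |Y|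
-- by about |2G|²/q, a gain only while τ² exceeds p up to constants; with r steps in all, 8 + 4 r
-- terms suffice once τ is beyond p^(1/2 + 1/(2 r + 4)). Glibichuk's argument needs no iteration,
-- only a set X of sums with |X|² > 2 q + |X|. Below p^(1/2) the set 2G is too small for it, while
-- 3G is large enough because 9/4 · 5/11 = 45/44 > 1. Stepanov's method treats only c ≠ 0 whose norm
-- differs from 1. The other values are taken by few triples, since such a sum of three elements of
-- G is 0 or contains two opposite elements. All estimates are inequalities between natural numbers
-- with explicit constants. Wherever a power of τ has to beat a power of p, the exponents leave a
-- strict gap, and this yields a spare factor p that absorbs the constants.

open import Defs
open import Level using (0ℓ)
open import Algebra.Bundles using (CommutativeRing; RawRing)
open import Algebra.Structures using (IsCommutativeRing)
import Tactic.RingSolver.Core.AlmostCommutativeRing as ACR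
open import Tactic.RingSolver.Core.Expression using (Expr; module Eval; Ι; _⊛_) renaming (_⊕_ to infixl 6 _:+_; _⊗_ to infixl 7 _:*_; ⊝_ to infix 8 :-_; Κ to con)
open import Tactic.RingSolver.Core.Polynomial.Parameters using (Homomorphism)
import Algebra.Properties.Semiring.Mult.TCOptimised
import Algebra.Properties.Ring
open import Data.Bool.Base using (Bool; true; false) renaming (T to IsTrue)
open import Data.Empty using (⊥; ⊥-elim)
open import Data.Integer.Base as ℤ using (ℤ; -[1+_]) renaming (+_ to pos)
import Data.Integer.Properties as ℤₚ
open import Data.List.Base using (List; []; _∷_; _++_; length; map; upTo; applyUpTo; filter; deduplicate; cartesianProduct)
open import Data.List.Membership.Propositional using (_∈_)
open import Data.List.Relation.Unary.All as All using (All; []; _∷_)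
open import Data.List.Relation.Unary.Any as Any using (Any; here; there)
open import Data.List.Relation.Unary.Unique.Propositional using (Unique; []; _∷_)
open import Data.Maybe.Base using (nothing)
open import Data.Nat using (ℕ; zero; suc; _+_; _*_; _∸_; _^_; _≤_; _<_; _≤ᵇ_; _<ᵇ_; pred; z≤n; s≤s; NonZero; >-nonZero; ≢-nonZero; nonTrivial⇒n>1)
import Data.Nat.Properties as ℕₚ
open import Data.Nat.Primality using (Prime)
open import Data.Product using (Σ; ∃; _×_; _,_; proj₁; proj₂)
open import Data.Sum using (_⊎_; inj₁; inj₂; [_,_]′)
open import Data.Unit using (⊤; tt)
open import Function using (_∘_)
open import Relation.Binary.Definitions using (DecidableEquality; tri<; tri≈; tri>)
open import Relation.Binary.PropositionalEquality using (_≡_; _≢_; refl; sym; trans; cong; cong₂; subst; module ≡-Reasoning)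
open import Relation.Nullary using (¬_; Dec; yes; no)
-- The stdlib solver decides cancellation only as far as its coefficients do, hence integer coefficients.
module RingSolver (R : CommutativeRing 0ℓ 0ℓ) where
  private
    module R = CommutativeRing R
    open Algebra.Properties.Ring R.ring using (-‿+-comm; -‿involutive; -0#≈0#; -‿distribˡ-*; -‿distribʳ-*)
    open Algebra.Properties.Semiring.Mult.TCOptimised R.semiring using (×-homo-+; ×1-homo-*) renaming (_×_ to _ו_)
    open import Relation.Binary.Reasoning.Setoid R.setoid

    ⟦_⟧ : ℤ → R.Carrier
    ⟦ pos n ⟧ = n ו R.1#
    ⟦ -[1+ n ] ⟧ = R.- (suc n ו R.1#)

    suc-homo : ∀ n → suc n ו R.1# R.≈ R.1# R.+ n ו R.1#
    suc-homo n = ×-homo-+ R.1# 1 n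

    cancel-suc : ∀ x y → x R.+ R.- y R.≈ (R.1# R.+ x) R.+ R.- (R.1# R.+ y)
    cancel-suc x y = R.sym (begin
      (R.1# R.+ x) R.+ R.- (R.1# R.+ y)         ≈⟨ R.+-congˡ (R.sym (-‿+-comm R.1# y)) ⟩
      (R.1# R.+ x) R.+ (R.- R.1# R.+ R.- y)     ≈⟨ R.+-congʳ (R.+-comm R.1# x) ⟩
      (x R.+ R.1#) R.+ (R.- R.1# R.+ R.- y)     ≈⟨ R.+-assoc x R.1# _ ⟩
      x R.+ (R.1# R.+ (R.- R.1# R.+ R.- y))     ≈⟨ R.+-congˡ (R.sym (R.+-assoc R.1# _ _)) ⟩
      x R.+ ((R.1# R.+ R.- R.1#) R.+ R.- y)     ≈⟨ R.+-congˡ (R.+-congʳ (R.-‿inverseʳ R.1#)) ⟩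
      x R.+ (R.0# R.+ R.- y)                    ≈⟨ R.+-congˡ (R.+-identityˡ _) ⟩
      x R.+ R.- y                               ∎)

    ⊖-homo : ∀ m n → ⟦ m ℤ.⊖ n ⟧ R.≈ m ו R.1# R.+ R.- (n ו R.1#)
    ⊖-homo m zero = R.sym (R.trans (R.+-congˡ -0#≈0#) (R.+-identityʳ _))
    ⊖-homo zero (suc n) = R.sym (R.+-identityˡ _)
    ⊖-homo (suc m) (suc n) = begin
      ⟦ suc m ℤ.⊖ suc n ⟧                        ≡⟨ cong ⟦_⟧ (ℤₚ.[1+m]⊖[1+n]≡m⊖n m n) ⟩
      ⟦ m ℤ.⊖ n ⟧                                ≈⟨ ⊖-homo m n ⟩
      m ו R.1# R.+ R.- (n ו R.1#)              ≈⟨ cancel-suc _ _ ⟩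
      (R.1# R.+ m ו R.1#) R.+ R.- (R.1# R.+ n ו R.1#)
        ≈⟨ R.+-cong (R.sym (suc-homo m)) (R.-‿cong (R.sym (suc-homo n))) ⟩
      suc m ו R.1# R.+ R.- (suc n ו R.1#)      ∎

    neg-homo : ∀ x → ⟦ ℤ.- x ⟧ R.≈ R.- ⟦ x ⟧
    neg-homo (pos zero) = R.sym -0#≈0#
    neg-homo (pos (suc n)) = R.refl
    neg-homo -[1+ n ] = R.sym (-‿involutive _)

    +-homo : ∀ x y → ⟦ x ℤ.+ y ⟧ R.≈ ⟦ x ⟧ R.+ ⟦ y ⟧
    +-homo (pos m) (pos n) = ×-homo-+ R.1# m n
    +-homo (pos m) -[1+ n ] = ⊖-homo m (suc n)
    +-homo -[1+ m ] (pos n) = R.trans (⊖-homo n (suc m)) (R.+-comm _ _)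
    +-homo -[1+ m ] -[1+ n ] = begin
      R.- (suc (suc (m + n)) ו R.1#)                 ≡⟨ cong (λ k → R.- (suc k ו R.1#)) (sym (ℕₚ.+-suc m n)) ⟩
      R.- ((suc m + suc n) ו R.1#)                   ≈⟨ R.-‿cong (×-homo-+ R.1# (suc m) (suc n)) ⟩
      R.- (suc m ו R.1# R.+ suc n ו R.1#)           ≈⟨ R.sym (-‿+-comm _ _) ⟩
      R.- (suc m ו R.1#) R.+ R.- (suc n ו R.1#)     ∎

    *-homo⁺ : ∀ m y → ⟦ pos m ℤ.* y ⟧ R.≈ m ו R.1# R.* ⟦ y ⟧
    *-homo⁺ m (pos n) = R.trans (R.reflexive (cong ⟦_⟧ (sym (ℤₚ.pos-* m n)))) (×1-homo-* m n)
    *-homo⁺ m -[1+ n ] = begin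
      ⟦ pos m ℤ.* -[1+ n ] ⟧           ≡⟨ cong ⟦_⟧ (sym (ℤₚ.neg-distribʳ-* (pos m) (pos (suc n)))) ⟩
      ⟦ ℤ.- (pos m ℤ.* pos (suc n)) ⟧      ≈⟨ neg-homo (pos m ℤ.* pos (suc n)) ⟩
      R.- ⟦ pos m ℤ.* pos (suc n) ⟧        ≈⟨ R.-‿cong (*-homo⁺ m (pos (suc n))) ⟩
      R.- (m ו R.1# R.* suc n ו R.1#)  ≈⟨ -‿distribʳ-* _ _ ⟩
      m ו R.1# R.* R.- (suc n ו R.1#)  ∎

    *-homo : ∀ x y → ⟦ x ℤ.* y ⟧ R.≈ ⟦ x ⟧ R.* ⟦ y ⟧
    *-homo (pos m) y = *-homo⁺ m y
    *-homo -[1+ m ] y = begin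
      ⟦ -[1+ m ] ℤ.* y ⟧             ≡⟨ cong ⟦_⟧ (sym (ℤₚ.neg-distribˡ-* (pos (suc m)) y)) ⟩
      ⟦ ℤ.- (pos (suc m) ℤ.* y) ⟧        ≈⟨ neg-homo (pos (suc m) ℤ.* y) ⟩
      R.- ⟦ pos (suc m) ℤ.* y ⟧          ≈⟨ R.-‿cong (*-homo⁺ (suc m) y) ⟩
      R.- (suc m ו R.1# R.* ⟦ y ⟧)  ≈⟨ -‿distribˡ-* _ _ ⟩
      R.- (suc m ו R.1#) R.* ⟦ y ⟧  ∎

    ℤ-rawRing : RawRing 0ℓ 0ℓ
    ℤ-rawRing = record
      { Carrier = ℤ ; _≈_ = _≡_ ; _+_ = ℤ._+_ ; _*_ = ℤ._*_ ; -_ = ℤ.-_ ; 0# = pos 0 ; 1# = pos 1 }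

    almostCommutativeRing : ACR.AlmostCommutativeRing 0ℓ 0ℓ
    almostCommutativeRing = ACR.fromCommutativeRing R (λ _ → nothing)

    isZero : ℤ → Bool
    isZero (pos zero) = true
    isZero _ = false

    isZero-sound : ∀ x → IsTrue (isZero x) → R.0# R.≈ ⟦ x ⟧
    isZero-sound (pos zero) _ = R.refl

    homomorphism : Homomorphism 0ℓ 0ℓ 0ℓ 0ℓ
    homomorphism = record
      { from = record { rawRing = ℤ-rawRing ; isZero = isZero }
      ; to = almostCommutativeRing
      ; morphism = record
        { ⟦_⟧ = ⟦_⟧ ; +-homo = +-homo ; *-homo = *-homo ; -‿homo = neg-homo ; 0-homo = R.refl ; 1-homo = R.refl }
      ; Zero-C⟶Zero-R = isZero-sound
      }

    open import Tactic.RingSolver.Core.Polynomial.Base (Homomorphism.from homomorphism)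
    open import Tactic.RingSolver.Core.Polynomial.Semantics homomorphism renaming (⟦_⟧ to ⟦_⟧ₚ)
    open import Tactic.RingSolver.Core.Polynomial.Homomorphism homomorphism
    open import Algebra.Properties.Semiring.Exp.TCOptimised R.semiring using (^-congˡ)

    open Eval R.rawRing ⟦_⟧ renaming (⟦_⟧ to ⟦_⟧ₑ)

    normalise : ∀ {n} → Expr ℤ n → Poly n
    normalise (con x) = κ x
    normalise (Ι x) = ι x
    normalise (x :+ y) = normalise x ⊞ normalise y
    normalise (x :* y) = normalise x ⊠ normalise y
    normalise (:- x) = ⊟ normalise x
    normalise (x ⊛ i) = normalise x ⊡ i

    correct : ∀ {n} (e : Expr ℤ n) ρ → ⟦ normalise e ⟧ₚ ρ R.≈ ⟦ e ⟧ₑ ρ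
    correct (con x) ρ = κ-hom x ρ
    correct (Ι x) ρ = ι-hom x ρ
    correct (x :+ y) ρ = R.trans (⊞-hom (normalise x) (normalise y) ρ) (R.+-cong (correct x ρ) (correct y ρ))
    correct (x :* y) ρ = R.trans (⊠-hom (normalise x) (normalise y) ρ) (R.*-cong (correct x ρ) (correct y ρ))
    correct (:- x) ρ = R.trans (⊟-hom (normalise x) ρ) (R.-‿cong (correct x ρ))
    correct (x ⊛ i) ρ = R.trans (⊡-hom (normalise x) i ρ) (^-congˡ i (correct x ρ))

    open import Relation.Binary.Reflection R.setoid Ι ⟦_⟧ₑ (λ e → ⟦ normalise e ⟧ₚ) correct using () renaming (solve to solve′)

  solve = solve′

  infix 4 _:=_
  _:=_ : ∀ {n} → Expr ℤ n → Expr ℤ n → Expr ℤ n × Expr ℤ n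
  _:=_ = _,_


-- Double counting: sums over lists, indicators, Cauchy-Schwarz.

∑ : {A : Set} → List A → (A → ℕ) → ℕ
∑ [] f = 0
∑ (x ∷ xs) f = f x + ∑ xs f

-- The Iverson bracket: counts become sums of indicators, so that double counting is an exchange of
-- sums.
⟪_⟫ : {P : Set} → Dec P → ℕ
⟪ yes _ ⟫ = 1
⟪ no _ ⟫ = 0

⟪⟫-mono : {P Q : Set} (p : Dec P) (q : Dec Q) → (P → Q) → ⟪ p ⟫ ≤ ⟪ q ⟫
⟪⟫-mono (yes p) (yes q) f = ℕₚ.≤-refl
⟪⟫-mono (yes p) (no ¬q) f = ⊥-elim (¬q (f p))
⟪⟫-mono (no _) q f = z≤n

⟪⟫-yes : {P : Set} (d : Dec P) → P → ⟪ d ⟫ ≡ 1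
⟪⟫-yes (yes _) p = refl
⟪⟫-yes (no ¬p) p = ⊥-elim (¬p p)

⟪⟫-no : {P : Set} (d : Dec P) → ¬ P → ⟪ d ⟫ ≡ 0
⟪⟫-no (yes p) ¬p = ⊥-elim (¬p p)
⟪⟫-no (no _) _ = refl

⟪⟫≤1 : {P : Set} (d : Dec P) → ⟪ d ⟫ ≤ 1
⟪⟫≤1 (yes _) = ℕₚ.≤-refl
⟪⟫≤1 (no _) = z≤n

2ab≤a²+b² : ∀ a b → 2 * (a * b) ≤ a * a + b * b
2ab≤a²+b² a b with ℕₚ.≤-total a b
... | inj₁ a≤b = subst (λ c → 2 * (a * c) ≤ a * a + c * c) (ℕₚ.m+[n∸m]≡n a≤b) (shifted a (b ∸ a))
  where
  open import Data.Nat.Tactic.RingSolver using (solve-∀)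
  eq : ∀ a k → a * a + (a + k) * (a + k) ≡ 2 * (a * (a + k)) + k * k
  eq = solve-∀
  shifted : ∀ a k → 2 * (a * (a + k)) ≤ a * a + (a + k) * (a + k)
  shifted a k = subst (2 * (a * (a + k)) ≤_) (sym (eq a k)) (ℕₚ.m≤m+n _ _)
... | inj₂ b≤a = subst (λ c → 2 * (c * b) ≤ c * c + b * b) (ℕₚ.m+[n∸m]≡n b≤a) (shifted b (a ∸ b))
  where
  open import Data.Nat.Tactic.RingSolver using (solve-∀)
  eq : ∀ b k → (b + k) * (b + k) + b * b ≡ 2 * ((b + k) * b) + k * k
  eq = solve-∀
  shifted : ∀ b k → 2 * ((b + k) * b) ≤ (b + k) * (b + k) + b * b
  shifted b k = subst (2 * ((b + k) * b) ≤_) (sym (eq b k)) (ℕₚ.m≤m+n _ _)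

module _ {A : Set} where
  ∑-cong : ∀ (xs : List A) {f g} → (∀ x → f x ≡ g x) → ∑ xs f ≡ ∑ xs g
  ∑-cong [] e = refl
  ∑-cong (x ∷ xs) e = cong₂ _+_ (e x) (∑-cong xs e)

  ∑-mono : ∀ (xs : List A) {f g} → (∀ {x} → x ∈ xs → f x ≤ g x) → ∑ xs f ≤ ∑ xs g
  ∑-mono [] e = z≤n
  ∑-mono (x ∷ xs) e = ℕₚ.+-mono-≤ (e (here refl)) (∑-mono xs (e ∘ there))

  ∑-distrib-+ : ∀ (xs : List A) f g → ∑ xs (λ x → f x + g x) ≡ ∑ xs f + ∑ xs g
  ∑-distrib-+ [] f g = refl
  ∑-distrib-+ (x ∷ xs) f g = trans (cong (_ +_) (∑-distrib-+ xs f g)) (interchange (f x) (g x) _ _)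
    where
    open import Data.Nat.Tactic.RingSolver using (solve-∀)
    interchange : ∀ a b c d → a + b + (c + d) ≡ a + c + (b + d)
    interchange = solve-∀

  *-distribˡ-∑ : ∀ c (xs : List A) f → c * ∑ xs f ≡ ∑ xs (λ x → c * f x)
  *-distribˡ-∑ c [] f = ℕₚ.*-zeroʳ c
  *-distribˡ-∑ c (x ∷ xs) f = trans (ℕₚ.*-distribˡ-+ c _ _) (cong (_ +_) (*-distribˡ-∑ c xs f))

  *-distribʳ-∑ : ∀ c (xs : List A) f → ∑ xs f * c ≡ ∑ xs (λ x → f x * c)
  *-distribʳ-∑ c xs f =
    trans (ℕₚ.*-comm _ c) (trans (*-distribˡ-∑ c xs f) (∑-cong xs (λ x → ℕₚ.*-comm c (f x))))

  ∑-const : ∀ c (xs : List A) → ∑ xs (λ _ → c) ≡ length xs * c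
  ∑-const c [] = refl
  ∑-const c (x ∷ xs) = cong (c +_) (∑-const c xs)

  ∑-bound : ∀ c (xs : List A) {f} → (∀ {x} → x ∈ xs → f x ≤ c) → ∑ xs f ≤ length xs * c
  ∑-bound c xs h = ℕₚ.≤-trans (∑-mono xs h) (ℕₚ.≤-reflexive (∑-const c xs))

  ∑-++ : ∀ (xs ys : List A) f → ∑ (xs ++ ys) f ≡ ∑ xs f + ∑ ys f
  ∑-++ [] ys f = refl
  ∑-++ (x ∷ xs) ys f = trans (cong (f x +_) (∑-++ xs ys f)) (sym (ℕₚ.+-assoc (f x) _ _))

  ∑-atMostOne : ∀ {xs : List A} {P : A → Set} (P? : ∀ x → Dec (P x)) → Unique xs →
    (∀ {x y} → P x → P y → x ≡ y) → ∑ xs (λ x → ⟪ P? x ⟫) ≤ 1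
  ∑-atMostOne P? [] inj = z≤n
  ∑-atMostOne {x ∷ xs} P? (x∉xs ∷ u) inj with P? x
  ... | no _ = ∑-atMostOne P? u inj
  ... | yes px = s≤s (ℕₚ.≤-trans
      (∑-bound 0 xs (λ {y} y∈xs → ℕₚ.≤-reflexive (⟪⟫-no (P? y) (λ py → All.lookup x∉xs y∈xs (inj px py)))))
      (ℕₚ.≤-reflexive (ℕₚ.*-zeroʳ (length xs))))

  ∑-member : ∀ {xs : List A} {P : A → Set} (P? : ∀ x → Dec (P x)) {x} → x ∈ xs → P x →
    1 ≤ ∑ xs (λ y → ⟪ P? y ⟫)
  ∑-member P? (here refl) px = ℕₚ.≤-trans (ℕₚ.≤-reflexive (sym (⟪⟫-yes (P? _) px))) (ℕₚ.m≤m+n _ _)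
  ∑-member P? (there x∈xs) px = ℕₚ.≤-trans (∑-member P? x∈xs px) (ℕₚ.m≤n+m _ _)

  -- Summing 2ab ≤ a² + b² over all pairs of entries gives twice the claim, without any subtraction.
  cauchySchwarz : ∀ (xs : List A) f → ∑ xs f * ∑ xs f ≤ length xs * ∑ xs (λ x → f x * f x)
  cauchySchwarz xs f = ℕₚ.*-cancelˡ-≤ 2 (begin
    2 * (∑ xs f * ∑ xs f)                             ≡⟨ cong (2 *_) (*-distribʳ-∑ _ xs f) ⟩
    2 * ∑ xs (λ x → f x * ∑ xs f)                     ≡⟨ *-distribˡ-∑ 2 xs _ ⟩
    ∑ xs (λ x → 2 * (f x * ∑ xs f))                   ≡⟨ ∑-cong xs (λ x → trans (cong (2 *_) (*-distribˡ-∑ (f x) xs f)) (*-distribˡ-∑ 2 xs _)) ⟩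
    ∑ xs (λ x → ∑ xs (λ y → 2 * (f x * f y)))         ≤⟨ ∑-mono xs (λ {x} _ → ∑-mono xs (λ {y} _ → 2ab≤a²+b² (f x) (f y))) ⟩
    ∑ xs (λ x → ∑ xs (λ y → f x * f x + f y * f y))   ≡⟨ ∑-cong xs (λ x → trans (∑-distrib-+ xs _ _) (cong (_+ Q) (∑-const (f x * f x) xs))) ⟩
    ∑ xs (λ x → length xs * (f x * f x) + Q)          ≡⟨ ∑-distrib-+ xs _ _ ⟩
    ∑ xs (λ x → length xs * (f x * f x)) + ∑ xs (λ _ → Q)
      ≡⟨ cong₂ _+_ (sym (*-distribˡ-∑ (length xs) xs _)) (∑-const Q xs) ⟩
    length xs * Q + length xs * Q                     ≡⟨ cong (length xs * Q +_) (sym (ℕₚ.+-identityʳ _)) ⟩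
    2 * (length xs * Q)                               ∎)
    where
    open ℕₚ.≤-Reasoning
    Q = ∑ xs (λ x → f x * f x)

∑-swap : {A B : Set} (xs : List A) (ys : List B) (f : A → B → ℕ) →
  ∑ xs (λ x → ∑ ys (f x)) ≡ ∑ ys (λ y → ∑ xs (λ x → f x y))
∑-swap [] ys f = sym (trans (∑-const 0 ys) (ℕₚ.*-zeroʳ (length ys)))
∑-swap (x ∷ xs) ys f = trans (cong (_ +_) (∑-swap xs ys f)) (sym (∑-distrib-+ ys _ _))

∑-map : {A B : Set} (xs : List A) (h : A → B) (f : B → ℕ) → ∑ (map h xs) f ≡ ∑ xs (f ∘ h)
∑-map [] h f = refl
∑-map (x ∷ xs) h f = cong (_ +_) (∑-map xs h f)

∑-product : {A B : Set} (xs : List A) (ys : List B) (f : A × B → ℕ) →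
  ∑ (cartesianProduct xs ys) f ≡ ∑ xs (λ x → ∑ ys (λ y → f (x , y)))
∑-product [] ys f = refl
∑-product (x ∷ xs) ys f =
  trans (∑-++ (map (x ,_) ys) _ f) (cong₂ _+_ (∑-map ys (x ,_) f) (∑-product xs ys f))

length-cartesianProduct : {A B : Set} (xs : List A) (ys : List B) →
  length (cartesianProduct xs ys) ≡ length xs * length ys
length-cartesianProduct xs ys = begin
  length (cartesianProduct xs ys)                  ≡⟨ sym (ℕₚ.*-identityʳ _) ⟩
  length (cartesianProduct xs ys) * 1              ≡⟨ sym (∑-const 1 (cartesianProduct xs ys)) ⟩
  ∑ (cartesianProduct xs ys) (λ _ → 1)             ≡⟨ ∑-product xs ys _ ⟩
  ∑ xs (λ _ → ∑ ys (λ _ → 1))                      ≡⟨ ∑-const _ xs ⟩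
  length xs * ∑ ys (λ _ → 1)                       ≡⟨ cong (length xs *_) (trans (∑-const 1 ys) (ℕₚ.*-identityʳ _)) ⟩
  length xs * length ys                            ∎
  where open ≡-Reasoning

module Collisions {A : Set} (_≟_ : DecidableEquality A) where
  open import Data.List.Membership.DecPropositional _≟_ using (_∈?_)

  unique-⊆⇒length-≤ : ∀ {xs ys : List A} → Unique xs → (∀ {x} → x ∈ xs → x ∈ ys) → length xs ≤ length ys
  unique-⊆⇒length-≤ {xs} {ys} u sub = begin
    length xs                                ≡⟨ sym (ℕₚ.*-identityʳ _) ⟩
    length xs * 1                            ≡⟨ sym (∑-const 1 xs) ⟩
    ∑ xs (λ _ → 1)                           ≤⟨ ∑-mono xs (λ {x} x∈ → ∑-member (x ≟_) (sub x∈) refl) ⟩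
    ∑ xs (λ x → ∑ ys (λ y → ⟪ x ≟ y ⟫))      ≡⟨ ∑-swap xs ys _ ⟩
    ∑ ys (λ y → ∑ xs (λ x → ⟪ x ≟ y ⟫))      ≤⟨ ∑-bound 1 ys (λ {y} _ → ∑-atMostOne (_≟ y) u (λ p q → trans p (sym q))) ⟩
    length ys * 1                            ≡⟨ ℕₚ.*-identityʳ _ ⟩
    length ys                                ∎
    where open ℕₚ.≤-Reasoning

  -- The second moment of the fibre sizes of φ, usually called energy; ordered pairs are counted,
  -- the diagonal included.
  collisions : {I : Set} → List I → (I → A) → ℕ
  collisions is φ = ∑ is (λ i → ∑ is (λ j → ⟪ φ i ≟ φ j ⟫))

  -- Cauchy-Schwarz for the fibre sizes `L y`: their sum is at least `length is` and their squares
  -- add up to at most the number of collisions.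
  length²≤image*collisions : {I : Set} (is : List I) (φ : I → A) {ys : List A} → Unique ys →
    (∀ {i} → i ∈ is → φ i ∈ ys) → length is * length is ≤ length ys * collisions is φ
  length²≤image*collisions is φ {ys} u sub = begin
    length is * length is                    ≤⟨ ℕₚ.*-mono-≤ hits hits ⟩
    ∑ ys L * ∑ ys L                          ≤⟨ cauchySchwarz ys L ⟩
    length ys * ∑ ys (λ y → L y * L y)       ≤⟨ ℕₚ.*-monoʳ-≤ (length ys) pairs ⟩
    length ys * collisions is φ              ∎
    where
    open ℕₚ.≤-Reasoning
    L : A → ℕ
    L y = ∑ is (λ i → ⟪ φ i ≟ y ⟫)
    hits : length is ≤ ∑ ys L
    hits = begin
      length is                                ≡⟨ sym (ℕₚ.*-identityʳ _) ⟩
      length is * 1                            ≡⟨ sym (∑-const 1 is) ⟩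
      ∑ is (λ _ → 1)                           ≤⟨ ∑-mono is (λ {i} i∈ → ∑-member (φ i ≟_) (sub i∈) refl) ⟩
      ∑ is (λ i → ∑ ys (λ y → ⟪ φ i ≟ y ⟫))    ≡⟨ ∑-swap is ys _ ⟩
      ∑ ys L                                   ∎
    pairs : ∑ ys (λ y → L y * L y) ≤ collisions is φ
    pairs = begin
      ∑ ys (λ y → L y * L y)
        ≡⟨ ∑-cong ys (λ y → trans (*-distribʳ-∑ (L y) is _) (∑-cong is (λ i → *-distribˡ-∑ ⟪ φ i ≟ y ⟫ is _))) ⟩
      ∑ ys (λ y → ∑ is (λ i → ∑ is (λ j → ⟪ φ i ≟ y ⟫ * ⟪ φ j ≟ y ⟫)))
        ≡⟨ ∑-swap ys is _ ⟩
      ∑ is (λ i → ∑ ys (λ y → ∑ is (λ j → ⟪ φ i ≟ y ⟫ * ⟪ φ j ≟ y ⟫)))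
        ≡⟨ ∑-cong is (λ i → ∑-swap ys is _) ⟩
      ∑ is (λ i → ∑ is (λ j → ∑ ys (λ y → ⟪ φ i ≟ y ⟫ * ⟪ φ j ≟ y ⟫)))
        ≤⟨ ∑-mono is (λ {i} _ → ∑-mono is (λ {j} _ → meet (φ i) (φ j))) ⟩
      collisions is φ ∎
      where
      meet : ∀ a b → ∑ ys (λ y → ⟪ a ≟ y ⟫ * ⟪ b ≟ y ⟫) ≤ ⟪ a ≟ b ⟫
      meet a b = begin
        ∑ ys (λ y → ⟪ a ≟ y ⟫ * ⟪ b ≟ y ⟫)
          ≤⟨ ∑-mono ys (λ {y} _ → factor (a ≟ y) (b ≟ y)) ⟩
        ∑ ys (λ y → ⟪ a ≟ b ⟫ * ⟪ a ≟ y ⟫)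
          ≡⟨ sym (*-distribˡ-∑ ⟪ a ≟ b ⟫ ys _) ⟩
        ⟪ a ≟ b ⟫ * ∑ ys (λ y → ⟪ a ≟ y ⟫)
          ≤⟨ ℕₚ.*-monoʳ-≤ ⟪ a ≟ b ⟫ (∑-atMostOne (a ≟_) u (λ p q → trans (sym p) q)) ⟩
        ⟪ a ≟ b ⟫ * 1 ≡⟨ ℕₚ.*-identityʳ _ ⟩
        ⟪ a ≟ b ⟫ ∎
        where
        factor : ∀ {y} (p : Dec (a ≡ y)) (r : Dec (b ≡ y)) → ⟪ p ⟫ * ⟪ r ⟫ ≤ ⟪ a ≟ b ⟫ * ⟪ p ⟫
        factor (no _) r = z≤n
        factor (yes p) r = subst (1 * ⟪ r ⟫ ≤_) (sym (ℕₚ.*-identityʳ _))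
          (subst (_≤ ⟪ a ≟ b ⟫) (sym (ℕₚ.*-identityˡ ⟪ r ⟫)) (⟪⟫-mono r (a ≟ b) (λ e → trans p (sym e))))

-- Finite fields with a listing of their elements.

record FiniteField : Set₁ where
  infixl 6 _+ᵏ_
  infixl 7 _*ᵏ_
  infix 8 -ᵏ_
  infix 4 _≟_
  field
    Carrier : Set
    _+ᵏ_ _*ᵏ_ : Carrier → Carrier → Carrier
    -ᵏ_ : Carrier → Carrier
    0ᵏ 1ᵏ : Carrier
    isCommutativeRing : IsCommutativeRing _≡_ _+ᵏ_ _*ᵏ_ -ᵏ_ 0ᵏ 1ᵏ
    _≟_ : DecidableEquality Carrier
    1≢0 : 1ᵏ ≢ 0ᵏ
    inverse : ∀ x → x ≢ 0ᵏ → ∃ λ y → x *ᵏ y ≡ 1ᵏ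
    elements : List Carrier
    complete : ∀ x → x ∈ elements
    elements-unique : Unique elements
  commutativeRing : CommutativeRing 0ℓ 0ℓ
  commutativeRing = record { isCommutativeRing = isCommutativeRing }
  open RingSolver commutativeRing public
  open IsCommutativeRing isCommutativeRing public
    using (+-identityˡ; +-identityʳ; *-identityˡ; *-identityʳ; zeroˡ; zeroʳ; -‿inverseˡ; -‿inverseʳ; distribˡ; distribʳ)
    renaming (+-assoc to +ᵏ-assoc; +-comm to +ᵏ-comm; *-assoc to *ᵏ-assoc; *-comm to *ᵏ-comm)

  card : ℕ
  card = length elements

  0<card : 0 < card
  0<card with elements | complete 0ᵏ
  ... | _ ∷ _ | _ = s≤s z≤n

  *-cancelˡ-0 : ∀ {x y} → x ≢ 0ᵏ → x *ᵏ y ≡ 0ᵏ → y ≡ 0ᵏ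
  *-cancelˡ-0 {x} {y} x≢0 xy≡0 with inverse x x≢0
  ... | x⁻¹ , e = begin
    y                   ≡⟨ sym (*-identityˡ y) ⟩
    1ᵏ *ᵏ y             ≡⟨ cong (_*ᵏ y) (sym e) ⟩
    x *ᵏ x⁻¹ *ᵏ y       ≡⟨ solve 3 (λ x i y → x :* i :* y := i :* (x :* y)) refl x x⁻¹ y ⟩
    x⁻¹ *ᵏ (x *ᵏ y)     ≡⟨ cong (x⁻¹ *ᵏ_) xy≡0 ⟩
    x⁻¹ *ᵏ 0ᵏ           ≡⟨ zeroʳ _ ⟩
    0ᵏ                  ∎
    where open ≡-Reasoning

  *-nonzero : ∀ {x y} → x ≢ 0ᵏ → y ≢ 0ᵏ → x *ᵏ y ≢ 0ᵏ
  *-nonzero x≢0 y≢0 e = y≢0 (*-cancelˡ-0 x≢0 e)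

  x-y≡0⇒x≡y : ∀ {x y} → x +ᵏ -ᵏ y ≡ 0ᵏ → x ≡ y
  x-y≡0⇒x≡y {x} {y} e = begin
    x                   ≡⟨ solve 2 (λ x y → x := (x :+ :- y) :+ y) refl x y ⟩
    x +ᵏ -ᵏ y +ᵏ y      ≡⟨ cong (_+ᵏ y) e ⟩
    0ᵏ +ᵏ y             ≡⟨ +-identityˡ y ⟩
    y                   ∎
    where open ≡-Reasoning

  x≡y⇒x-y≡0 : ∀ {x y} → x ≡ y → x +ᵏ -ᵏ y ≡ 0ᵏ
  x≡y⇒x-y≡0 {x} refl = -‿inverseʳ x

  *-cancelˡ : ∀ {x y z} → x ≢ 0ᵏ → x *ᵏ y ≡ x *ᵏ z → y ≡ z
  *-cancelˡ {x} {y} {z} x≢0 e = x-y≡0⇒x≡y (*-cancelˡ-0 x≢0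
    (trans (solve 3 (λ x y z → x :* (y :+ :- z) := x :* y :+ :- (x :* z)) refl x y z) (x≡y⇒x-y≡0 e)))

  +-cancelˡ : ∀ {x y z} → x +ᵏ y ≡ x +ᵏ z → y ≡ z
  +-cancelˡ {x} {y} {z} e = x-y≡0⇒x≡y
    (trans (solve 3 (λ x y z → y :+ :- z := x :+ y :+ :- (x :+ z)) refl x y z) (x≡y⇒x-y≡0 e))

  infixr 8 _^ᵏ_
  _^ᵏ_ : Carrier → ℕ → Carrier
  x ^ᵏ zero = 1ᵏ
  x ^ᵏ suc n = x *ᵏ x ^ᵏ n

  ^-+ : ∀ x m n → x ^ᵏ (m + n) ≡ x ^ᵏ m *ᵏ x ^ᵏ n
  ^-+ x zero n = sym (*-identityˡ _)
  ^-+ x (suc m) n = trans (cong (x *ᵏ_) (^-+ x m n)) (sym (*ᵏ-assoc x _ _))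

  1^ : ∀ n → 1ᵏ ^ᵏ n ≡ 1ᵏ
  1^ zero = refl
  1^ (suc n) = trans (*-identityˡ _) (1^ n)

  ^-* : ∀ x m n → x ^ᵏ (m * n) ≡ (x ^ᵏ m) ^ᵏ n
  ^-* x m zero = cong (x ^ᵏ_) (ℕₚ.*-zeroʳ m)
  ^-* x m (suc n) = trans (cong (x ^ᵏ_) (ℕₚ.*-suc m n)) (trans (^-+ x m (m * n)) (cong (x ^ᵏ m *ᵏ_) (^-* x m n)))

  ^-distrib-* : ∀ x y n → (x *ᵏ y) ^ᵏ n ≡ x ^ᵏ n *ᵏ y ^ᵏ n
  ^-distrib-* x y zero = sym (*-identityˡ _)
  ^-distrib-* x y (suc n) = trans (cong (x *ᵏ y *ᵏ_) (^-distrib-* x y n))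
    (solve 4 (λ x y a b → x :* y :* (a :* b) := x :* a :* (y :* b)) refl x y (x ^ᵏ n) (y ^ᵏ n))

  ^-nonzero : ∀ {x} n → x ≢ 0ᵏ → x ^ᵏ n ≢ 0ᵏ
  ^-nonzero zero x≢0 = 1≢0
  ^-nonzero (suc n) x≢0 = *-nonzero x≢0 (^-nonzero n x≢0)

-- Incidences of lines, and covering the field by sums of products.

module SumProduct (𝔽 : FiniteField) where
  open FiniteField 𝔽
  open Collisions _≟_
  open import Data.List.Membership.DecPropositional _≟_ using (_∈?_)
  import Data.List.Relation.Unary.Unique.DecPropositional.Properties _≟_ as Uniqueₚ
  open import Data.List.Membership.Propositional.Properties
    using (∈-map⁺; ∈-map⁻; ∈-cartesianProduct⁺; ∈-cartesianProduct⁻; ∈-deduplicate⁺; ∈-deduplicate⁻; ∈-++⁺ˡ; ∈-++⁺ʳ; ∈-++⁻)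
  open import Data.List.Properties using (length-map; length-++)
  open import Data.Product.Properties using (≡-dec)
  open import Data.Nat.Tactic.RingSolver using () renaming (solve-∀ to ℕ-ring)

  private q = card

  unique⇒length≤card : ∀ {X} → Unique X → length X ≤ q
  unique⇒length≤card u = unique-⊆⇒length-≤ u (λ {x} _ → complete x)

  -- The sets X and v - Y cannot be disjoint, for together they would have more than q elements.
  pigeonhole : ∀ {X Y} → Unique X → Unique Y → q < length X + length Y →
    ∀ v → ∃ λ x → ∃ λ y → x ∈ X × y ∈ Y × x +ᵏ y ≡ v
  pigeonhole {X} {Y} uX uY large v with Any.any? (_∈? map (λ y → v +ᵏ -ᵏ y) Y) X
  ... | yes meet = let x , x∈X , x∈v-Y = find meet
                       y , y∈Y , x≡v-y = ∈-map⁻ _ x∈v-Y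
                   in x , y , x∈X , y∈Y ,
                      trans (cong (_+ᵏ y) x≡v-y) (solve 2 (λ v y → v :+ :- y :+ y := v) refl v y)
    where open import Data.List.Membership.Propositional using (find)
  ... | no ¬meet = ⊥-elim (ℕₚ.<-irrefl refl (ℕₚ.<-≤-trans large
      (subst (_≤ q) (trans (length-++ X) (cong (length X +_) (length-map _ Y)))
        (unique⇒length≤card (Uniqueₚ.++⁺ uX (Uniqueₚ.map⁺ v-injective uY) disjoint)))))
    where
    open import Data.List.Membership.Propositional using (lose)
    v-injective : ∀ {y z} → v +ᵏ -ᵏ y ≡ v +ᵏ -ᵏ z → y ≡ z
    v-injective {y} {z} e = x-y≡0⇒x≡y
      (trans (solve 3 (λ v y z → y :+ :- z := v :+ :- z :+ :- (v :+ :- y)) refl v y z) (x≡y⇒x-y≡0 (sym e)))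
    disjoint : ∀ {x} → x ∈ X × x ∈ map (λ y → v +ᵏ -ᵏ y) Y → ⊥
    disjoint (x∈X , x∈) = ¬meet (lose x∈X x∈)

  module Lines {A C : List Carrier} (uA : Unique A) (uC : Unique C) where
    AC : List (Carrier × Carrier)
    AC = cartesianProduct A C

    m : ℕ
    m = length AC

    line : Carrier → Carrier × Carrier → Carrier
    line b (a , c) = a *ᵏ b +ᵏ c

    -- Ordered pairs of lines that meet above the abscissa `b`, each line paired with itself
    -- included.
    energy : Carrier → ℕ
    energy b = collisions AC (line b)

    private
      _≟²_ : DecidableEquality (Carrier × Carrier)
      _≟²_ = ≡-dec _≟_ _≟_

      meet : ∀ i j → ∑ elements (λ b → ⟪ line b i ≟ line b j ⟫) ≤ 1 + q * ⟪ i ≟² j ⟫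
      meet i@(a , c) j@(a' , c') with i ≟² j
      ... | yes _ = ℕₚ.≤-trans (∑-bound 1 elements (λ _ → ⟪⟫≤1 (_ ≟ _))) (ℕₚ.m≤n+m _ 1)
      ... | no i≢j = ℕₚ.≤-trans (∑-atMostOne (λ b → line b i ≟ line b j) elements-unique once) (ℕₚ.m≤m+n 1 _)
        where
        once : ∀ {b b'} → line b i ≡ line b j → line b' i ≡ line b' j → b ≡ b'
        once {b} {b'} e e' with a ≟ a'
        ... | yes refl = ⊥-elim (i≢j (cong (a ,_) (+-cancelˡ e)))
        ... | no a≢a' = x-y≡0⇒x≡y (*-cancelˡ-0 (a≢a' ∘ x-y≡0⇒x≡y) (begin
          (a +ᵏ -ᵏ a') *ᵏ (b +ᵏ -ᵏ b')
            ≡⟨ solve 6 (λ a a' b b' c c' → (a :+ :- a') :* (b :+ :- b') :=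
                 (a :* b :+ c) :+ :- (a' :* b :+ c') :+ :- ((a :* b' :+ c) :+ :- (a' :* b' :+ c'))) refl a a' b b' c c' ⟩
          line b i +ᵏ -ᵏ line b j +ᵏ -ᵏ (line b' i +ᵏ -ᵏ line b' j)
            ≡⟨ cong₂ (λ x y → x +ᵏ -ᵏ y) (x≡y⇒x-y≡0 e) (x≡y⇒x-y≡0 e') ⟩
          0ᵏ +ᵏ -ᵏ 0ᵏ
            ≡⟨ -‿inverseʳ 0ᵏ ⟩
          0ᵏ ∎))
          where open ≡-Reasoning

    -- Two distinct lines y = a b + c meet at most once.
    total-energy : ∑ elements energy ≤ m * m + q * m
    total-energy = begin
      ∑ elements energy
        ≡⟨ ∑-swap elements AC _ ⟩
      ∑ AC (λ i → ∑ elements (λ b → ∑ AC (λ j → ⟪ line b i ≟ line b j ⟫)))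
        ≡⟨ ∑-cong AC (λ i → ∑-swap elements AC _) ⟩
      ∑ AC (λ i → ∑ AC (λ j → ∑ elements (λ b → ⟪ line b i ≟ line b j ⟫)))
        ≤⟨ ∑-mono AC (λ {i} _ → ∑-mono AC (λ {j} _ → meet i j)) ⟩
      ∑ AC (λ i → ∑ AC (λ j → 1 + q * ⟪ i ≟² j ⟫))
        ≡⟨ ∑-cong AC (λ i → trans (∑-distrib-+ AC _ _) (cong₂ _+_ (∑-const 1 AC) (sym (*-distribˡ-∑ q AC _)))) ⟩
      ∑ AC (λ i → m * 1 + q * ∑ AC (λ j → ⟪ i ≟² j ⟫))
        ≤⟨ ∑-bound (m * 1 + q * 1) AC (λ {i} _ → ℕₚ.+-monoʳ-≤ (m * 1)
             (ℕₚ.*-monoʳ-≤ q (∑-atMostOne (i ≟²_) (Uniqueₚ.cartesianProduct⁺ uA uC) (λ e e' → trans (sym e) e')))) ⟩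
      m * (m * 1 + q * 1)
        ≡⟨ rearrange m q ⟩
      m * m + q * m ∎
      where
      open ℕₚ.≤-Reasoning
      rearrange : ∀ m q → m * (m * 1 + q * 1) ≡ m * m + q * m
      rearrange = ℕ-ring

    -- For b in B the values of all lines stay in Y, so the energy is at least m²/N; elsewhere it is
    -- at least m²/q. The total energy is at most m² + q m, which leaves m |B| (q - N) ≤ q² N, the
    -- claim after rearrangement.
    sumset-growth : ∀ {B Y} → Unique B → Unique Y → (∀ {i b} → i ∈ AC → b ∈ B → line b i ∈ Y) →
      m * length B * q ≤ length Y * (q * q + m * length B)
    sumset-growth {B} {Y} uB uY sub = finish
      where
      open ℕₚ.≤-Reasoning
      N = length Y
      r = q ∸ N
      N+r≡q : N + r ≡ q
      N+r≡q = ℕₚ.m+[n∸m]≡n (unique⇒length≤card uY)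
      χ : Carrier → ℕ
      χ b = ∑ B (λ b' → ⟪ b ≟ b' ⟫)

      |B|≤∑χ : length B ≤ ∑ elements χ
      |B|≤∑χ = begin
        length B                                          ≡⟨ sym (ℕₚ.*-identityʳ _) ⟩
        length B * 1                                      ≡⟨ sym (∑-const 1 B) ⟩
        ∑ B (λ _ → 1)                                     ≤⟨ ∑-mono B (λ {b'} _ → ∑-member (_≟ b') (complete b') refl) ⟩
        ∑ B (λ b' → ∑ elements (λ b → ⟪ b ≟ b' ⟫))        ≡⟨ ∑-swap B elements _ ⟩
        ∑ elements χ                                      ∎

      -- Both lower bounds for the energy in one formula, multiplied by q N; `χ` is the indicator of
      -- B.
      pointwise : ∀ b → N * (m * m) + χ b * (r * (m * m)) ≤ q * N * energy b
      pointwise b with b ∈? B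
      ... | yes b∈B = begin
        N * (m * m) + χ b * (r * (m * m))    ≤⟨ ℕₚ.+-monoʳ-≤ _ (ℕₚ.*-monoˡ-≤ _ (∑-atMostOne (b ≟_) uB (λ e e' → trans (sym e) e'))) ⟩
        N * (m * m) + 1 * (r * (m * m))      ≡⟨ regroup N r (m * m) ⟩
        (N + r) * (m * m)                    ≡⟨ cong (_* (m * m)) N+r≡q ⟩
        q * (m * m)                          ≤⟨ ℕₚ.*-monoʳ-≤ q (length²≤image*collisions AC (line b) uY (λ i∈ → sub i∈ b∈B)) ⟩
        q * (N * energy b)                   ≡⟨ sym (ℕₚ.*-assoc q N _) ⟩
        q * N * energy b                     ∎
        where
        regroup : ∀ n r k → n * k + 1 * (r * k) ≡ (n + r) * k
        regroup = ℕ-ring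
      ... | no b∉B = begin
        N * (m * m) + χ b * (r * (m * m))    ≡⟨ cong (λ k → N * (m * m) + k * (r * (m * m))) χ≡0 ⟩
        N * (m * m) + 0                      ≡⟨ ℕₚ.+-identityʳ _ ⟩
        N * (m * m)                          ≤⟨ ℕₚ.*-monoʳ-≤ N (length²≤image*collisions AC (line b) elements-unique (λ _ → complete _)) ⟩
        N * (q * energy b)                   ≡⟨ regroup N q (energy b) ⟩
        q * N * energy b                     ∎
        where
        regroup : ∀ n q e → n * (q * e) ≡ q * n * e
        regroup = ℕ-ring
        χ≡0 : χ b ≡ 0
        χ≡0 = ℕₚ.n≤0⇒n≡0 (ℕₚ.≤-trans
          (∑-bound 0 B (λ {b'} b'∈B → ℕₚ.≤-reflexive (⟪⟫-no (b ≟ b') (λ { refl → b∉B b'∈B }))))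
          (ℕₚ.≤-reflexive (ℕₚ.*-zeroʳ (length B))))

      summed : q * (N * (m * m)) + length B * (r * (m * m)) ≤ q * N * (m * m + q * m)
      summed = begin
        q * (N * (m * m)) + length B * (r * (m * m))
          ≤⟨ ℕₚ.+-monoʳ-≤ (q * (N * (m * m))) (ℕₚ.*-monoˡ-≤ _ |B|≤∑χ) ⟩
        q * (N * (m * m)) + ∑ elements χ * (r * (m * m))
          ≡⟨ sym (trans (∑-distrib-+ elements _ _) (cong₂ _+_ (∑-const _ elements) (sym (*-distribʳ-∑ _ elements χ)))) ⟩
        ∑ elements (λ b → N * (m * m) + χ b * (r * (m * m)))
          ≤⟨ ∑-mono elements (λ {b} _ → pointwise b) ⟩
        ∑ elements (λ b → q * N * energy b)
          ≡⟨ sym (*-distribˡ-∑ (q * N) elements energy) ⟩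
        q * N * ∑ elements energy
          ≤⟨ ℕₚ.*-monoʳ-≤ (q * N) total-energy ⟩
        q * N * (m * m + q * m) ∎

      -- The number of lines is generalised so that the case of no lines, in which m cannot be
      -- cancelled, can be split off.
      cancelled : ∀ m → q * (N * (m * m)) + length B * (r * (m * m)) ≤ q * N * (m * m + q * m) →
        m * (length B * r) ≤ q * q * N
      cancelled zero _ = z≤n
      cancelled m@(suc _) h = ℕₚ.*-cancelˡ-≤ m (ℕₚ.+-cancelˡ-≤ (q * (N * (m * m))) _ _
        (subst (_≤ q * (N * (m * m)) + m * (q * q * N)) (cong (λ k → q * (N * (m * m)) + k) (lhs (length B) r m))
          (ℕₚ.≤-trans h (ℕₚ.≤-reflexive (rhs q N m)))))
        where
        lhs : ∀ b r m → b * (r * (m * m)) ≡ m * (m * (b * r))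
        lhs = ℕ-ring
        rhs : ∀ q n m → q * n * (m * m + q * m) ≡ q * (n * (m * m)) + m * (q * q * n)
        rhs = ℕ-ring

      finish : m * length B * q ≤ N * (q * q + m * length B)
      finish = begin
        m * length B * q                          ≡⟨ cong (m * length B *_) (sym N+r≡q) ⟩
        m * length B * (N + r)                    ≡⟨ split m (length B) N r ⟩
        N * (m * length B) + m * (length B * r)   ≤⟨ ℕₚ.+-monoʳ-≤ _ (cancelled m summed) ⟩
        N * (m * length B) + q * q * N            ≡⟨ join m (length B) N q ⟩
        N * (q * q + m * length B)                ∎
        where
        split : ∀ m b n r → m * b * (n + r) ≡ n * (m * b) + m * (b * r)
        split = ℕ-ring
        join : ∀ m b n q → n * (m * b) + q * q * n ≡ n * (q * q + m * b)
        join = ℕ-ring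

    -- Averaging: if every ξ exceeded this bound, the sum over the q elements would exceed the total
    -- energy.
    lowEnergy : ∃ λ ξ → q * energy ξ ≤ q * m + m * m
    lowEnergy with Any.any? (λ ξ → q * energy ξ ℕₚ.≤? q * m + m * m) elements
    ... | yes found = Any.satisfied found
    ... | no none = ⊥-elim (ℕₚ.<-irrefl refl (begin-strict
      q * (m * m + q * m)                         <⟨ ℕₚ.*-monoʳ-< q {{>-nonZero 0<card}} (ℕₚ.n<1+n _) ⟩
      q * suc (m * m + q * m)                     ≡⟨ cong (λ k → q * suc k) (ℕₚ.+-comm (m * m) (q * m)) ⟩
      q * suc (q * m + m * m)                     ≡⟨ sym (∑-const _ elements) ⟩
      ∑ elements (λ _ → suc (q * m + m * m))      ≤⟨ ∑-mono elements (λ ξ∈ → ℕₚ.≰⇒> (λ le → none (lose ξ∈ le))) ⟩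
      ∑ elements (λ ξ → q * energy ξ)             ≡⟨ sym (*-distribˡ-∑ q elements energy) ⟩
      q * ∑ elements energy                       ≤⟨ ℕₚ.*-monoʳ-≤ q total-energy ⟩
      q * (m * m + q * m)                         ∎))
      where
      open ℕₚ.≤-Reasoning
      open import Data.List.Membership.Propositional using (lose)

    -- Exchanging the two slopes turns a (-ξ) + c = a' (-ξ) + c' into a' ξ + c = a ξ + c'. Hence a
    -- single ξ of low energy serves both for C + ξ A and for C - ξ A.
    energy-neg : ∀ ξ → energy (-ᵏ ξ) ≤ energy ξ
    energy-neg ξ = begin
      energy (-ᵏ ξ)
        ≡⟨ expand (-ᵏ ξ) ⟩
      ∑ A (λ a → ∑ A (λ a' → ∑ C (λ c → ∑ C (λ c' → ⟪ line (-ᵏ ξ) (a , c) ≟ line (-ᵏ ξ) (a' , c') ⟫))))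
        ≤⟨ ∑-mono A (λ {a} _ → ∑-mono A (λ {a'} _ → ∑-mono C (λ {c} _ → ∑-mono C (λ {c'} _ →
             ⟪⟫-mono (_ ≟ _) (_ ≟ _) (flip a a' c c'))))) ⟩
      ∑ A (λ a → ∑ A (λ a' → ∑ C (λ c → ∑ C (λ c' → ⟪ line ξ (a' , c) ≟ line ξ (a , c') ⟫))))
        ≡⟨ ∑-swap A A _ ⟩
      ∑ A (λ a' → ∑ A (λ a → ∑ C (λ c → ∑ C (λ c' → ⟪ line ξ (a' , c) ≟ line ξ (a , c') ⟫))))
        ≡⟨ sym (expand ξ) ⟩
      energy ξ ∎
      where
      open ℕₚ.≤-Reasoning
      expand : ∀ b → energy b ≡
        ∑ A (λ a → ∑ A (λ a' → ∑ C (λ c → ∑ C (λ c' → ⟪ line b (a , c) ≟ line b (a' , c') ⟫))))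
      expand b = trans (∑-product A C _) (∑-cong A (λ a →
        trans (∑-cong C (λ c → ∑-product A C _)) (∑-swap C A _)))
      flip : ∀ a a' c c' → a *ᵏ -ᵏ ξ +ᵏ c ≡ a' *ᵏ -ᵏ ξ +ᵏ c' → a' *ᵏ ξ +ᵏ c ≡ a *ᵏ ξ +ᵏ c'
      flip a a' c c' e = x-y≡0⇒x≡y (trans
        (solve 5 (λ a a' c c' ξ → a' :* ξ :+ c :+ :- (a :* ξ :+ c') := a :* :- ξ :+ c :+ :- (a' :* :- ξ :+ c'))
          refl a a' c c' ξ)
        (x≡y⇒x-y≡0 e))

    -- Cauchy-Schwarz gives an image of at least q m / (q + m) elements, which is more than q/2 as
    -- soon as m exceeds q.
    lowEnergy⇒large-image : ∀ ξ → q < m → q * energy ξ ≤ q * m + m * m →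
      let X = deduplicate _≟_ (map (line ξ) AC) in q < length X + length X
    lowEnergy⇒large-image ξ q<m low = ℕₚ.≰⇒> (λ 2N≤q → ℕₚ.<⇒≱ q<m (ℕₚ.+-cancelˡ-≤ (q * m) _ _ (ε 2N≤q)))
      where
      open ℕₚ.≤-Reasoning
      X = deduplicate _≟_ (map (line ξ) AC)
      N = length X
      instance
        m-nonZero : NonZero m
        m-nonZero = >-nonZero (ℕₚ.≤-<-trans z≤n q<m)
        q-nonZero : NonZero q
        q-nonZero = >-nonZero 0<card
      qm≤ : q * m ≤ N * (q + m)
      qm≤ = ℕₚ.*-cancelʳ-≤ _ _ m (begin
        q * m * m            ≡⟨ ℕₚ.*-assoc q m m ⟩
        q * (m * m)          ≤⟨ ℕₚ.*-monoʳ-≤ q (length²≤image*collisions AC (line ξ) (Uniqueₚ.deduplicate-! _)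
                                  (λ i∈ → ∈-deduplicate⁺ _≟_ (∈-map⁺ (line ξ) i∈))) ⟩
        q * (N * energy ξ)   ≡⟨ e₁ q N (energy ξ) ⟩
        N * (q * energy ξ)   ≤⟨ ℕₚ.*-monoʳ-≤ N low ⟩
        N * (q * m + m * m)  ≡⟨ e₂ N q m ⟩
        N * (q + m) * m      ∎)
        where
        e₁ : ∀ q n e → q * (n * e) ≡ n * (q * e)
        e₁ = ℕ-ring
        e₂ : ∀ n q m → n * (q * m + m * m) ≡ n * (q + m) * m
        e₂ = ℕ-ring
      ε : N + N ≤ q → q * m + m ≤ q * m + q
      ε 2N≤q = ℕₚ.+-monoʳ-≤ (q * m) (ℕₚ.+-cancelˡ-≤ m _ _ (ℕₚ.*-cancelˡ-≤ q (begin
        q * (m + m)                    ≡⟨ e₁ q m ⟩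
        q * m + q * m                  ≤⟨ ℕₚ.+-mono-≤ qm≤ qm≤ ⟩
        N * (q + m) + N * (q + m)      ≡⟨ e₂ N q m ⟩
        (N + N) * (q + m)              ≤⟨ ℕₚ.*-monoˡ-≤ (q + m) 2N≤q ⟩
        q * (q + m)                    ≡⟨ cong (q *_) (ℕₚ.+-comm q m) ⟩
        q * (m + q)                    ∎)))
        where
        e₁ : ∀ q m → q * (m + m) ≡ q * m + q * m
        e₁ = ℕ-ring
        e₂ : ∀ n q m → n * (q + m) + n * (q + m) ≡ (n + n) * (q + m)
        e₂ = ℕ-ring

  record Represented (A C : List Carrier) (ζ w : Carrier) : Set where
    field
      {a a' c c'} : Carrier
      a∈ : a ∈ A
      a'∈ : a' ∈ A
      c∈ : c ∈ C
      c'∈ : c' ∈ C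
      sum≡ : a *ᵏ ζ +ᵏ c +ᵏ (a' *ᵏ ζ +ᵏ c') ≡ w

  record EightProducts (A C : List Carrier) (v : Carrier) : Set where
    field
      {a₁ a₂ a₃ a₄ c₁ c₂ c₃ c₄} : Carrier
      a₁∈ : a₁ ∈ A
      a₂∈ : a₂ ∈ A
      a₃∈ : a₃ ∈ A
      a₄∈ : a₄ ∈ A
      c₁∈ : c₁ ∈ C
      c₂∈ : c₂ ∈ C
      c₃∈ : c₃ ∈ C
      c₄∈ : c₄ ∈ C
      sum≡ : (a₁ +ᵏ a₂) *ᵏ (c₃ +ᵏ c₄) +ᵏ (c₁ +ᵏ c₂) *ᵏ (a₃ +ᵏ a₄) ≡ v

  -- After Glibichuk: for a suitable ξ both C + ξ A and C - ξ A fill more than half of the field. The second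
  -- gives c₁ + c₂ = ξ (a₁ + a₂); multiplying the doubled first set by a₁ + a₂ turns ξ into products again.
  module _ {A C : List Carrier} (uA : Unique A) (uC : Unique C) (antisymmetric : ∀ {c c'} → c ∈ C → c' ∈ C → c +ᵏ c' ≢ 0ᵏ)
           (large : q < length (cartesianProduct A C)) where
    private
      module L = Lines uA uC
      ξ = proj₁ L.lowEnergy

      represent : ∀ ζ → L.energy ζ ≤ L.energy ξ → ∀ w → Represented A C ζ w
      represent ζ le w = unpack (pigeonhole (Uniqueₚ.deduplicate-! X) (Uniqueₚ.deduplicate-! X)
          (L.lowEnergy⇒large-image ζ large (ℕₚ.≤-trans (ℕₚ.*-monoʳ-≤ q le) (proj₂ L.lowEnergy))) w)
        where
        X = map (L.line ζ) L.AC
        unpack : (∃ λ x → ∃ λ y → x ∈ deduplicate _≟_ X × y ∈ deduplicate _≟_ X × x +ᵏ y ≡ w) → Represented A C ζ w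
        unpack (x , y , x∈ , y∈ , e) = record
          { a∈ = proj₁ ac∈ ; c∈ = proj₂ ac∈ ; a'∈ = proj₁ ac'∈ ; c'∈ = proj₂ ac'∈
          ; sum≡ = trans (cong₂ _+ᵏ_ (sym (proj₂ (proj₂ i))) (sym (proj₂ (proj₂ j)))) e }
          where
          i = ∈-map⁻ (L.line ζ) (∈-deduplicate⁻ _≟_ X x∈)
          j = ∈-map⁻ (L.line ζ) (∈-deduplicate⁻ _≟_ X y∈)
          ac∈ = ∈-cartesianProduct⁻ A C (proj₁ (proj₂ i))
          ac'∈ = ∈-cartesianProduct⁻ A C (proj₁ (proj₂ j))

    eight-products : ∀ v → EightProducts A C v
    eight-products v = record
      { a₁∈ = R.a∈ ; a₂∈ = R.a'∈ ; c₁∈ = R.c∈ ; c₂∈ = R.c'∈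
      ; a₃∈ = R'.a∈ ; a₄∈ = R'.a'∈ ; c₃∈ = R'.c∈ ; c₄∈ = R'.c'∈ ; sum≡ = eq }
      where
      module R = Represented (represent (-ᵏ ξ) (L.energy-neg ξ) 0ᵏ)
      s = R.a +ᵏ R.a'
      c≡ξs : R.c +ᵏ R.c' ≡ ξ *ᵏ s
      c≡ξs = x-y≡0⇒x≡y (trans (solve 5 (λ a a' c c' ξ → c :+ c' :+ :- (ξ :* (a :+ a')) :=
        a :* :- ξ :+ c :+ (a' :* :- ξ :+ c')) refl R.a R.a' R.c R.c' ξ) R.sum≡)
      -- Were a₁ + a₂ zero, c₁ + c₂ = ξ (a₁ + a₂) would vanish too, which the antisymmetry of C
      -- forbids.
      s≢0 : s ≢ 0ᵏ
      s≢0 s≡0 = antisymmetric R.c∈ R.c'∈ (trans c≡ξs (trans (cong (ξ *ᵏ_) s≡0) (zeroʳ ξ)))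
      s⁻¹ = proj₁ (inverse s s≢0)
      module R' = Represented (represent ξ ℕₚ.≤-refl (v *ᵏ s⁻¹))
      eq : s *ᵏ (R'.c +ᵏ R'.c') +ᵏ (R.c +ᵏ R.c') *ᵏ (R'.a +ᵏ R'.a') ≡ v
      eq = begin
        s *ᵏ (R'.c +ᵏ R'.c') +ᵏ (R.c +ᵏ R.c') *ᵏ (R'.a +ᵏ R'.a')
          ≡⟨ cong (λ z → s *ᵏ (R'.c +ᵏ R'.c') +ᵏ z *ᵏ (R'.a +ᵏ R'.a')) c≡ξs ⟩
        s *ᵏ (R'.c +ᵏ R'.c') +ᵏ ξ *ᵏ s *ᵏ (R'.a +ᵏ R'.a')
          ≡⟨ solve 6 (λ s ξ a a' c c' → s :* (c :+ c') :+ ξ :* s :* (a :+ a') :=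
               s :* (a :* ξ :+ c :+ (a' :* ξ :+ c'))) refl s ξ R'.a R'.a' R'.c R'.c' ⟩
        s *ᵏ (R'.a *ᵏ ξ +ᵏ R'.c +ᵏ (R'.a' *ᵏ ξ +ᵏ R'.c'))
          ≡⟨ cong (s *ᵏ_) R'.sum≡ ⟩
        s *ᵏ (v *ᵏ s⁻¹)
          ≡⟨ solve 3 (λ v s i → s :* (v :* i) := v :* (s :* i)) refl v s s⁻¹ ⟩
        v *ᵏ (s *ᵏ s⁻¹)
          ≡⟨ cong (v *ᵏ_) (proj₂ (inverse s s≢0)) ⟩
        v *ᵏ 1ᵏ
          ≡⟨ *-identityʳ v ⟩
        v ∎
        where open ≡-Reasoning

  -- Greedy choice: an element is taken unless it is 0 or plus or minus one already taken, so that S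
  -- stays inside {0} ∪ C ∪ -C. The set 2G is symmetric when -1 lies in G, hence the need to halve
  -- it; `odd` excludes c + c = 0 for a chosen c.
  antisymmetric-half : (∀ x → x +ᵏ x ≡ 0ᵏ → x ≡ 0ᵏ) → ∀ {S} → Unique S → ∃ λ C → Unique C ×
    (∀ {c} → c ∈ C → c ∈ S) × (∀ {c c'} → c ∈ C → c' ∈ C → c +ᵏ c' ≢ 0ᵏ) × length S ≤ suc (length C + length C)
  antisymmetric-half odd {S} uS =
    let C , uC , sub , anti , cover = build uS
    in C , uC , sub , anti ,
       subst (λ n → length S ≤ suc n) (trans (length-++ C) (cong (length C +_) (length-map _ C)))
         (unique-⊆⇒length-≤ uS cover)
    where
    neg-neg : ∀ x → x ≡ -ᵏ (-ᵏ x)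
    neg-neg = solve 1 (λ x → x := :- (:- x)) refl
    build : ∀ {S} → Unique S → ∃ λ C → Unique C × (∀ {c} → c ∈ C → c ∈ S) ×
      (∀ {c c'} → c ∈ C → c' ∈ C → c +ᵏ c' ≢ 0ᵏ) × (∀ {x} → x ∈ S → x ∈ 0ᵏ ∷ C ++ map -ᵏ_ C)
    build {[]} [] = [] , [] , (λ ()) , (λ ()) , (λ ())
    build {x ∷ S} (x∉S ∷ uS) with build uS
    ... | C , uC , sub , anti , cover with x ∈? (0ᵏ ∷ C ++ map -ᵏ_ C)
    ... | yes x∈ = C , uC , there ∘ sub , anti , (λ { (here refl) → x∈ ; (there x∈S) → cover x∈S })
    ... | no x∉ = x ∷ C , All.tabulate (λ c∈ e → All.lookup x∉S (sub c∈) e) ∷ uC ,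
        (λ { (here refl) → here refl ; (there c∈) → there (sub c∈) }) , anti' , cover'
      where
      opposite : ∀ {c} → c ∈ C → x +ᵏ c ≢ 0ᵏ
      opposite {c} c∈ e = x∉ (there (∈-++⁺ʳ C (subst (_∈ map -ᵏ_ C) (sym x≡-c) (∈-map⁺ -ᵏ_ c∈))))
        where
        x≡-c : x ≡ -ᵏ c
        x≡-c = x-y≡0⇒x≡y (trans (cong (x +ᵏ_) (sym (neg-neg c))) e)
      anti' : ∀ {c c'} → c ∈ x ∷ C → c' ∈ x ∷ C → c +ᵏ c' ≢ 0ᵏ
      anti' (here refl) (here refl) e = x∉ (here (odd x e))
      anti' (here refl) (there c'∈) e = opposite c'∈ e
      anti' (there c∈) (here refl) e = opposite c∈ (trans (+ᵏ-comm x _) e)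
      anti' (there c∈) (there c'∈) e = anti c∈ c'∈ e
      cover' : ∀ {y} → y ∈ x ∷ S → y ∈ 0ᵏ ∷ (x ∷ C) ++ map -ᵏ_ (x ∷ C)
      cover' (here refl) = there (here refl)
      cover' (there y∈S) with cover y∈S
      ... | here e = here e
      ... | there y∈ with ∈-++⁻ C y∈
      ... | inj₁ y∈C = there (there (∈-++⁺ˡ y∈C))
      ... | inj₂ y∈-C = there (there (∈-++⁺ʳ C (there y∈-C)))

-- Sums of a prescribed number of elements of G, and the growth of sets of them.

module Sumsets (𝔽 : FiniteField) (G : FiniteField.Carrier 𝔽 → Set)
  (G-closed : ∀ {x y} → G x → G y → G (FiniteField._*ᵏ_ 𝔽 x y)) where
  open FiniteField 𝔽
  open SumProduct 𝔽
  open Collisions _≟_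
  import Data.List.Relation.Unary.Unique.DecPropositional.Properties _≟_ as Uniqueₚ
  open import Data.List.Membership.Propositional.Properties
    using (∈-map⁺; ∈-map⁻; ∈-cartesianProduct⁺; ∈-cartesianProduct⁻; ∈-deduplicate⁺; ∈-deduplicate⁻)
  open import Data.Nat.Tactic.RingSolver using () renaming (solve-∀ to ℕ-ring)

  private q = card

  data Sums : ℕ → Carrier → Set where
    nil : Sums 0 0ᵏ
    cons : ∀ {n g x} → G g → Sums n x → Sums (suc n) (g +ᵏ x)

  Sums-singleton : ∀ {g} → G g → Sums 1 g
  Sums-singleton Gg = subst (Sums 1) (+-identityʳ _) (cons Gg nil)

  Sums-+ : ∀ {i j x y} → Sums i x → Sums j y → Sums (i + j) (x +ᵏ y)
  Sums-+ nil t = subst (Sums _) (sym (+-identityˡ _)) t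
  Sums-+ (cons g s) t = subst (Sums _) (sym (+ᵏ-assoc _ _ _)) (cons g (Sums-+ s t))

  Sums-scale : ∀ {g n x} → G g → Sums n x → Sums n (g *ᵏ x)
  Sums-scale Gg nil = subst (Sums 0) (sym (zeroʳ _)) nil
  Sums-scale Gg (cons Gh s) = subst (Sums _) (sym (distribˡ _ _ _)) (cons (G-closed Gg Gh) (Sums-scale Gg s))

  -- Expanding the product gives i j terms, each a product of two elements of G and so in G again.
  Sums-* : ∀ {i j x y} → Sums i x → Sums j y → Sums (i * j) (x *ᵏ y)
  Sums-* nil t = subst (Sums 0) (sym (zeroˡ _)) nil
  Sums-* (cons g s) t = subst (Sums _) (sym (distribʳ _ _ _)) (Sums-+ (Sums-scale g t) (Sums-* s t))

  AllSums : ℕ → Set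
  AllSums k = ∀ v → Sums k v

  -- Surplus terms are spent on copies of a fixed g, subtracted from the target beforehand.
  AllSums-≤ : ∀ {g} → G g → ∀ {k l} → k ≤ l → AllSums k → AllSums l
  AllSums-≤ {g} Gg {k} {l} k≤l all = subst AllSums (ℕₚ.m∸n+n≡m k≤l) (extend (l ∸ k))
    where
    extend : ∀ d → AllSums (d + k)
    extend zero = all
    extend (suc d) v = subst (Sums _) (solve 2 (λ g v → g :+ (v :+ :- g) := v) refl g v)
      (cons Gg (extend d (v +ᵏ -ᵏ g)))

  record SumSubset (k : ℕ) : Set where
    field
      points : List Carrier
      unique : Unique points
      sums : ∀ {x} → x ∈ points → Sums k x
    size : ℕ
    size = length points
  open SumSubset

  -- The line inequality for Y = A B + C, with slopes from A, abscissae from B and intercepts from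
  -- C.
  product-sum : ∀ {i j l} (A : SumSubset i) (B : SumSubset j) (C : SumSubset l) → Σ (SumSubset (i * j + l)) λ Y →
    size A * size B * size C * q ≤ size Y * (q * q + size A * size B * size C)
  product-sum A B C = Y , subst (λ m → m * q ≤ size Y * (q * q + m)) m|B|≡
      (sumset-growth (unique B) (unique Y) (λ i∈ b∈ → ∈-deduplicate⁺ _≟_ (∈-map⁺ point (∈-cartesianProduct⁺ i∈ b∈))))
    where
    open Lines (unique A) (unique C)
    point : (Carrier × Carrier) × Carrier → Carrier
    point (i , b) = line b i
    Y : SumSubset _
    Y = record
      { points = deduplicate _≟_ (map point (cartesianProduct AC (points B)))
      ; unique = Uniqueₚ.deduplicate-! (map point (cartesianProduct AC (points B)))
      ; sums = λ x∈ → let (((a , c) , b) , ib∈ , x≡) = ∈-map⁻ point (∈-deduplicate⁻ _≟_ _ x∈)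
                          i∈ , b∈ = ∈-cartesianProduct⁻ AC (points B) ib∈
                          a∈ , c∈ = ∈-cartesianProduct⁻ (points A) (points C) i∈
                      in subst (Sums _) (sym x≡) (Sums-+ (Sums-* (sums A a∈) (sums B b∈)) (sums C c∈)) }
    m|B|≡ : m * size B ≡ size A * size B * size C
    m|B|≡ = trans (cong (_* size B) (length-cartesianProduct (points A) (points C))) (swap (size A) (size C) (size B))
      where
      swap : ∀ a c b → a * c * b ≡ a * b * c
      swap = ℕ-ring

  cover : ∀ {i j} (X : SumSubset i) (D : SumSubset j) → q < size X + size D → AllSums (i + j)
  cover X D large v = let x , d , x∈ , d∈ , e = pigeonhole (unique X) (unique D) large v
                      in subst (Sums _) e (Sums-+ (sums X x∈) (sums D d∈))

  -- Let P = |A| |B| |C|. If P ≤ q², the denominator q² + P is at most 2 q², so |Y| ≥ P / (2 q); if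
  -- P > q², it is below 2 P, so Y fills more than half of the field.
  grow : ∀ {i j l} (A : SumSubset i) (B : SumSubset j) (C : SumSubset l) → Σ (SumSubset (i * j + l)) λ Y →
    q < size Y + size Y ⊎ size A * size B * size C ≤ 2 * q * size Y
  grow A B C = Y , bound (size A * size B * size C) (size Y) (proj₂ (product-sum A B C))
    where
    Y = proj₁ (product-sum A B C)
    open ℕₚ.≤-Reasoning
    bound : ∀ P N → P * q ≤ N * (q * q + P) → q < N + N ⊎ P ≤ 2 * q * N
    bound P N h with ℕₚ.≤-<-connex P (q * q)
    ... | inj₁ P≤q² = inj₂ (ℕₚ.*-cancelʳ-≤ P _ q {{>-nonZero 0<card}} (begin
      P * q                  ≤⟨ h ⟩
      N * (q * q + P)        ≤⟨ ℕₚ.*-monoʳ-≤ N (ℕₚ.+-monoʳ-≤ (q * q) P≤q²) ⟩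
      N * (q * q + q * q)    ≡⟨ eq N q ⟩
      2 * q * N * q          ∎))
      where
      eq : ∀ n q → n * (q * q + q * q) ≡ 2 * q * n * q
      eq = ℕ-ring
    bound P zero h | inj₂ q²<P = ⊥-elim (ℕₚ.<⇒≱ (ℕₚ.*-mono-< (ℕₚ.≤-<-trans z≤n q²<P) 0<card) h)
    bound P N@(suc _) h | inj₂ q²<P = inj₁ (ℕₚ.*-cancelˡ-< P q (N + N) (begin-strict
      P * q                  ≤⟨ h ⟩
      N * (q * q + P)        <⟨ ℕₚ.*-monoʳ-< N (ℕₚ.+-monoˡ-< P q²<P) ⟩
      N * (P + P)            ≡⟨ eq N P ⟩
      P * (N + N)            ∎))
      where
      eq : ∀ n p → n * (p + p) ≡ p * (n + n)
      eq = ℕ-ring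

  -- If A B + C + D missed a point, pigeonhole would give |D| ≤ q - N for N = |A B + C|, and the
  -- line inequality bounds P (q - N) by N q² ≤ q³, where P = |A| |B| |C|.
  cover-product : ∀ {i j l n} (A : SumSubset i) (B : SumSubset j) (C : SumSubset l) (D : SumSubset n) →
    q * q * q < size A * size B * size C * size D → AllSums (i * j + l + n)
  cover-product A B C D large with ℕₚ.≤-<-connex (size (proj₁ (product-sum A B C)) + size D) q
  ... | inj₂ q<Y+D = cover (proj₁ (product-sum A B C)) D q<Y+D
  ... | inj₁ Y+D≤q = ⊥-elim (ℕₚ.<⇒≱ large
      (impossible (size A * size B * size C) (size (proj₁ (product-sum A B C))) (size D)
        (unique⇒length≤card (unique (proj₁ (product-sum A B C)))) Y+D≤q (proj₂ (product-sum A B C))))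
    where
    open ℕₚ.≤-Reasoning
    impossible : ∀ P N d → N ≤ q → N + d ≤ q → P * q ≤ N * (q * q + P) → P * d ≤ q * q * q
    impossible P N d N≤q N+d≤q h = begin
      P * d                      ≤⟨ ℕₚ.+-cancelˡ-≤ (P * N) _ _ (begin
        P * N + P * d              ≡⟨ sym (ℕₚ.*-distribˡ-+ P N d) ⟩
        P * (N + d)                ≤⟨ ℕₚ.*-monoʳ-≤ P N+d≤q ⟩
        P * q                      ≤⟨ h ⟩
        N * (q * q + P)            ≡⟨ eq N q P ⟩
        P * N + N * (q * q)        ∎) ⟩
      N * (q * q)                ≤⟨ ℕₚ.*-monoˡ-≤ (q * q) N≤q ⟩
      q * (q * q)                ≡⟨ sym (ℕₚ.*-assoc q q q) ⟩
      q * q * q                  ∎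
      where
      eq : ∀ n q p → n * (q * q + p) ≡ p * n + n * (q * q)
      eq = ℕ-ring

  -- The condition reads |A| (|A| - 1) / 2 > q, and an antisymmetric half C of A has at least (|A| -
  -- 1) / 2 elements. Each of the two products has two factors made of i + i terms.
  cover-eight : (∀ x → x +ᵏ x ≡ 0ᵏ → x ≡ 0ᵏ) → ∀ {i} (A : SumSubset i) → 2 * q + size A < size A * size A →
    AllSums ((i + i) * (i + i) + (i + i) * (i + i))
  cover-eight odd A large v with antisymmetric-half odd (unique A)
  ... | C , uC , C⊆A , anti , |A|≤ = subst (Sums _) E.sum≡
      (Sums-+ (Sums-* (Sums-+ (sums A E.a₁∈) (sums A E.a₂∈)) (Sums-+ (sums A (C⊆A E.c₃∈)) (sums A (C⊆A E.c₄∈))))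
              (Sums-* (Sums-+ (sums A (C⊆A E.c₁∈)) (sums A (C⊆A E.c₂∈))) (Sums-+ (sums A E.a₃∈) (sums A E.a₄∈))))
    where
    open ℕₚ.≤-Reasoning
    q<|A||C| : q < size A * length C
    q<|A||C| = ℕₚ.*-cancelˡ-< 2 q _ (ℕₚ.+-cancelʳ-< (size A) _ _ (begin-strict
      2 * q + size A                        <⟨ large ⟩
      size A * size A                       ≤⟨ ℕₚ.*-monoʳ-≤ (size A) |A|≤ ⟩
      size A * suc (length C + length C)    ≡⟨ eq (size A) (length C) ⟩
      2 * (size A * length C) + size A      ∎))
      where
      eq : ∀ a c → a * suc (c + c) ≡ 2 * (a * c) + a
      eq = ℕ-ring
    module E = EightProducts (eight-products (unique A) uC anti
      (subst (q <_) (sym (length-cartesianProduct (points A) C)) q<|A||C|) v)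

  -- Number of terms after t steps Y ↦ S S + Y from Y = S = 2G: a product of two sums of two terms
  -- costs four.
  index : ℕ → ℕ
  index zero = 2
  index (suc t) = 4 + index t

  module _ {g} (Gg : G g) (S : SumSubset 2) where
    -- Each step multiplies |Y| by |S|² / (2 q), unless Y has come to fill more than half of the
    -- field; then Y + Y is everything.
    chain : ∀ t → AllSums (index t + index t) ⊎
      Σ (SumSubset (index t)) λ Y → size S ^ suc (2 * t) ≤ (2 * q) ^ t * size Y
    chain zero = inj₂ (S , ℕₚ.≤-reflexive (ℕₚ.*-comm (size S) 1))
    chain (suc t) with chain t
    ... | inj₁ all = inj₁ (AllSums-≤ Gg (ℕₚ.+-mono-≤ (ℕₚ.m≤n+m (index t) 4) (ℕₚ.m≤n+m (index t) 4)) all)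
    ... | inj₂ (Y , h) with grow S S Y
    ... | Y' , inj₁ large = inj₁ (cover Y' Y' large)
    ... | Y' , inj₂ bound = inj₂ (Y' , (begin
      s ^ suc (2 * suc t)                      ≡⟨ cong (λ n → s ^ suc n) (ℕₚ.*-suc 2 t) ⟩
      s * (s * (s ^ suc (2 * t)))              ≤⟨ ℕₚ.*-monoʳ-≤ s (ℕₚ.*-monoʳ-≤ s h) ⟩
      s * (s * ((2 * q) ^ t * size Y))         ≡⟨ e₁ s ((2 * q) ^ t) (size Y) ⟩
      (2 * q) ^ t * (s * s * size Y)           ≤⟨ ℕₚ.*-monoʳ-≤ ((2 * q) ^ t) bound ⟩
      (2 * q) ^ t * (2 * q * size Y')          ≡⟨ e₂ ((2 * q) ^ t) (2 * q) (size Y') ⟩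
      2 * q * (2 * q) ^ t * size Y'            ∎))
      where
      open ℕₚ.≤-Reasoning
      s = size S
      e₁ : ∀ s k y → s * (s * (k * y)) ≡ k * (s * s * y)
      e₁ = ℕ-ring
      e₂ : ∀ k r y → k * (r * y) ≡ r * k * y
      e₂ = ℕ-ring

    -- The set S S + Y + Z, with Y and Z taken from the chain after t and s steps, covers by
    -- `cover-product`. The comparisons of indices handle a chain that has already covered with
    -- twice its own index: those terms fit into the stated number.
    cover-chain : ∀ t s → index s ≤ index t → index t ≤ 4 + index s →
      (2 * q) ^ (t + s) * (q * q * q) < size S * size S * (size S ^ suc (2 * t) * size S ^ suc (2 * s)) →
      AllSums (4 + index t + index s)
    cover-chain t s s≤t t≤1+s large with chain t | chain s
    ... | inj₁ all | _ = AllSums-≤ Gg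
      (ℕₚ.≤-trans (ℕₚ.+-monoʳ-≤ (index t) t≤1+s) (ℕₚ.≤-reflexive (eq (index t) (index s)))) all
      where
      eq : ∀ a b → a + (4 + b) ≡ 4 + a + b
      eq = ℕ-ring
    ... | inj₂ _ | inj₁ all = AllSums-≤ Gg (ℕₚ.+-monoˡ-≤ (index s) (ℕₚ.≤-trans s≤t (ℕₚ.m≤n+m (index t) 4))) all
    ... | inj₂ (Y , h) | inj₂ (Z , k) = cover-product S S Y Z (ℕₚ.*-cancelˡ-< ((2 * q) ^ (t + s)) _ _ (begin-strict
      (2 * q) ^ (t + s) * (q * q * q)                                            <⟨ large ⟩
      size S * size S * (size S ^ suc (2 * t) * size S ^ suc (2 * s))            ≤⟨ ℕₚ.*-monoʳ-≤ (size S * size S) (ℕₚ.*-mono-≤ h k) ⟩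
      size S * size S * ((2 * q) ^ t * size Y * ((2 * q) ^ s * size Z))          ≡⟨ e (size S) ((2 * q) ^ t) (size Y) ((2 * q) ^ s) (size Z) ⟩
      (2 * q) ^ t * (2 * q) ^ s * (size S * size S * size Y * size Z)            ≡⟨ cong (_* (size S * size S * size Y * size Z)) (sym (ℕₚ.^-distribˡ-+-* (2 * q) t s)) ⟩
      (2 * q) ^ (t + s) * (size S * size S * size Y * size Z)                    ∎))
      where
      open ℕₚ.≤-Reasoning
      e : ∀ S a y b z → S * S * (a * y * (b * z)) ≡ a * b * (S * S * y * z)
      e = ℕ-ring

-- Polynomials as coefficient lists, and their formal derivatives.

module Polynomial (𝔽 : FiniteField) where
  open FiniteField 𝔽
  open import Algebra.Properties.Ring (CommutativeRing.ring commutativeRing) using (-0#≈0#)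

  Poly : Set
  Poly = List Carrier

  coef : Poly → ℕ → Carrier
  coef [] n = 0ᵏ
  coef (a ∷ f) zero = a
  coef (a ∷ f) (suc n) = coef f n

  infix 4 _≈ᵖ_
  -- Lists may carry trailing zeros, so polynomials are compared coefficientwise. Wrapping the
  -- comparison in a record lets both lists be read off its type.
  record _≈ᵖ_ (f g : Poly) : Set where
    constructor coefwise
    field at : ∀ n → coef f n ≡ coef g n
  open _≈ᵖ_ public

  infixl 6 _+ᵖ_
  infixl 7 _*ᵖ_
  infix 8 -ᵖ_

  _+ᵖ_ : Poly → Poly → Poly
  [] +ᵖ g = g
  (a ∷ f) +ᵖ [] = a ∷ f
  (a ∷ f) +ᵖ (b ∷ g) = (a +ᵏ b) ∷ (f +ᵖ g)

  -ᵖ_ : Poly → Poly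
  -ᵖ_ = map -ᵏ_

  scale : Carrier → Poly → Poly
  scale a = map (a *ᵏ_)

  _*ᵖ_ : Poly → Poly → Poly
  [] *ᵖ g = []
  (a ∷ f) *ᵖ g = scale a g +ᵖ (0ᵏ ∷ f *ᵖ g)

  const : Carrier → Poly
  const a = a ∷ []

  1ᵖ X : Poly
  1ᵖ = const 1ᵏ
  X = 0ᵏ ∷ 1ᵏ ∷ []

  ≈-refl : ∀ {f} → f ≈ᵖ f
  ≈-refl = coefwise (λ _ → refl)

  ≈-sym : ∀ {f g} → f ≈ᵖ g → g ≈ᵖ f
  ≈-sym e = coefwise (λ n → sym (at e n))

  ≈-trans : ∀ {f g h} → f ≈ᵖ g → g ≈ᵖ h → f ≈ᵖ h
  ≈-trans e e' = coefwise (λ n → trans (at e n) (at e' n))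

  coef-+ : ∀ f g n → coef (f +ᵖ g) n ≡ coef f n +ᵏ coef g n
  coef-+ [] g n = sym (+-identityˡ _)
  coef-+ (a ∷ f) [] n = sym (+-identityʳ _)
  coef-+ (a ∷ f) (b ∷ g) zero = refl
  coef-+ (a ∷ f) (b ∷ g) (suc n) = coef-+ f g n

  coef-neg : ∀ f n → coef (-ᵖ f) n ≡ -ᵏ coef f n
  coef-neg [] n = sym -0#≈0#
  coef-neg (a ∷ f) zero = refl
  coef-neg (a ∷ f) (suc n) = coef-neg f n

  coef-scale : ∀ a f n → coef (scale a f) n ≡ a *ᵏ coef f n
  coef-scale a [] n = sym (zeroʳ a)
  coef-scale a (b ∷ f) zero = refl
  coef-scale a (b ∷ f) (suc n) = coef-scale a f n

  coef-* : ∀ a f g n → coef ((a ∷ f) *ᵖ g) n ≡ a *ᵏ coef g n +ᵏ coef (0ᵏ ∷ f *ᵖ g) n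
  coef-* a f g n = trans (coef-+ (scale a g) _ n) (cong (_+ᵏ _) (coef-scale a g n))

  +ᵖ-cong : ∀ {f f' g g'} → f ≈ᵖ f' → g ≈ᵖ g' → f +ᵖ g ≈ᵖ f' +ᵖ g'
  +ᵖ-cong {f} {f'} {g} {g'} e e' =
    coefwise (λ n → trans (coef-+ f g n) (trans (cong₂ _+ᵏ_ (at e n) (at e' n)) (sym (coef-+ f' g' n))))

  +ᵖ-comm : ∀ f g → f +ᵖ g ≈ᵖ g +ᵖ f
  +ᵖ-comm f g = coefwise (λ n → trans (coef-+ f g n) (trans (+ᵏ-comm _ _) (sym (coef-+ g f n))))

  +ᵖ-assoc : ∀ f g h → (f +ᵖ g) +ᵖ h ≈ᵖ f +ᵖ (g +ᵖ h)
  +ᵖ-assoc f g h = coefwise λ n → begin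
    coef ((f +ᵖ g) +ᵖ h) n                 ≡⟨ trans (coef-+ (f +ᵖ g) h n) (cong (_+ᵏ _) (coef-+ f g n)) ⟩
    coef f n +ᵏ coef g n +ᵏ coef h n       ≡⟨ +ᵏ-assoc _ _ _ ⟩
    coef f n +ᵏ (coef g n +ᵏ coef h n)     ≡⟨ sym (trans (coef-+ f (g +ᵖ h) n) (cong (_ +ᵏ_) (coef-+ g h n))) ⟩
    coef (f +ᵖ (g +ᵖ h)) n                 ∎
    where open ≡-Reasoning

  +ᵖ-identityʳ : ∀ f → f +ᵖ [] ≈ᵖ f
  +ᵖ-identityʳ f = coefwise (λ n → trans (coef-+ f [] n) (+-identityʳ _))

  -ᵖ-cong : ∀ {f g} → f ≈ᵖ g → -ᵖ f ≈ᵖ -ᵖ g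
  -ᵖ-cong {f} {g} e = coefwise (λ n → trans (coef-neg f n) (trans (cong -ᵏ_ (at e n)) (sym (coef-neg g n))))

  -ᵖ-inverseʳ : ∀ f → f +ᵖ -ᵖ f ≈ᵖ []
  -ᵖ-inverseʳ f = coefwise (λ n → trans (coef-+ f (-ᵖ f) n) (trans (cong (coef f n +ᵏ_) (coef-neg f n)) (-‿inverseʳ _)))

  ∷-cong : ∀ {a f g} → f ≈ᵖ g → a ∷ f ≈ᵖ a ∷ g
  ∷-cong e = coefwise λ { zero → refl ; (suc n) → at e n }

  scale-cong : ∀ {a f g} → f ≈ᵖ g → scale a f ≈ᵖ scale a g
  scale-cong {a} {f} {g} e =
    coefwise (λ n → trans (coef-scale a f n) (trans (cong (a *ᵏ_) (at e n)) (sym (coef-scale a g n))))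

  0∷[]≈[] : 0ᵏ ∷ [] ≈ᵖ []
  0∷[]≈[] = coefwise λ { zero → refl ; (suc n) → refl }

  *ᵖ-congʳ : ∀ f {g g'} → g ≈ᵖ g' → f *ᵖ g ≈ᵖ f *ᵖ g'
  *ᵖ-congʳ [] e = ≈-refl
  *ᵖ-congʳ (a ∷ f) e = +ᵖ-cong (scale-cong e) (∷-cong (*ᵖ-congʳ f e))

  *ᵖ-zeroʳ : ∀ f → f *ᵖ [] ≈ᵖ []
  *ᵖ-zeroʳ [] = ≈-refl
  *ᵖ-zeroʳ (a ∷ f) = ≈-trans (∷-cong (*ᵖ-zeroʳ f)) 0∷[]≈[]

  *ᵖ-∷ : ∀ f b g → f *ᵖ (b ∷ g) ≈ᵖ scale b f +ᵖ (0ᵏ ∷ f *ᵖ g)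
  *ᵖ-∷ [] b g = ≈-sym 0∷[]≈[]
  *ᵖ-∷ (a ∷ f) b g = coefwise λ
    { zero → trans (coef-* a f (b ∷ g) 0) (trans (cong (_+ᵏ 0ᵏ) (*ᵏ-comm a b)) (sym (coef-+ (scale b (a ∷ f)) (0ᵏ ∷ (a ∷ f) *ᵖ g) 0)))
    ; (suc n) → begin
        coef ((a ∷ f) *ᵖ (b ∷ g)) (suc n)
          ≡⟨ coef-* a f (b ∷ g) (suc n) ⟩
        a *ᵏ coef g n +ᵏ coef (f *ᵖ (b ∷ g)) n
          ≡⟨ cong (a *ᵏ coef g n +ᵏ_) (trans (at (*ᵖ-∷ f b g) n) (trans (coef-+ (scale b f) _ n) (cong (_+ᵏ _) (coef-scale b f n)))) ⟩
        a *ᵏ coef g n +ᵏ (b *ᵏ coef f n +ᵏ coef (0ᵏ ∷ f *ᵖ g) n)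
          ≡⟨ solve 3 (λ x y z → x :+ (y :+ z) := y :+ (x :+ z)) refl _ _ _ ⟩
        b *ᵏ coef f n +ᵏ (a *ᵏ coef g n +ᵏ coef (0ᵏ ∷ f *ᵖ g) n)
          ≡⟨ cong₂ _+ᵏ_ (sym (coef-scale b f n)) (sym (coef-* a f g n)) ⟩
        coef (scale b f) n +ᵏ coef ((a ∷ f) *ᵖ g) n
          ≡⟨ sym (coef-+ (scale b (a ∷ f)) (0ᵏ ∷ (a ∷ f) *ᵖ g) (suc n)) ⟩
        coef (scale b (a ∷ f) +ᵖ (0ᵏ ∷ (a ∷ f) *ᵖ g)) (suc n) ∎ }
    where open ≡-Reasoning

  *ᵖ-comm : ∀ f g → f *ᵖ g ≈ᵖ g *ᵖ f
  *ᵖ-comm [] g = ≈-sym (*ᵖ-zeroʳ g)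
  *ᵖ-comm (a ∷ f) g = ≈-trans (+ᵖ-cong (≈-refl {scale a g}) (∷-cong (*ᵖ-comm f g))) (≈-sym (*ᵖ-∷ g a f))

  *ᵖ-cong : ∀ {f f' g g'} → f ≈ᵖ f' → g ≈ᵖ g' → f *ᵖ g ≈ᵖ f' *ᵖ g'
  *ᵖ-cong {f} {f'} {g} {g'} e e' = ≈-trans (*ᵖ-congʳ f e')
    (≈-trans (*ᵖ-comm f g') (≈-trans (*ᵖ-congʳ g' e) (*ᵖ-comm g' f')))

  scale-* : ∀ a g h → scale a g *ᵖ h ≈ᵖ scale a (g *ᵖ h)
  scale-* a [] h = ≈-refl
  scale-* a (b ∷ g) h = coefwise λ n → begin
    coef (scale a (b ∷ g) *ᵖ h) n                        ≡⟨ coef-* (a *ᵏ b) (scale a g) h n ⟩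
    a *ᵏ b *ᵏ coef h n +ᵏ coef (0ᵏ ∷ scale a g *ᵖ h) n   ≡⟨ cong (_ +ᵏ_) (at tail n) ⟩
    a *ᵏ b *ᵏ coef h n +ᵏ coef (scale a (0ᵏ ∷ g *ᵖ h)) n ≡⟨ cong (_ +ᵏ_) (coef-scale a (0ᵏ ∷ g *ᵖ h) n) ⟩
    a *ᵏ b *ᵏ coef h n +ᵏ a *ᵏ coef (0ᵏ ∷ g *ᵖ h) n
      ≡⟨ solve 4 (λ a b x y → a :* b :* x :+ a :* y := a :* (b :* x :+ y)) refl _ _ _ _ ⟩
    a *ᵏ (b *ᵏ coef h n +ᵏ coef (0ᵏ ∷ g *ᵖ h) n)         ≡⟨ cong (a *ᵏ_) (sym (coef-* b g h n)) ⟩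
    a *ᵏ coef ((b ∷ g) *ᵖ h) n                           ≡⟨ sym (coef-scale a ((b ∷ g) *ᵖ h) n) ⟩
    coef (scale a ((b ∷ g) *ᵖ h)) n                      ∎
    where
    open ≡-Reasoning
    tail : 0ᵏ ∷ scale a g *ᵖ h ≈ᵖ scale a (0ᵏ ∷ g *ᵖ h)
    tail = coefwise λ { zero → sym (zeroʳ a) ; (suc n) → at (scale-* a g h) n }

  0∷-* : ∀ f h → (0ᵏ ∷ f) *ᵖ h ≈ᵖ 0ᵏ ∷ f *ᵖ h
  0∷-* f h = coefwise λ n → trans (coef-* 0ᵏ f h n) (trans (cong (_+ᵏ coef (0ᵏ ∷ f *ᵖ h) n) (zeroˡ (coef h n))) (+-identityˡ _))

  *ᵖ-distribʳ : ∀ h f g → (f +ᵖ g) *ᵖ h ≈ᵖ f *ᵖ h +ᵖ g *ᵖ h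
  *ᵖ-distribʳ h [] g = ≈-refl
  *ᵖ-distribʳ h (a ∷ f) [] = ≈-sym (+ᵖ-identityʳ _)
  *ᵖ-distribʳ h (a ∷ f) (b ∷ g) = coefwise λ n → begin
    coef (((a +ᵏ b) ∷ (f +ᵖ g)) *ᵖ h) n
      ≡⟨ coef-* (a +ᵏ b) (f +ᵖ g) h n ⟩
    (a +ᵏ b) *ᵏ coef h n +ᵏ coef (0ᵏ ∷ (f +ᵖ g) *ᵖ h) n
      ≡⟨ cong (_ +ᵏ_) (at tail n) ⟩
    (a +ᵏ b) *ᵏ coef h n +ᵏ coef ((0ᵏ ∷ f *ᵖ h) +ᵖ (0ᵏ ∷ g *ᵖ h)) n
      ≡⟨ cong (_ +ᵏ_) (coef-+ (0ᵏ ∷ f *ᵖ h) (0ᵏ ∷ g *ᵖ h) n) ⟩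
    (a +ᵏ b) *ᵏ coef h n +ᵏ (coef (0ᵏ ∷ f *ᵖ h) n +ᵏ coef (0ᵏ ∷ g *ᵖ h) n)
      ≡⟨ solve 5 (λ a b x y z → (a :+ b) :* x :+ (y :+ z) := a :* x :+ y :+ (b :* x :+ z)) refl a b _ _ _ ⟩
    (a *ᵏ coef h n +ᵏ coef (0ᵏ ∷ f *ᵖ h) n) +ᵏ (b *ᵏ coef h n +ᵏ coef (0ᵏ ∷ g *ᵖ h) n)
      ≡⟨ cong₂ _+ᵏ_ (sym (coef-* a f h n)) (sym (coef-* b g h n)) ⟩
    coef ((a ∷ f) *ᵖ h) n +ᵏ coef ((b ∷ g) *ᵖ h) n
      ≡⟨ sym (coef-+ ((a ∷ f) *ᵖ h) ((b ∷ g) *ᵖ h) n) ⟩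
    coef ((a ∷ f) *ᵖ h +ᵖ (b ∷ g) *ᵖ h) n ∎
    where
    open ≡-Reasoning
    tail : 0ᵏ ∷ (f +ᵖ g) *ᵖ h ≈ᵖ (0ᵏ ∷ f *ᵖ h) +ᵖ (0ᵏ ∷ g *ᵖ h)
    tail = coefwise λ { zero → sym (+-identityˡ 0ᵏ) ; (suc n) → at (*ᵖ-distribʳ h f g) n }

  *ᵖ-assoc : ∀ f g h → (f *ᵖ g) *ᵖ h ≈ᵖ f *ᵖ (g *ᵖ h)
  *ᵖ-assoc [] g h = ≈-refl
  *ᵖ-assoc (a ∷ f) g h = ≈-trans (*ᵖ-distribʳ h (scale a g) (0ᵏ ∷ f *ᵖ g))
    (+ᵖ-cong (scale-* a g h) (≈-trans (0∷-* (f *ᵖ g) h) (∷-cong (*ᵖ-assoc f g h))))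

  *ᵖ-identityˡ : ∀ f → 1ᵖ *ᵖ f ≈ᵖ f
  *ᵖ-identityˡ f = coefwise λ n → trans (coef-* 1ᵏ [] f n)
    (trans (cong₂ _+ᵏ_ (*-identityˡ _) (at 0∷[]≈[] n)) (+-identityʳ _))

  polynomialRing : CommutativeRing 0ℓ 0ℓ
  polynomialRing = record
    { Carrier = Poly ; _≈_ = _≈ᵖ_ ; _+_ = _+ᵖ_ ; _*_ = _*ᵖ_ ; -_ = -ᵖ_ ; 0# = [] ; 1# = 1ᵖ
    ; isCommutativeRing = record
      { isRing = record
        { +-isAbelianGroup = record
          { isGroup = record
            { isMonoid = record
              { isSemigroup = record
                { isMagma = record
                  { isEquivalence = record { refl = ≈-refl ; sym = ≈-sym ; trans = ≈-trans }
                  ; ∙-cong = +ᵖ-cong }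
                ; assoc = +ᵖ-assoc }
              ; identity = (λ _ → ≈-refl) , +ᵖ-identityʳ }
            ; inverse = (λ f → ≈-trans (+ᵖ-comm (-ᵖ f) f) (-ᵖ-inverseʳ f)) , -ᵖ-inverseʳ
            ; ⁻¹-cong = -ᵖ-cong }
          ; comm = +ᵖ-comm }
        ; *-cong = *ᵖ-cong
        ; *-assoc = *ᵖ-assoc
        ; *-identity = *ᵖ-identityˡ , (λ f → ≈-trans (*ᵖ-comm f 1ᵖ) (*ᵖ-identityˡ f))
        ; distrib = (λ f g h → ≈-trans (*ᵖ-comm f (g +ᵖ h)) (≈-trans (*ᵖ-distribʳ f g h)
                                 (+ᵖ-cong (*ᵖ-comm g f) (*ᵖ-comm h f)))) , *ᵖ-distribʳ }
      ; *-comm = *ᵖ-comm } }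

  open RingSolver polynomialRing public using () renaming (solve to solveᵖ)
  module ≈-Reasoning where
    open import Relation.Binary.Reasoning.Setoid (CommutativeRing.setoid polynomialRing) public

  ∷≈const+X* : ∀ a f → a ∷ f ≈ᵖ const a +ᵖ X *ᵖ f
  ∷≈const+X* a f = ≈-sym (≈-trans (+ᵖ-cong (≈-refl {const a})
    (≈-trans (0∷-* 1ᵖ f) (∷-cong (*ᵖ-identityˡ f)))) (coefwise λ { zero → +-identityʳ a ; (suc n) → refl }))

  const-+ : ∀ a b → const (a +ᵏ b) ≈ᵖ const a +ᵖ const b
  const-+ a b = ≈-refl

  const-* : ∀ a b → const (a *ᵏ b) ≈ᵖ const a *ᵖ const b
  const-* a b = coefwise λ { zero → sym (+-identityʳ _) ; (suc n) → refl }

  const-0 : const 0ᵏ ≈ᵖ []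
  const-0 = 0∷[]≈[]

  scale≈const* : ∀ a f → scale a f ≈ᵖ const a *ᵖ f
  scale≈const* a f = ≈-sym (≈-trans (+ᵖ-cong (≈-refl {scale a f}) 0∷[]≈[]) (+ᵖ-identityʳ _))

  eval : Carrier → Poly → Carrier
  eval x [] = 0ᵏ
  eval x (a ∷ f) = a +ᵏ x *ᵏ eval x f

  eval-≈0 : ∀ x f → f ≈ᵖ [] → eval x f ≡ 0ᵏ
  eval-≈0 x [] e = refl
  eval-≈0 x (a ∷ f) e = trans (cong₂ (λ b c → b +ᵏ x *ᵏ c) (at e 0) (eval-≈0 x f (coefwise (at e ∘ suc))))
    (trans (+-identityˡ _) (zeroʳ x))

  eval-cong : ∀ x {f g} → f ≈ᵖ g → eval x f ≡ eval x g
  eval-cong x {[]} {g} e = sym (eval-≈0 x g (≈-sym e))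
  eval-cong x {a ∷ f} {[]} e = eval-≈0 x (a ∷ f) e
  eval-cong x {a ∷ f} {b ∷ g} e =
    cong₂ (λ c v → c +ᵏ x *ᵏ v) (at e 0) (eval-cong x {f} {g} (coefwise (at e ∘ suc)))

  eval-+ : ∀ x f g → eval x (f +ᵖ g) ≡ eval x f +ᵏ eval x g
  eval-+ x [] g = sym (+-identityˡ _)
  eval-+ x (a ∷ f) [] = sym (+-identityʳ _)
  eval-+ x (a ∷ f) (b ∷ g) = trans (cong (λ v → a +ᵏ b +ᵏ x *ᵏ v) (eval-+ x f g))
    (solve 5 (λ a b x u v → a :+ b :+ x :* (u :+ v) := a :+ x :* u :+ (b :+ x :* v)) refl a b x _ _)

  eval-scale : ∀ x a f → eval x (scale a f) ≡ a *ᵏ eval x f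
  eval-scale x a [] = sym (zeroʳ a)
  eval-scale x a (b ∷ f) = trans (cong (λ v → a *ᵏ b +ᵏ x *ᵏ v) (eval-scale x a f))
    (solve 4 (λ a b x u → a :* b :+ x :* (a :* u) := a :* (b :+ x :* u)) refl a b x _)

  eval-* : ∀ x f g → eval x (f *ᵖ g) ≡ eval x f *ᵏ eval x g
  eval-* x [] g = sym (zeroˡ _)
  eval-* x (a ∷ f) g = begin
    eval x (scale a g +ᵖ (0ᵏ ∷ f *ᵖ g))             ≡⟨ eval-+ x (scale a g) _ ⟩
    eval x (scale a g) +ᵏ (0ᵏ +ᵏ x *ᵏ eval x (f *ᵖ g))
      ≡⟨ cong₂ _+ᵏ_ (eval-scale x a g) (trans (+-identityˡ _) (cong (x *ᵏ_) (eval-* x f g))) ⟩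
    a *ᵏ eval x g +ᵏ x *ᵏ (eval x f *ᵏ eval x g)
      ≡⟨ solve 4 (λ a g x f → a :* g :+ x :* (f :* g) := (a :+ x :* f) :* g) refl a _ x _ ⟩
    (a +ᵏ x *ᵏ eval x f) *ᵏ eval x g                ∎
    where open ≡-Reasoning

  eval-const : ∀ x a → eval x (const a) ≡ a
  eval-const x a = trans (cong (a +ᵏ_) (zeroʳ x)) (+-identityʳ a)

  eval-X : ∀ x → eval x X ≡ x
  eval-X x = trans (+-identityˡ _) (trans (cong (x *ᵏ_) (eval-const x 1ᵏ)) (*-identityʳ x))

  infixr 8 _^ᵖ_
  _^ᵖ_ : Poly → ℕ → Poly
  f ^ᵖ zero = 1ᵖ
  f ^ᵖ suc n = f *ᵖ f ^ᵖ n

  ^ᵖ-+ : ∀ f m n → f ^ᵖ (m + n) ≈ᵖ f ^ᵖ m *ᵖ f ^ᵖ n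
  ^ᵖ-+ f zero n = ≈-sym (*ᵖ-identityˡ _)
  ^ᵖ-+ f (suc m) n = ≈-trans (*ᵖ-congʳ f (^ᵖ-+ f m n)) (≈-sym (*ᵖ-assoc f _ _))

  eval-^ : ∀ x f n → eval x (f ^ᵖ n) ≡ eval x f ^ᵏ n
  eval-^ x f zero = eval-const x 1ᵏ
  eval-^ x f (suc n) = trans (eval-* x f (f ^ᵖ n)) (cong (eval x f *ᵏ_) (eval-^ x f n))

  fromℕ : ℕ → Carrier
  fromℕ zero = 0ᵏ
  fromℕ (suc n) = 1ᵏ +ᵏ fromℕ n

  -- Horner form of the derivative: (a + X f)' = f + X f'.
  d : Poly → Poly
  d [] = []
  d (a ∷ f) = f +ᵖ (0ᵏ ∷ d f)

  coef-d : ∀ f n → coef (d f) n ≡ fromℕ (suc n) *ᵏ coef f (suc n)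
  coef-d [] n = sym (zeroʳ _)
  coef-d (a ∷ f) zero = trans (coef-+ f _ 0)
    (solve 1 (λ x → x :+ con (pos 0) := (con (pos 1) :+ con (pos 0)) :* x) refl _)
  coef-d (a ∷ f) (suc n) = trans (coef-+ f (0ᵏ ∷ d f) (suc n)) (trans (cong (coef f (suc n) +ᵏ_) (coef-d f n))
    (solve 2 (λ x y → x :+ y :* x := (con (pos 1) :+ y) :* x) refl (coef f (suc n)) (fromℕ (suc n))))

  d-cong : ∀ {f g} → f ≈ᵖ g → d f ≈ᵖ d g
  d-cong {f} {g} e = coefwise (λ n → trans (coef-d f n) (trans (cong (_ *ᵏ_) (at e (suc n))) (sym (coef-d g n))))

  d-+ : ∀ f g → d (f +ᵖ g) ≈ᵖ d f +ᵖ d g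
  d-+ f g = coefwise λ n → begin
    coef (d (f +ᵖ g)) n                                  ≡⟨ coef-d (f +ᵖ g) n ⟩
    fromℕ (suc n) *ᵏ coef (f +ᵖ g) (suc n)               ≡⟨ cong (_ *ᵏ_) (coef-+ f g (suc n)) ⟩
    fromℕ (suc n) *ᵏ (coef f (suc n) +ᵏ coef g (suc n))  ≡⟨ distribˡ _ _ _ ⟩
    fromℕ (suc n) *ᵏ coef f (suc n) +ᵏ fromℕ (suc n) *ᵏ coef g (suc n)
      ≡⟨ cong₂ _+ᵏ_ (sym (coef-d f n)) (sym (coef-d g n)) ⟩
    coef (d f) n +ᵏ coef (d g) n                         ≡⟨ sym (coef-+ (d f) (d g) n) ⟩
    coef (d f +ᵖ d g) n                                  ∎
    where open ≡-Reasoning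

  d-scale : ∀ a f → d (scale a f) ≈ᵖ scale a (d f)
  d-scale a f = coefwise λ n → begin
    coef (d (scale a f)) n                      ≡⟨ coef-d (scale a f) n ⟩
    fromℕ (suc n) *ᵏ coef (scale a f) (suc n)   ≡⟨ cong (_ *ᵏ_) (coef-scale a f (suc n)) ⟩
    fromℕ (suc n) *ᵏ (a *ᵏ coef f (suc n))
      ≡⟨ solve 3 (λ n a x → n :* (a :* x) := a :* (n :* x)) refl _ a _ ⟩
    a *ᵏ (fromℕ (suc n) *ᵏ coef f (suc n))      ≡⟨ cong (a *ᵏ_) (sym (coef-d f n)) ⟩
    a *ᵏ coef (d f) n                           ≡⟨ sym (coef-scale a (d f) n) ⟩
    coef (scale a (d f)) n                      ∎
    where open ≡-Reasoning

  d-* : ∀ f g → d (f *ᵖ g) ≈ᵖ d f *ᵖ g +ᵖ f *ᵖ d g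
  d-* [] g = ≈-refl
  d-* (a ∷ f) g = begin
    d (scale a g +ᵖ (0ᵏ ∷ f *ᵖ g))
      ≈⟨ d-+ (scale a g) (0ᵏ ∷ f *ᵖ g) ⟩
    d (scale a g) +ᵖ (f *ᵖ g +ᵖ (0ᵏ ∷ d (f *ᵖ g)))
      ≈⟨ +ᵖ-cong (d-scale a g) (+ᵖ-cong (≈-refl {f *ᵖ g}) (≈-trans (∷-cong (d-* f g)) 0∷-+)) ⟩
    scale a (d g) +ᵖ (f *ᵖ g +ᵖ ((0ᵏ ∷ d f *ᵖ g) +ᵖ (0ᵏ ∷ f *ᵖ d g)))
      ≈⟨ solveᵖ 4 (λ s fg u v → s :+ (fg :+ (u :+ v)) := fg :+ u :+ (s :+ v)) ≈-refl
           (scale a (d g)) (f *ᵖ g) (0ᵏ ∷ d f *ᵖ g) (0ᵏ ∷ f *ᵖ d g) ⟩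
    (f *ᵖ g +ᵖ (0ᵏ ∷ d f *ᵖ g)) +ᵖ (scale a (d g) +ᵖ (0ᵏ ∷ f *ᵖ d g))
      ≈⟨ +ᵖ-cong (≈-sym (≈-trans (*ᵖ-distribʳ g f (0ᵏ ∷ d f)) (+ᵖ-cong (≈-refl {f *ᵖ g}) (0∷-* (d f) g)))) ≈-refl ⟩
    (f +ᵖ (0ᵏ ∷ d f)) *ᵖ g +ᵖ (a ∷ f) *ᵖ d g ∎
    where
    open ≈-Reasoning
    0∷-+ : 0ᵏ ∷ (d f *ᵖ g +ᵖ f *ᵖ d g) ≈ᵖ (0ᵏ ∷ d f *ᵖ g) +ᵖ (0ᵏ ∷ f *ᵖ d g)
    0∷-+ = coefwise λ { zero → sym (+-identityˡ 0ᵏ) ; (suc n) → refl }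

  d-const : ∀ a → d (const a) ≈ᵖ []
  d-const a = 0∷[]≈[]

  d-X : d X ≈ᵖ 1ᵖ
  d-X = coefwise λ { zero → +-identityʳ 1ᵏ ; (suc zero) → refl ; (suc (suc n)) → refl }

  d-const* : ∀ a f → d (const a *ᵖ f) ≈ᵖ const a *ᵖ d f
  d-const* a f = ≈-trans (d-* (const a) f)
    (≈-trans (+ᵖ-cong (*ᵖ-cong (d-const a) (≈-refl {f})) (≈-refl {const a *ᵖ d f})) ≈-refl)

  -- The power rule multiplied by f, to avoid the exponent n - 1.
  *-d-^ : ∀ f n → f *ᵖ d (f ^ᵖ n) ≈ᵖ const (fromℕ n) *ᵖ (d f *ᵖ f ^ᵖ n)
  *-d-^ f zero = ≈-trans (*ᵖ-congʳ f (d-const 1ᵏ)) (≈-trans (*ᵖ-zeroʳ f)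
    (≈-sym (*ᵖ-cong const-0 (≈-refl {d f *ᵖ 1ᵖ}))))
  *-d-^ f (suc n) = begin
    f *ᵖ d (f *ᵖ f ^ᵖ n)
      ≈⟨ *ᵖ-congʳ f (d-* f (f ^ᵖ n)) ⟩
    f *ᵖ (d f *ᵖ f ^ᵖ n +ᵖ f *ᵖ d (f ^ᵖ n))
      ≈⟨ *ᵖ-congʳ f (+ᵖ-cong (≈-refl {d f *ᵖ f ^ᵖ n}) (*-d-^ f n)) ⟩
    f *ᵖ (d f *ᵖ f ^ᵖ n +ᵖ const (fromℕ n) *ᵖ (d f *ᵖ f ^ᵖ n))
      ≈⟨ solveᵖ 4 (λ f f' p n → f :* (f' :* p :+ n :* (f' :* p)) := (con (pos 1) :+ n) :* (f' :* (f :* p))) ≈-refl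
           f (d f) (f ^ᵖ n) (const (fromℕ n)) ⟩
    (1ᵖ +ᵖ const (fromℕ n)) *ᵖ (d f *ᵖ (f *ᵖ f ^ᵖ n)) ∎
    where open ≈-Reasoning

  d-^suc : ∀ f n → d (f ^ᵖ suc n) ≈ᵖ const (fromℕ (suc n)) *ᵖ (d f *ᵖ f ^ᵖ n)
  d-^suc f n = begin
    d (f *ᵖ f ^ᵖ n)                                             ≈⟨ d-* f (f ^ᵖ n) ⟩
    d f *ᵖ f ^ᵖ n +ᵖ f *ᵖ d (f ^ᵖ n)                            ≈⟨ +ᵖ-cong (≈-refl {d f *ᵖ f ^ᵖ n}) (*-d-^ f n) ⟩
    d f *ᵖ f ^ᵖ n +ᵖ const (fromℕ n) *ᵖ (d f *ᵖ f ^ᵖ n)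
      ≈⟨ solveᵖ 2 (λ x n → x :+ n :* x := (con (pos 1) :+ n) :* x) ≈-refl (d f *ᵖ f ^ᵖ n) (const (fromℕ n)) ⟩
    (1ᵖ +ᵖ const (fromℕ n)) *ᵖ (d f *ᵖ f ^ᵖ n)                  ∎
    where open ≈-Reasoning

  -- Lengths do the work of degrees: a length of at most n forces degree below n, whether or not the
  -- last coefficient is zero.
  length-+ : ∀ {n} f g → length f ≤ n → length g ≤ n → length (f +ᵖ g) ≤ n
  length-+ [] g _ h = h
  length-+ (a ∷ f) [] h _ = h
  length-+ (a ∷ f) (b ∷ g) (s≤s h) (s≤s h') = s≤s (length-+ f g h h')

  length-scale : ∀ a f → length (scale a f) ≡ length f
  length-scale a f = length-map _ f
    where open import Data.List.Properties using (length-map)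

  length-* : ∀ {m n} f g → length f ≤ suc m → length g ≤ suc n → length (f *ᵖ g) ≤ suc (m + n)
  length-* [] g _ _ = z≤n
  length-* {m} {n} (a ∷ f) g (s≤s hf) hg = length-+ (scale a g) (0ᵏ ∷ f *ᵖ g)
    (ℕₚ.≤-trans (ℕₚ.≤-reflexive (length-scale a g)) (ℕₚ.≤-trans hg (s≤s (ℕₚ.m≤n+m n m))))
    (s≤s (tail f hf))
    where
    tail : ∀ {m} f → length f ≤ m → length (f *ᵖ g) ≤ m + n
    tail [] _ = z≤n
    tail {suc m} f@(_ ∷ _) h = length-* f g h hg

  length-^ : ∀ f n → length f ≤ 2 → length (f ^ᵖ n) ≤ suc n
  length-^ f zero h = ℕₚ.≤-refl
  length-^ f (suc n) h = length-* f (f ^ᵖ n) h (length-^ f n h)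

  length-d : ∀ {n} f → length f ≤ n → length (d f) ≤ n
  length-d [] h = h
  length-d {suc n} (a ∷ f) (s≤s h) = length-+ f (0ᵏ ∷ d f) (ℕₚ.m≤n⇒m≤1+n h) (s≤s (length-d f h))

  module _ {I : Set} where
    ∑ᵏ : List I → (I → Carrier) → Carrier
    ∑ᵏ [] F = 0ᵏ
    ∑ᵏ (i ∷ is) F = F i +ᵏ ∑ᵏ is F

    ∑ᵖ : List I → (I → Poly) → Poly
    ∑ᵖ [] F = []
    ∑ᵖ (i ∷ is) F = F i +ᵖ ∑ᵖ is F

    ∑ᵖ-cong : ∀ is {F G} → (∀ {i} → i ∈ is → F i ≈ᵖ G i) → ∑ᵖ is F ≈ᵖ ∑ᵖ is G
    ∑ᵖ-cong [] e = ≈-refl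
    ∑ᵖ-cong (i ∷ is) e = +ᵖ-cong (e (here refl)) (∑ᵖ-cong is (e ∘ there))

    *-distribˡ-∑ᵖ : ∀ f is F → f *ᵖ ∑ᵖ is F ≈ᵖ ∑ᵖ is (λ i → f *ᵖ F i)
    *-distribˡ-∑ᵖ f [] F = *ᵖ-zeroʳ f
    *-distribˡ-∑ᵖ f (i ∷ is) F = ≈-trans
      (solveᵖ 3 (λ f x y → f :* (x :+ y) := f :* x :+ f :* y) ≈-refl f (F i) (∑ᵖ is F))
      (+ᵖ-cong (≈-refl {f *ᵖ F i}) (*-distribˡ-∑ᵖ f is F))

    ∑ᵖ-+ : ∀ is F G → ∑ᵖ is (λ i → F i +ᵖ G i) ≈ᵖ ∑ᵖ is F +ᵖ ∑ᵖ is G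
    ∑ᵖ-+ [] F G = ≈-refl
    ∑ᵖ-+ (i ∷ is) F G = ≈-trans (+ᵖ-cong (≈-refl {F i +ᵖ G i}) (∑ᵖ-+ is F G))
      (solveᵖ 4 (λ a b c d → a :+ b :+ (c :+ d) := a :+ c :+ (b :+ d)) ≈-refl (F i) (G i) (∑ᵖ is F) (∑ᵖ is G))

    d-∑ᵖ : ∀ is F → d (∑ᵖ is F) ≈ᵖ ∑ᵖ is (λ i → d (F i))
    d-∑ᵖ [] F = ≈-refl
    d-∑ᵖ (i ∷ is) F = ≈-trans (d-+ (F i) _) (+ᵖ-cong (≈-refl {d (F i)}) (d-∑ᵖ is F))

    eval-∑ᵖ : ∀ x is F → eval x (∑ᵖ is F) ≡ ∑ᵏ is (λ i → eval x (F i))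
    eval-∑ᵖ x [] F = refl
    eval-∑ᵖ x (i ∷ is) F = trans (eval-+ x (F i) _) (cong (_ +ᵏ_) (eval-∑ᵖ x is F))

    coef-∑ᵖ : ∀ n is F → coef (∑ᵖ is F) n ≡ ∑ᵏ is (λ i → coef (F i) n)
    coef-∑ᵖ n [] F = refl
    coef-∑ᵖ n (i ∷ is) F = trans (coef-+ (F i) _ n) (cong (_ +ᵏ_) (coef-∑ᵖ n is F))

    ∑ᵏ-cong : ∀ is {F G} → (∀ {i} → i ∈ is → F i ≡ G i) → ∑ᵏ is F ≡ ∑ᵏ is G
    ∑ᵏ-cong [] e = refl
    ∑ᵏ-cong (i ∷ is) e = cong₂ _+ᵏ_ (e (here refl)) (∑ᵏ-cong is (e ∘ there))

    *-distribˡ-∑ᵏ : ∀ a is F → a *ᵏ ∑ᵏ is F ≡ ∑ᵏ is (λ i → a *ᵏ F i)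
    *-distribˡ-∑ᵏ a [] F = zeroʳ a
    *-distribˡ-∑ᵏ a (i ∷ is) F = trans (distribˡ a _ _) (cong (_ +ᵏ_) (*-distribˡ-∑ᵏ a is F))

    ∑ᵏ-zero : ∀ is {F} → (∀ {i} → i ∈ is → F i ≡ 0ᵏ) → ∑ᵏ is F ≡ 0ᵏ
    ∑ᵏ-zero [] e = refl
    ∑ᵏ-zero (i ∷ is) e = trans (cong₂ _+ᵏ_ (e (here refl)) (∑ᵏ-zero is (e ∘ there))) (+-identityˡ _)

    length-∑ᵖ : ∀ {n} is F → (∀ {i} → i ∈ is → length (F i) ≤ n) → length (∑ᵖ is F) ≤ n
    length-∑ᵖ [] F h = z≤n
    length-∑ᵖ (i ∷ is) F h = length-+ (F i) _ (h (here refl)) (length-∑ᵖ is F (h ∘ there))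

-- Orders of vanishing, counting zeros, sparse polynomials and linear systems.

module Vanishing (𝔽 : FiniteField) where
  open FiniteField 𝔽
  open Polynomial 𝔽

  -- A zero of order at least n, expressed by the first n derivatives of order 0 to n - 1. In
  -- characteristic p factors X - x can be split off from this only while the order is at most p.
  Vanishes : ℕ → Carrier → Poly → Set
  Vanishes zero x f = ⊤
  Vanishes (suc n) x f = eval x f ≡ 0ᵏ × Vanishes n x (d f)

  vanishes-cong : ∀ n {x f g} → f ≈ᵖ g → Vanishes n x f → Vanishes n x g
  vanishes-cong zero e v = tt
  vanishes-cong (suc n) {x} e (v , w) = trans (sym (eval-cong x e)) v , vanishes-cong n (d-cong e) w

  vanishes-pred : ∀ n {x f} → Vanishes (suc n) x f → Vanishes n x f
  vanishes-pred zero v = tt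
  vanishes-pred (suc n) (v , w) = v , vanishes-pred n w

  vanishes-+ : ∀ n {x f g} → Vanishes n x f → Vanishes n x g → Vanishes n x (f +ᵖ g)
  vanishes-+ zero v w = tt
  vanishes-+ (suc n) {x} {f} {g} (v , v') (w , w') =
    trans (eval-+ x f g) (trans (cong₂ _+ᵏ_ v w) (+-identityˡ 0ᵏ)) ,
    vanishes-cong n (≈-sym (d-+ f g)) (vanishes-+ n v' w')

  vanishes-* : ∀ n {x} g {f} → Vanishes n x f → Vanishes n x (g *ᵖ f)
  vanishes-* zero g v = tt
  vanishes-* (suc n) {x} g {f} v =
    trans (eval-* x g f) (trans (cong (eval x g *ᵏ_) (proj₁ v)) (zeroʳ _)) ,
    vanishes-cong n (≈-sym (d-* g f)) (vanishes-+ n (vanishes-* n (d g) (vanishes-pred n v)) (vanishes-* n g (proj₂ v)))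

  vanishes-neg : ∀ n {x f} → Vanishes n x f → Vanishes n x (-ᵖ f)
  vanishes-neg n {x} {f} v = vanishes-cong n
    (solveᵖ 1 (λ f → (:- con (pos 1)) :* f := :- f) ≈-refl f) (vanishes-* n (-ᵖ 1ᵖ) v)

  -- Leibniz: g f' = (g f)' - g' f, and f already vanishes to one order less by induction.
  vanishes-unit : ∀ n {x} g {f} → eval x g ≢ 0ᵏ → Vanishes n x (g *ᵖ f) → Vanishes n x f
  vanishes-unit zero g g≢0 v = tt
  vanishes-unit (suc n) {x} g {f} g≢0 v = *-cancelˡ-0 g≢0 (trans (sym (eval-* x g f)) (proj₁ v)) ,
    vanishes-unit n g g≢0 (vanishes-cong n cancel
      (vanishes-+ n (vanishes-cong n (d-* g f) (proj₂ v))
        (vanishes-neg n (vanishes-* n (d g) (vanishes-unit n g g≢0 (vanishes-pred n v))))))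
    where
    cancel : d g *ᵖ f +ᵖ g *ᵖ d f +ᵖ -ᵖ (d g *ᵖ f) ≈ᵖ g *ᵖ d f
    cancel = solveᵖ 2 (λ a b → a :+ b :+ :- a := b) ≈-refl (d g *ᵖ f) (g *ᵖ d f)

  vanishes-^ : ∀ n {x} u h → eval x u ≡ 0ᵏ → Vanishes n x (u ^ᵖ n *ᵖ h)
  vanishes-^ zero u h e = tt
  vanishes-^ (suc n) {x} u h e =
    trans (eval-* x (u *ᵖ u ^ᵖ n) h) (trans (cong (_*ᵏ eval x h)
      (trans (eval-* x u (u ^ᵖ n)) (trans (cong (_*ᵏ eval x (u ^ᵖ n)) e) (zeroˡ _)))) (zeroˡ _)) ,
    vanishes-cong n derivative (vanishes-^ n u (const (fromℕ (suc n)) *ᵖ d u *ᵖ h +ᵖ u *ᵖ d h) e)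
    where
    derivative : u ^ᵖ n *ᵖ (const (fromℕ (suc n)) *ᵖ d u *ᵖ h +ᵖ u *ᵖ d h) ≈ᵖ d (u ^ᵖ suc n *ᵖ h)
    derivative = ≈-sym (≈-trans (d-* (u ^ᵖ suc n) h)
      (≈-trans (+ᵖ-cong (*ᵖ-cong (d-^suc u n) (≈-refl {h})) (≈-refl {u ^ᵖ suc n *ᵖ d h}))
        (solveᵖ 6 (λ c u' p h u h' → c :* (u' :* p) :* h :+ u :* p :* h' := p :* (c :* u' :* h :+ u :* h')) ≈-refl
          (const (fromℕ (suc n))) (d u) (u ^ᵖ n) h u (d h))))

  X-_ : Carrier → Poly
  X- x = (-ᵏ x) ∷ 1ᵏ ∷ []

  eval-X- : ∀ x y → eval y (X- x) ≡ y +ᵏ -ᵏ x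
  eval-X- x y = solve 2 (λ x y → :- x :+ y :* (con (pos 1) :+ y :* con (pos 0)) := y :+ :- x) refl x y

  d-X- : ∀ x → d (X- x) ≈ᵖ 1ᵖ
  d-X- x = coefwise λ { zero → +-identityʳ 1ᵏ ; (suc zero) → refl ; (suc (suc n)) → refl }

  X-≈ : ∀ x → X- x ≈ᵖ X +ᵖ -ᵖ const x
  X-≈ x = coefwise λ { zero → sym (+-identityˡ _) ; (suc zero) → refl ; (suc (suc n)) → refl }

  -- Synthetic division by X - x: the coefficients of the quotient are the values at x of the
  -- successive tails of f.
  quotient : Carrier → Poly → Poly
  quotient x [] = []
  quotient x (a ∷ []) = []
  quotient x (a ∷ f@(_ ∷ _)) = eval x f ∷ quotient x f

  length-quotient : ∀ x a f → length (quotient x (a ∷ f)) ≡ length f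
  length-quotient x a [] = refl
  length-quotient x a (b ∷ f) = cong suc (length-quotient x b f)

  division : ∀ x f → f ≈ᵖ (X- x) *ᵖ quotient x f +ᵖ const (eval x f)
  division x [] = ≈-sym (≈-trans (+ᵖ-cong (*ᵖ-zeroʳ (X- x)) const-0) ≈-refl)
  division x (a ∷ []) = ≈-sym (≈-trans (+ᵖ-cong (*ᵖ-zeroʳ (X- x)) (≈-refl {const (eval x (a ∷ []))}))
    (coefwise λ { zero → eval-const x a ; (suc n) → refl }))
  division x (a ∷ f@(_ ∷ _)) = begin
    a ∷ f
      ≈⟨ ∷≈const+X* a f ⟩
    const a +ᵖ X *ᵖ f
      ≈⟨ +ᵖ-cong (≈-refl {const a}) (*ᵖ-congʳ X (≈-trans (division x f)
           (+ᵖ-cong (*ᵖ-cong (X-≈ x) (≈-refl {quotient x f})) (≈-refl {const (eval x f)})))) ⟩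
    const a +ᵖ X *ᵖ ((X +ᵖ -ᵖ const x) *ᵖ quotient x f +ᵖ const (eval x f))
      ≈⟨ solveᵖ 5 (λ a X c q r → a :+ X :* ((X :+ :- c) :* q :+ r) := (X :+ :- c) :* (r :+ X :* q) :+ (a :+ c :* r))
           ≈-refl (const a) X (const x) (quotient x f) (const (eval x f)) ⟩
    (X +ᵖ -ᵖ const x) *ᵖ (const (eval x f) +ᵖ X *ᵖ quotient x f) +ᵖ (const a +ᵖ const x *ᵖ const (eval x f))
      ≈⟨ +ᵖ-cong (*ᵖ-cong (≈-sym (X-≈ x)) (≈-sym (∷≈const+X* (eval x f) (quotient x f))))
           (≈-trans (+ᵖ-cong (≈-refl {const a}) (≈-sym (const-* x (eval x f)))) (≈-sym (const-+ a (x *ᵏ eval x f)))) ⟩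
    (X- x) *ᵖ (eval x f ∷ quotient x f) +ᵖ const (eval x (a ∷ f)) ∎
    where open ≈-Reasoning

  factor : ∀ x f → eval x f ≡ 0ᵏ → f ≈ᵖ (X- x) *ᵖ quotient x f
  factor x f e = ≈-trans (division x f) (≈-trans
    (+ᵖ-cong (≈-refl {(X- x) *ᵖ quotient x f}) (≈-trans (coefwise λ { zero → e ; (suc n) → refl }) const-0))
    (+ᵖ-identityʳ _))

  module _ (p : ℕ) (characteristic : ∀ n → 0 < n → n < p → fromℕ n ≢ 0ᵏ) where
    private
      -- Differentiating (X - x) g repeatedly produces (X - x) g' + m g with g replaced by its
      -- derivatives and m growing by one, so the induction runs on this shape. At x only m g(x)
      -- survives, and m is invertible below p.
      vanishes-divide′ : ∀ n {x} m g → 0 < m → m + n ≤ p →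
        Vanishes n x ((X- x) *ᵖ d g +ᵖ const (fromℕ m) *ᵖ g) → Vanishes n x g
      vanishes-divide′ zero m g _ _ v = tt
      vanishes-divide′ (suc n) {x} m g 0<m m+n<p (v , w) =
        *-cancelˡ-0 (characteristic m 0<m (ℕₚ.<-≤-trans (ℕₚ.m<m+n m (s≤s z≤n)) m+n<p)) (trans (sym value) v) ,
        vanishes-divide′ n (suc m) (d g) (s≤s z≤n) (subst (_≤ p) (ℕₚ.+-suc m n) m+n<p) (vanishes-cong n derivative w)
        where
        value : eval x ((X- x) *ᵖ d g +ᵖ const (fromℕ m) *ᵖ g) ≡ fromℕ m *ᵏ eval x g
        value = trans (eval-+ x ((X- x) *ᵖ d g) (const (fromℕ m) *ᵖ g)) (trans (cong₂ _+ᵏ_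
          (trans (eval-* x (X- x) (d g)) (trans (cong (_*ᵏ eval x (d g)) (trans (eval-X- x x) (-‿inverseʳ x))) (zeroˡ _)))
          (trans (eval-* x (const (fromℕ m)) g) (cong (_*ᵏ eval x g) (eval-const x _)))) (+-identityˡ _))
        derivative : d ((X- x) *ᵖ d g +ᵖ const (fromℕ m) *ᵖ g) ≈ᵖ (X- x) *ᵖ d (d g) +ᵖ const (fromℕ (suc m)) *ᵖ d g
        derivative = begin
          d ((X- x) *ᵖ d g +ᵖ const (fromℕ m) *ᵖ g)
            ≈⟨ d-+ ((X- x) *ᵖ d g) (const (fromℕ m) *ᵖ g) ⟩
          d ((X- x) *ᵖ d g) +ᵖ d (const (fromℕ m) *ᵖ g)
            ≈⟨ +ᵖ-cong (≈-trans (d-* (X- x) (d g)) (+ᵖ-cong (*ᵖ-cong (d-X- x) (≈-refl {d g})) (≈-refl {(X- x) *ᵖ d (d g)})))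
                 (d-const* (fromℕ m) g) ⟩
          1ᵖ *ᵖ d g +ᵖ (X- x) *ᵖ d (d g) +ᵖ const (fromℕ m) *ᵖ d g
            ≈⟨ solveᵖ 3 (λ a b m → con (pos 1) :* a :+ b :+ m :* a := b :+ (con (pos 1) :+ m) :* a) ≈-refl
                 (d g) ((X- x) *ᵖ d (d g)) (const (fromℕ m)) ⟩
          (X- x) *ᵖ d (d g) +ᵖ const (fromℕ (suc m)) *ᵖ d g ∎
          where open ≈-Reasoning

    vanishes-divide : ∀ n {x} g → suc n ≤ p → Vanishes (suc n) x ((X- x) *ᵖ g) → Vanishes n x g
    vanishes-divide n {x} g n<p (_ , w) = vanishes-divide′ n 1 g (s≤s z≤n) n<p (vanishes-cong n derivative w)
      where
      derivative : d ((X- x) *ᵖ g) ≈ᵖ (X- x) *ᵖ d g +ᵖ const (fromℕ 1) *ᵖ g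
      derivative = ≈-trans (d-* (X- x) g) (≈-trans
        (+ᵖ-cong (*ᵖ-cong {d (X- x)} {const (fromℕ 1)} (≈-trans (d-X- x) (coefwise λ { zero → sym (+-identityʳ 1ᵏ) ; (suc n) → refl })) (≈-refl {g}))
          (≈-refl {(X- x) *ᵖ d g}))
        (+ᵖ-comm (const (fromℕ 1) *ᵖ g) ((X- x) *ᵖ d g)))

    vanishing-count : ∀ {D} → D ≤ p → ∀ W → Unique W → ∀ e x f → All (x ≢_) W → e ≤ p →
      Vanishes e x f → (∀ {y} → y ∈ W → Vanishes D y f) → length f ≤ e + length W * D → f ≈ᵖ []
    vanishing-count D≤p W u e x [] _ _ _ _ _ = ≈-refl
    vanishing-count D≤p [] u zero x (a ∷ f) _ _ _ _ ()
    vanishing-count {D} D≤p (y ∷ W) (y∉W ∷ u) zero x f@(_ ∷ _) _ _ _ vs h =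
      vanishing-count D≤p W u D y f y∉W D≤p (vs (here refl)) (vs ∘ there) h
    vanishing-count {D} D≤p W u (suc e) x f@(a ∷ f') x∉W e<p v vs h =
      ≈-trans f≈ (≈-trans (*ᵖ-congʳ (X- x) g≈0) (*ᵖ-zeroʳ (X- x)))
      where
      g = quotient x f
      f≈ : f ≈ᵖ (X- x) *ᵖ g
      f≈ = factor x f (proj₁ v)
      g≈0 : g ≈ᵖ []
      g≈0 = vanishing-count D≤p W u e x g x∉W (ℕₚ.<⇒≤ e<p)
        (vanishes-divide e g e<p (vanishes-cong (suc e) f≈ v))
        (λ {y} y∈ → vanishes-unit D (X- x)
          (λ z → All.lookup x∉W y∈ (sym (x-y≡0⇒x≡y (trans (sym (eval-X- x y)) z))))
          (vanishes-cong D f≈ (vs y∈)))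
        (subst (_≤ e + length W * D) (sym (length-quotient x a f')) (ℕₚ.≤-pred h))

  -- Multiplying by ρ does not change the order of vanishing where ρ is nonzero.
  vanishes-derivation : ∀ ρ n {x} → eval x ρ ≢ 0ᵏ → ∀ f (g : ℕ → Poly) → f ≈ᵖ g 0 →
    (∀ s → ρ *ᵖ d (g s) ≈ᵖ g (suc s)) → (∀ s → s < n → eval x (g s) ≡ 0ᵏ) → Vanishes n x f
  vanishes-derivation ρ zero ρ≢0 f g e step zeros = tt
  vanishes-derivation ρ (suc n) {x} ρ≢0 f g e step zeros =
    trans (eval-cong x e) (zeros 0 (s≤s z≤n)) ,
    vanishes-unit n ρ ρ≢0 (vanishes-derivation ρ n ρ≢0 (ρ *ᵖ d f) (g ∘ suc)
      (≈-trans (*ᵖ-congʳ ρ (d-cong e)) (step 0)) (step ∘ suc) (λ s s<n → zeros (suc s) (s≤s s<n)))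

  module _ {I : Set} (exponent : I → ℕ) where
    open import Data.List.Relation.Unary.AllPairs using (AllPairs; []; _∷_)

    monomial : (I → Carrier) → I → Poly
    monomial a i = const (a i) *ᵖ X ^ᵖ exponent i

    -- The operator X d/dX - e₀ removes the term X^e₀ and lowers the order of vanishing by at most one.
    sparse-vanishing : ∀ {c} → c ≢ 0ᵏ → ∀ is → AllPairs (λ i j → fromℕ (exponent i) ≢ fromℕ (exponent j)) is →
      ∀ a → Vanishes (length is) c (∑ᵖ is (monomial a)) → ∀ {i} → i ∈ is → a i ≡ 0ᵏ
    sparse-vanishing {c} c≢0 (i₀ ∷ is) (distinct ∷ distincts) a v = conclusion
      where
      f = ∑ᵖ (i₀ ∷ is) (monomial a)
      e₀ = fromℕ (exponent i₀)
      b : I → Carrier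
      b i = a i *ᵏ (fromℕ (exponent i) +ᵏ -ᵏ e₀)

      term : ∀ i → X *ᵖ d (monomial a i) +ᵖ -ᵖ const e₀ *ᵖ monomial a i ≈ᵖ monomial b i
      term i = begin
        X *ᵖ d (monomial a i) +ᵖ -ᵖ const e₀ *ᵖ monomial a i
          ≈⟨ +ᵖ-cong (*ᵖ-congʳ X (d-const* (a i) (X ^ᵖ exponent i))) (≈-refl { -ᵖ const e₀ *ᵖ monomial a i}) ⟩
        X *ᵖ (const (a i) *ᵖ d (X ^ᵖ exponent i)) +ᵖ -ᵖ const e₀ *ᵖ monomial a i
          ≈⟨ solveᵖ 5 (λ X a d e m → X :* (a :* d) :+ :- e :* m := a :* (X :* d) :+ :- e :* m) ≈-refl
               X (const (a i)) (d (X ^ᵖ exponent i)) (const e₀) (monomial a i) ⟩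
        const (a i) *ᵖ (X *ᵖ d (X ^ᵖ exponent i)) +ᵖ -ᵖ const e₀ *ᵖ monomial a i
          ≈⟨ +ᵖ-cong (*ᵖ-congʳ (const (a i)) (≈-trans (*-d-^ X (exponent i))
               (*ᵖ-congʳ (const (fromℕ (exponent i))) (*ᵖ-cong d-X (≈-refl {X ^ᵖ exponent i})))))
               (≈-refl { -ᵖ const e₀ *ᵖ monomial a i}) ⟩
        const (a i) *ᵖ (const (fromℕ (exponent i)) *ᵖ (1ᵖ *ᵖ X ^ᵖ exponent i)) +ᵖ -ᵖ const e₀ *ᵖ (const (a i) *ᵖ X ^ᵖ exponent i)
          ≈⟨ solveᵖ 4 (λ a e x f → a :* (e :* (con (pos 1) :* x)) :+ :- f :* (a :* x) := a :* (e :+ :- f) :* x) ≈-refl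
               (const (a i)) (const (fromℕ (exponent i))) (X ^ᵖ exponent i) (const e₀) ⟩
        const (a i) *ᵖ (const (fromℕ (exponent i)) +ᵖ -ᵖ const e₀) *ᵖ X ^ᵖ exponent i
          ≈⟨ *ᵖ-cong (≈-sym (const-* (a i) (fromℕ (exponent i) +ᵏ -ᵏ e₀))) (≈-refl {X ^ᵖ exponent i}) ⟩
        monomial b i ∎
        where open ≈-Reasoning

      first-term : monomial b i₀ ≈ᵖ []
      first-term = *ᵖ-cong {const (b i₀)} {[]} (coefwise λ
        { zero → trans (cong (a i₀ *ᵏ_) (-‿inverseʳ e₀)) (zeroʳ _) ; (suc n) → refl }) (≈-refl {X ^ᵖ exponent i₀})

      reduced : X *ᵖ d f +ᵖ -ᵖ const e₀ *ᵖ f ≈ᵖ ∑ᵖ is (monomial b)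
      reduced = begin
        X *ᵖ d f +ᵖ -ᵖ const e₀ *ᵖ f
          ≈⟨ +ᵖ-cong (≈-trans (*ᵖ-congʳ X (d-∑ᵖ (i₀ ∷ is) (monomial a))) (*-distribˡ-∑ᵖ X (i₀ ∷ is) _))
               (*-distribˡ-∑ᵖ (-ᵖ const e₀) (i₀ ∷ is) (monomial a)) ⟩
        ∑ᵖ (i₀ ∷ is) (λ i → X *ᵖ d (monomial a i)) +ᵖ ∑ᵖ (i₀ ∷ is) (λ i → -ᵖ const e₀ *ᵖ monomial a i)
          ≈⟨ ≈-sym (∑ᵖ-+ (i₀ ∷ is) (λ i → X *ᵖ d (monomial a i)) (λ i → -ᵖ const e₀ *ᵖ monomial a i)) ⟩
        ∑ᵖ (i₀ ∷ is) (λ i → X *ᵖ d (monomial a i) +ᵖ -ᵖ const e₀ *ᵖ monomial a i)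
          ≈⟨ ∑ᵖ-cong (i₀ ∷ is) (λ {i} _ → term i) ⟩
        monomial b i₀ +ᵖ ∑ᵖ is (monomial b)
          ≈⟨ +ᵖ-cong first-term (≈-refl {∑ᵖ is (monomial b)}) ⟩
        ∑ᵖ is (monomial b) ∎
        where open ≈-Reasoning

      b≡0 : ∀ {i} → i ∈ is → b i ≡ 0ᵏ
      b≡0 = sparse-vanishing c≢0 is distincts b (vanishes-cong (length is) reduced
        (vanishes-+ (length is) (vanishes-* (length is) X (proj₂ v))
          (vanishes-* (length is) (-ᵖ const e₀) (vanishes-pred (length is) v))))

      rest : ∀ {i} → i ∈ is → a i ≡ 0ᵏ
      rest {i} i∈ = *-cancelˡ-0 (λ e → All.lookup distinct i∈ (sym (x-y≡0⇒x≡y e))) (trans (*ᵏ-comm _ (a i)) (b≡0 i∈))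

      eval-monomial : ∀ i → eval c (monomial a i) ≡ c ^ᵏ exponent i *ᵏ a i
      eval-monomial i = trans (eval-* c (const (a i)) (X ^ᵖ exponent i)) (trans (*ᵏ-comm _ _)
        (cong₂ _*ᵏ_ (trans (eval-^ c X (exponent i)) (cong (_^ᵏ exponent i) (eval-X c))) (eval-const c (a i))))

      first : a i₀ ≡ 0ᵏ
      first = *-cancelˡ-0 (^-nonzero (exponent i₀) c≢0) (begin
        c ^ᵏ exponent i₀ *ᵏ a i₀
          ≡⟨ sym (eval-monomial i₀) ⟩
        eval c (monomial a i₀)
          ≡⟨ sym (+-identityʳ _) ⟩
        eval c (monomial a i₀) +ᵏ 0ᵏ
          ≡⟨ cong (eval c (monomial a i₀) +ᵏ_) (sym (trans (eval-∑ᵖ c is (monomial a))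
               (∑ᵏ-zero is (λ {i} i∈ → trans (eval-monomial i) (trans (cong (c ^ᵏ exponent i *ᵏ_) (rest i∈)) (zeroʳ _)))))) ⟩
        eval c (monomial a i₀) +ᵏ eval c (∑ᵖ is (monomial a))
          ≡⟨ sym (eval-+ c (monomial a i₀) _) ⟩
        eval c f
          ≡⟨ proj₁ v ⟩
        0ᵏ ∎)
        where open ≡-Reasoning

      conclusion : ∀ {i} → i ∈ i₀ ∷ is → a i ≡ 0ᵏ
      conclusion (here refl) = first
      conclusion (there i∈) = rest i∈

  module _ {U : Set} (_≟ᵘ_ : DecidableEquality U) where
    open import Data.List.Relation.Unary.All.Properties using (++⁺; map⁻)
    open import Data.List.Properties using (length-map; length-++)

    dot : List U → (U → Carrier) → (U → Carrier) → Carrier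
    dot us a r = ∑ᵏ us (λ u → r u *ᵏ a u)

    -- Gaussian elimination on u₀. If every equation ignores u₀, the vector supported there solves
    -- the system; otherwise a pivot row removes u₀ from all others, and both counts drop by one.
    homogeneous-system : ∀ us → Unique us → ∀ rows → length rows < length us →
      ∃ λ a → (∃ λ u → u ∈ us × a u ≢ 0ᵏ) × All (λ r → dot us a r ≡ 0ᵏ) rows
    homogeneous-system (u₀ ∷ us) (u₀∉us ∷ uniq) rows |rows|<|us| with Any.any? (λ r → ¬? (r u₀ ≟ 0ᵏ)) rows
      where open import Relation.Nullary.Decidable using (¬?)
    ... | no none = a , (u₀ , here refl , λ e → 1≢0 (trans (sym a-u₀) e)) , All.tabulate solved
      where
      open import Data.List.Membership.Propositional using (lose)
      a : U → Carrier
      a u with u ≟ᵘ u₀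
      ... | yes _ = 1ᵏ
      ... | no _ = 0ᵏ
      a-u₀ : a u₀ ≡ 1ᵏ
      a-u₀ with u₀ ≟ᵘ u₀
      ... | yes _ = refl
      ... | no ≢ = ⊥-elim (≢ refl)
      a-us : ∀ {u} → u ∈ us → a u ≡ 0ᵏ
      a-us {u} u∈ with u ≟ᵘ u₀
      ... | yes refl = ⊥-elim (All.lookup u₀∉us u∈ refl)
      ... | no _ = refl
      solved : ∀ {r} → r ∈ rows → dot (u₀ ∷ us) a r ≡ 0ᵏ
      solved {r} r∈ with r u₀ ≟ 0ᵏ
      ... | no ≢ = ⊥-elim (none (lose r∈ ≢))
      ... | yes e = trans (cong₂ _+ᵏ_ (trans (cong (_*ᵏ a u₀) e) (zeroˡ _))
          (∑ᵏ-zero us (λ {u} u∈ → trans (cong (r u *ᵏ_) (a-us u∈)) (zeroʳ _)))) (+-identityˡ 0ᵏ)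
    ... | yes some = a , (u₁ , there u₁∈ , λ e → a'u₁≢0 (trans (sym (a-us u₁∈)) e)) ,
        subst (All _) (sym rows≡) (++⁺ (All.tabulate (λ r∈ → kept (∈-++⁺ˡ r∈))) (pivoted ∷ All.tabulate (λ r∈ → kept (∈-++⁺ʳ before r∈))))
      where
      open import Data.List.Membership.Propositional using (find)
      open import Data.List.Membership.Propositional.Properties using (∈-∃++; ∈-++⁺ˡ; ∈-++⁺ʳ)
      r₀ = proj₁ (find some)
      r₀≢0 = proj₂ (proj₂ (find some))
      splitting = ∈-∃++ (proj₁ (proj₂ (find some)))
      before = proj₁ splitting
      after = proj₁ (proj₂ splitting)
      rows≡ : rows ≡ before ++ r₀ ∷ after
      rows≡ = proj₂ (proj₂ splitting)
      i₀ = proj₁ (inverse (r₀ u₀) r₀≢0)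
      eliminate : (U → Carrier) → U → Carrier
      eliminate r u = r u +ᵏ -ᵏ (r u₀ *ᵏ i₀) *ᵏ r₀ u
      rows' = map eliminate (before ++ after)
      length-rows : suc (length rows') ≡ length rows
      length-rows = begin
        suc (length rows')                           ≡⟨ cong suc (length-map eliminate (before ++ after)) ⟩
        suc (length (before ++ after))               ≡⟨ cong suc (length-++ before) ⟩
        suc (length before + length after)           ≡⟨ sym (ℕₚ.+-suc (length before) (length after)) ⟩
        length before + suc (length after)           ≡⟨ sym (length-++ before) ⟩
        length (before ++ r₀ ∷ after)                ≡⟨ cong length (sym rows≡) ⟩
        length rows                                  ∎
        where open ≡-Reasoning
      recursive = homogeneous-system us uniq rows' (ℕₚ.≤-pred (subst (_< suc (length us)) (sym length-rows) |rows|<|us|))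
      a' = proj₁ recursive
      u₁ = proj₁ (proj₁ (proj₂ recursive))
      u₁∈ = proj₁ (proj₂ (proj₁ (proj₂ recursive)))
      a'u₁≢0 = proj₂ (proj₂ (proj₁ (proj₂ recursive)))
      -- Back substitution: the value of u₀ that the pivot row forces.
      head-value = -ᵏ (i₀ *ᵏ dot us a' r₀)
      a : U → Carrier
      a u with u ≟ᵘ u₀
      ... | yes _ = head-value
      ... | no _ = a' u
      a-u₀ : a u₀ ≡ head-value
      a-u₀ with u₀ ≟ᵘ u₀
      ... | yes _ = refl
      ... | no ≢ = ⊥-elim (≢ refl)
      a-us : ∀ {u} → u ∈ us → a u ≡ a' u
      a-us {u} u∈ with u ≟ᵘ u₀
      ... | yes refl = ⊥-elim (All.lookup u₀∉us u∈ refl)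
      ... | no _ = refl
      dot-a : ∀ r → dot (u₀ ∷ us) a r ≡ r u₀ *ᵏ head-value +ᵏ dot us a' r
      dot-a r = cong₂ _+ᵏ_ (cong (r u₀ *ᵏ_) a-u₀) (∑ᵏ-cong us (λ {u} u∈ → cong (r u *ᵏ_) (a-us u∈)))
      pivoted : dot (u₀ ∷ us) a r₀ ≡ 0ᵏ
      pivoted = trans (dot-a r₀) (trans
        (solve 3 (λ r i s → r :* :- (i :* s) :+ s := (con (pos 1) :+ :- (r :* i)) :* s) refl (r₀ u₀) i₀ (dot us a' r₀))
        (trans (cong (λ z → (1ᵏ +ᵏ -ᵏ z) *ᵏ dot us a' r₀) (proj₂ (inverse (r₀ u₀) r₀≢0)))
          (trans (cong (_*ᵏ dot us a' r₀) (-‿inverseʳ 1ᵏ)) (zeroˡ _))))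
      dot-eliminate : ∀ r vs → dot vs a' (eliminate r) ≡ dot vs a' r +ᵏ -ᵏ (r u₀ *ᵏ i₀) *ᵏ dot vs a' r₀
      dot-eliminate r [] = solve 1 (λ c → con (pos 0) := con (pos 0) :+ c :* con (pos 0)) refl (-ᵏ (r u₀ *ᵏ i₀))
      dot-eliminate r (u ∷ vs) = trans (cong (eliminate r u *ᵏ a' u +ᵏ_) (dot-eliminate r vs))
        (solve 6 (λ x c y a s t → (x :+ c :* y) :* a :+ (s :+ c :* t) := x :* a :+ s :+ c :* (y :* a :+ t)) refl
          (r u) (-ᵏ (r u₀ *ᵏ i₀)) (r₀ u) (a' u) (dot vs a' r) (dot vs a' r₀))
      kept : ∀ {r} → r ∈ before ++ after → dot (u₀ ∷ us) a r ≡ 0ᵏ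
      kept {r} r∈ = begin
        dot (u₀ ∷ us) a r
          ≡⟨ dot-a r ⟩
        r u₀ *ᵏ head-value +ᵏ dot us a' r
          ≡⟨ solve 4 (λ r i s t → r :* :- (i :* s) :+ t := t :+ :- (r :* i) :* s) refl (r u₀) i₀ (dot us a' r₀) (dot us a' r) ⟩
        dot us a' r +ᵏ -ᵏ (r u₀ *ᵏ i₀) *ᵏ dot us a' r₀
          ≡⟨ sym (dot-eliminate r us) ⟩
        dot us a' (eliminate r)
          ≡⟨ All.lookup (map⁻ (proj₂ (proj₂ recursive))) r∈ ⟩
        0ᵏ ∎
        where open ≡-Reasoning

-- Stepanov's method: a combination of the monomials X^(i+jτ) U^(kτ) V^((B-1-k)τ), i < A, j, k < B, vanishes to
-- order D wherever X^τ = 1 and U^τ = V^τ, because there the derivation X U V d/dX acts on it through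
-- polynomials of low degree; sparsity of the coefficients of U^(kτ) shows that it is nonzero.
module Stepanov (𝔽 : FiniteField) (p : ℕ)
  (characteristic : ∀ n → 0 < n → n < p → Polynomial.fromℕ 𝔽 n ≢ FiniteField.0ᵏ 𝔽) where
  open FiniteField 𝔽
  open Polynomial 𝔽
  open Vanishing 𝔽
  open import Data.List.Properties using (length-map; length-upTo)
  open import Data.List.Membership.Propositional.Properties
    using (∈-cartesianProduct⁺; ∈-cartesianProduct⁻; ∈-upTo⁺; ∈-upTo⁻; ∈-map⁺)
  import Data.List.Relation.Unary.Unique.Propositional.Properties as Uniqueₚ
  open import Data.List.Relation.Unary.AllPairs as AllPairs using (AllPairs)
  open import Data.Product.Properties using (≡-dec)
  open import Data.Nat.DivMod using (_%_; m<n⇒m%n≡m; [m+kn]%n≡m%n)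
  open import Data.Nat.Tactic.RingSolver using () renaming (solve-∀ to ℕ-ring)

  fromℕ-+ : ∀ m n → fromℕ (m + n) ≡ fromℕ m +ᵏ fromℕ n
  fromℕ-+ zero n = sym (+-identityˡ _)
  fromℕ-+ (suc m) n = trans (cong (1ᵏ +ᵏ_) (fromℕ-+ m n)) (sym (+ᵏ-assoc _ _ _))

  fromℕ-<-distinct : ∀ {m n} → m < n → n < p → fromℕ m ≢ fromℕ n
  fromℕ-<-distinct {m} {n} m<n n<p e = characteristic (n ∸ m) (ℕₚ.m<n⇒0<n∸m m<n) (ℕₚ.≤-<-trans (ℕₚ.m∸n≤m n m) n<p)
    (+-cancelˡ (trans (sym (fromℕ-+ m (n ∸ m))) (trans (cong fromℕ (ℕₚ.m+[n∸m]≡n (ℕₚ.<⇒≤ m<n)))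
      (trans (sym e) (sym (+-identityʳ _))))))

  fromℕ-injective : ∀ {m n} → m < p → n < p → fromℕ m ≡ fromℕ n → m ≡ n
  fromℕ-injective {m} {n} m<p n<p e with ℕₚ.<-cmp m n
  ... | tri< m<n _ _ = ⊥-elim (fromℕ-<-distinct m<n n<p e)
  ... | tri≈ _ m≡n _ = m≡n
  ... | tri> _ _ n<m = ⊥-elim (fromℕ-<-distinct n<m m<p (sym e))

  coef-beyond : ∀ f n → length f ≤ n → coef f n ≡ 0ᵏ
  coef-beyond [] n _ = refl
  coef-beyond (a ∷ f) (suc n) (s≤s h) = coef-beyond f n h

  vanishes-≤ : ∀ {m n x f} → m ≤ n → Vanishes n x f → Vanishes m x f
  vanishes-≤ z≤n v = tt
  vanishes-≤ (s≤s m≤n) (v , w) = v , vanishes-≤ m≤n w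

  vanishing-everywhere : ∀ {D} → D ≤ p → ∀ {W f} → Unique W → (∀ {y} → y ∈ W → Vanishes D y f) →
    length f ≤ length W * D → f ≈ᵖ []
  vanishing-everywhere D≤p {[]} {[]} u vs h = ≈-refl
  vanishing-everywhere {D} D≤p {y ∷ W} {f} (y∉W ∷ u) vs h =
    vanishing-count p characteristic D≤p W u D y f y∉W D≤p (vs (here refl)) (vs ∘ there) h

  allPairs : {I : Set} {R : I → I → Set} {is : List I} → Unique is →
    (∀ {i j} → i ∈ is → j ∈ is → i ≢ j → R i j) → AllPairs R is
  allPairs [] h = AllPairs.[]
  allPairs (i∉ ∷ u) h = All.tabulate (λ j∈ → h (here refl) (there j∈) (All.lookup i∉ j∈)) AllPairs.∷
    allPairs u (λ i∈ j∈ → h (there i∈) (there j∈))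

  module _ {I J : Set} where
    ∑ᵖ-++ : ∀ (is is' : List I) F → ∑ᵖ (is ++ is') F ≈ᵖ ∑ᵖ is F +ᵖ ∑ᵖ is' F
    ∑ᵖ-++ [] is' F = ≈-refl
    ∑ᵖ-++ (i ∷ is) is' F = ≈-trans (+ᵖ-cong (≈-refl {F i}) (∑ᵖ-++ is is' F)) (≈-sym (+ᵖ-assoc (F i) (∑ᵖ is F) (∑ᵖ is' F)))

    ∑ᵖ-map : ∀ (h : J → I) js F → ∑ᵖ (map h js) F ≈ᵖ ∑ᵖ js (F ∘ h)
    ∑ᵖ-map h [] F = ≈-refl
    ∑ᵖ-map h (j ∷ js) F = +ᵖ-cong (≈-refl {F (h j)}) (∑ᵖ-map h js F)

  ∑ᵖ-product : {I J : Set} (is : List I) (js : List J) (F : I × J → Poly) →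
    ∑ᵖ (cartesianProduct is js) F ≈ᵖ ∑ᵖ is (λ i → ∑ᵖ js (λ j → F (i , j)))
  ∑ᵖ-product [] js F = ≈-refl
  ∑ᵖ-product {I} {J} (i ∷ is) js F = ≈-trans (∑ᵖ-++ {I × J} {J} (map (i ,_) js) (cartesianProduct is js) F)
    (+ᵖ-cong (∑ᵖ-map (i ,_) js F) (∑ᵖ-product is js F))

  ∑ᵖ-applyUpTo : {I : Set} (g : ℕ → I) (n : ℕ) (F : I → Poly) → ∑ᵖ (applyUpTo g n) F ≈ᵖ ∑ᵖ (upTo n) (F ∘ g)
  ∑ᵖ-applyUpTo g zero F = ≈-refl
  ∑ᵖ-applyUpTo g (suc n) F = +ᵖ-cong (≈-refl {F (g 0)})
    (≈-trans (∑ᵖ-applyUpTo (g ∘ suc) n F) (≈-sym (∑ᵖ-applyUpTo suc n (F ∘ g))))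

  module _ (τ : ℕ) (0<τ : 0 < τ) (c e : Carrier) (c≢0 : c ≢ 0ᵏ) (ec≢1 : e *ᵏ c ≢ 1ᵏ) where
    private instance
      τ-nonZero : NonZero τ
      τ-nonZero = >-nonZero 0<τ

    -- The polynomials c - X and e X - 1. With e the conjugate of c and w of norm one, their values
    -- at w are x = c - w and w times the conjugate of x.
    U V : Poly
    U = c ∷ (-ᵏ 1ᵏ) ∷ []
    V = (-ᵏ 1ᵏ) ∷ e ∷ []

    eval-U : ∀ x → eval x U ≡ c +ᵏ -ᵏ x
    eval-U x = solve 2 (λ c x → c :+ x :* (:- con (pos 1) :+ x :* con (pos 0)) := c :+ :- x) refl c x

    eval-V : ∀ x → eval x V ≡ e *ᵏ x +ᵏ -ᵏ 1ᵏ
    eval-V x = solve 2 (λ e x → :- con (pos 1) :+ x :* (e :+ x :* con (pos 0)) := e :* x :+ :- con (pos 1)) refl e x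

    private
      d-U : d U ≈ᵖ const (-ᵏ 1ᵏ)
      d-U = coefwise λ { zero → +-identityʳ _ ; (suc zero) → refl ; (suc (suc n)) → refl }

      d-V : d V ≈ᵖ const e
      d-V = coefwise λ { zero → +-identityʳ _ ; (suc zero) → refl ; (suc (suc n)) → refl }

      -- The constant term c of U is nonzero, so the coefficients of h vanish successively from the
      -- lowest upwards.
      U-cancel : ∀ h → U *ᵖ h ≈ᵖ [] → h ≈ᵖ []
      U-cancel h Uh≈0 = coefwise zero-coef
        where
        lower : ∀ n → coef h n ≡ 0ᵏ → coef ((-ᵏ 1ᵏ ∷ []) *ᵖ h) n ≡ 0ᵏ
        lower n e = trans (coef-* (-ᵏ 1ᵏ) [] h n) (trans (cong₂ _+ᵏ_ (trans (cong (-ᵏ 1ᵏ *ᵏ_) e) (zeroʳ _)) (at 0∷[]≈[] n)) (+-identityˡ _))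
        leading : ∀ n → coef (0ᵏ ∷ (-ᵏ 1ᵏ ∷ []) *ᵖ h) n ≡ 0ᵏ → coef h n ≡ 0ᵏ
        leading n e = *-cancelˡ-0 c≢0 (begin
          c *ᵏ coef h n                                                   ≡⟨ sym (+-identityʳ _) ⟩
          c *ᵏ coef h n +ᵏ 0ᵏ                                             ≡⟨ cong (c *ᵏ coef h n +ᵏ_) (sym e) ⟩
          c *ᵏ coef h n +ᵏ coef (0ᵏ ∷ (-ᵏ 1ᵏ ∷ []) *ᵖ h) n                ≡⟨ sym (coef-* c (-ᵏ 1ᵏ ∷ []) h n) ⟩
          coef (U *ᵖ h) n                                                 ≡⟨ at Uh≈0 n ⟩
          0ᵏ                                                              ∎)
          where open ≡-Reasoning
        zero-coef : ∀ n → coef h n ≡ 0ᵏ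
        zero-coef zero = leading zero refl
        zero-coef (suc n) = leading (suc n) (lower n (zero-coef n))

      U^-cancel : ∀ n h → U ^ᵖ n *ᵖ h ≈ᵖ [] → h ≈ᵖ []
      U^-cancel zero h e = ≈-trans (≈-sym (*ᵖ-identityˡ h)) e
      U^-cancel (suc n) h e = U^-cancel n h (U-cancel (U ^ᵖ n *ᵖ h) (≈-trans (≈-sym (*ᵖ-assoc U (U ^ᵖ n) h)) e))

      -- Homogeneous of degree n - 1 in U^τ and V^τ, so that all k < n give the same value wherever
      -- these two agree.
      UV : ℕ → ℕ → Poly
      UV n k = U ^ᵖ (k * τ) *ᵖ V ^ᵖ ((n ∸ suc k) * τ)

      UV-sum : ℕ → (ℕ → Poly) → Poly
      UV-sum n f = ∑ᵖ (upTo n) (λ k → UV n k *ᵖ f k)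

      UV-sum-suc : ∀ n f → UV-sum (suc n) f ≈ᵖ V ^ᵖ (n * τ) *ᵖ f 0 +ᵖ U ^ᵖ τ *ᵖ UV-sum n (f ∘ suc)
      UV-sum-suc n f = +ᵖ-cong {UV (suc n) 0 *ᵖ f 0} (*ᵖ-cong (*ᵖ-identityˡ (V ^ᵖ (n * τ))) (≈-refl {f 0})) (begin
        ∑ᵖ (applyUpTo suc n) (λ k → UV (suc n) k *ᵖ f k)
          ≈⟨ ∑ᵖ-applyUpTo suc n (λ k → UV (suc n) k *ᵖ f k) ⟩
        ∑ᵖ (upTo n) (λ k → U ^ᵖ (τ + k * τ) *ᵖ V ^ᵖ ((n ∸ suc k) * τ) *ᵖ f (suc k))
          ≈⟨ ∑ᵖ-cong (upTo n) (λ {k} _ → ≈-trans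
               (*ᵖ-cong (*ᵖ-cong (^ᵖ-+ U τ (k * τ)) (≈-refl {V ^ᵖ ((n ∸ suc k) * τ)})) (≈-refl {f (suc k)}))
               (solveᵖ 4 (λ t u v f → t :* u :* v :* f := t :* (u :* v :* f)) ≈-refl
                 (U ^ᵖ τ) (U ^ᵖ (k * τ)) (V ^ᵖ ((n ∸ suc k) * τ)) (f (suc k)))) ⟩
        ∑ᵖ (upTo n) (λ k → U ^ᵖ τ *ᵖ (UV n k *ᵖ f (suc k)))
          ≈⟨ ≈-sym (*-distribˡ-∑ᵖ (U ^ᵖ τ) (upTo n) (λ k → UV n k *ᵖ f (suc k))) ⟩
        U ^ᵖ τ *ᵖ UV-sum n (f ∘ suc) ∎)
        where open ≈-Reasoning

      V-at-c : ∀ n → eval c (V ^ᵖ n) ≢ 0ᵏ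
      V-at-c n e≡0 = ^-nonzero n (λ z → ec≢1 (x-y≡0⇒x≡y (trans (sym (eval-V c)) z))) (trans (sym (eval-^ c V n)) e≡0)

      U-at-c : eval c U ≡ 0ᵏ
      U-at-c = trans (eval-U c) (-‿inverseʳ c)

      -- Modulo U^τ only the term of k = 0 remains, and V is nonzero at c because e c ≠ 1; so `f 0`
      -- vanishes to order τ at c and is zero by sparsity. Dividing the rest by U^τ continues the
      -- induction. `P` carries along what sparsity says of the coefficients.
      UV-independent : ∀ n (f : ℕ → Poly) (P : ℕ → Set) → (∀ k → Vanishes τ c (f k) → f k ≈ᵖ [] × P k) →
        UV-sum n f ≈ᵖ [] → ∀ {k} → k < n → P k
      UV-independent (suc n) f P sparse sum≈0 {k} = at-index k
        where
        rest = UV-sum n (f ∘ suc)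
        split : V ^ᵖ (n * τ) *ᵖ f 0 +ᵖ U ^ᵖ τ *ᵖ rest ≈ᵖ []
        split = ≈-trans (≈-sym (UV-sum-suc n f)) sum≈0
        first : f 0 ≈ᵖ [] × P 0
        first = sparse 0 (vanishes-unit τ (V ^ᵖ (n * τ)) (V-at-c (n * τ))
          (vanishes-cong τ (≈-sym (begin
            V ^ᵖ (n * τ) *ᵖ f 0
              ≈⟨ solveᵖ 2 (λ a b → a := a :+ b :+ :- b) ≈-refl (V ^ᵖ (n * τ) *ᵖ f 0) (U ^ᵖ τ *ᵖ rest) ⟩
            V ^ᵖ (n * τ) *ᵖ f 0 +ᵖ U ^ᵖ τ *ᵖ rest +ᵖ -ᵖ (U ^ᵖ τ *ᵖ rest)
              ≈⟨ +ᵖ-cong split (≈-refl { -ᵖ (U ^ᵖ τ *ᵖ rest)}) ⟩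
            -ᵖ (U ^ᵖ τ *ᵖ rest) ∎)) (vanishes-neg τ (vanishes-^ τ U rest U-at-c))))
          where open ≈-Reasoning
        rest≈0 : rest ≈ᵖ []
        rest≈0 = U^-cancel τ rest (≈-trans (≈-sym (+ᵖ-cong
          (≈-trans (*ᵖ-congʳ (V ^ᵖ (n * τ)) (proj₁ first)) (*ᵖ-zeroʳ (V ^ᵖ (n * τ)))) (≈-refl {U ^ᵖ τ *ᵖ rest}))) split)
        later : ∀ {k} → k < n → P (suc k)
        later = UV-independent n (f ∘ suc) (P ∘ suc) (sparse ∘ suc) rest≈0
        at-index : ∀ k → k < suc n → P k
        at-index zero _ = proj₂ first
        at-index (suc k) (s≤s k<n) = later k<n

    -- `AB≤τ` lets a zero of order τ at c kill the A B coefficients that belong to one k.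
    -- `few-conditions` compares D (A + 3 D) equations with A B² unknowns. `low-degree` keeps the
    -- exponents i + j τ distinct as elements of the field.
    module _ (A B D : ℕ) (AB≤τ : A * B ≤ τ) (0<B : 0 < B) (few-conditions : D * (A + 3 * D) < A * (B * B))
             (low-degree : A + τ * (B + B) ≤ p) (D≤p : D ≤ p)
             {W : List Carrier} (uW : Unique W)
             (points : ∀ {x} → x ∈ W → x ≢ 0ᵏ × eval x U ≢ 0ᵏ × eval x V ≢ 0ᵏ × x ^ᵏ τ ≡ 1ᵏ × eval x U ^ᵏ τ ≡ eval x V ^ᵏ τ) where
      private
        A≤τ : A ≤ τ
        A≤τ = ℕₚ.≤-trans (ℕₚ.m≤m*n A B {{>-nonZero 0<B}}) AB≤τ

        Exponents = ℕ × ℕ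
        Index = ℕ × Exponents

        low : List Exponents
        low = cartesianProduct (upTo A) (upTo B)

        indices : List Index
        indices = cartesianProduct (upTo B) low

        exponent : Exponents → ℕ
        exponent (i , j) = i + j * τ

        m : Index → Poly
        m (k , ij) = X ^ᵖ exponent ij *ᵖ UV B k

        R : Poly
        R = X *ᵖ (U *ᵖ V)

        -- The logarithmic derivative of the monomial `m u`, multiplied by R to clear denominators;
        -- U' = -1 and V' = e supply the constants.
        L : Index → Poly
        L (k , ij) = const (fromℕ (exponent ij)) *ᵖ (U *ᵖ V)
          +ᵖ const (fromℕ (k * τ)) *ᵖ (const (-ᵏ 1ᵏ) *ᵖ (X *ᵖ V))
          +ᵖ const (fromℕ ((B ∸ suc k) * τ)) *ᵖ (const e *ᵖ (X *ᵖ U))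

        R*d-m : ∀ u → R *ᵖ d (m u) ≈ᵖ m u *ᵖ L u
        R*d-m u@(k , ij) = begin
          R *ᵖ d (x *ᵖ (P *ᵖ Q))
            ≈⟨ *ᵖ-congʳ R (≈-trans (d-* x (P *ᵖ Q)) (+ᵖ-cong (≈-refl {d x *ᵖ (P *ᵖ Q)}) (*ᵖ-congʳ x (d-* P Q)))) ⟩
          R *ᵖ (d x *ᵖ (P *ᵖ Q) +ᵖ x *ᵖ (d P *ᵖ Q +ᵖ P *ᵖ d Q))
            ≈⟨ solveᵖ 9 (λ X U V x P Q x' P' Q' → X :* (U :* V) :* (x' :* (P :* Q) :+ x :* (P' :* Q :+ P :* Q')) :=
                 (X :* x') :* (U :* V :* (P :* Q)) :+ (U :* P') :* (x :* Q :* (X :* V)) :+ (V :* Q') :* (x :* P :* (X :* U)))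
                 ≈-refl X U V x P Q (d x) (d P) (d Q) ⟩
          (X *ᵖ d x) *ᵖ (U *ᵖ V *ᵖ (P *ᵖ Q)) +ᵖ (U *ᵖ d P) *ᵖ (x *ᵖ Q *ᵖ (X *ᵖ V)) +ᵖ (V *ᵖ d Q) *ᵖ (x *ᵖ P *ᵖ (X *ᵖ U))
            ≈⟨ +ᵖ-cong (+ᵖ-cong
                 (*ᵖ-cong (≈-trans (*-d-^ X (exponent ij)) (*ᵖ-congʳ n₁ (*ᵖ-cong d-X (≈-refl {x})))) (≈-refl {U *ᵖ V *ᵖ (P *ᵖ Q)}))
                 (*ᵖ-cong (≈-trans (*-d-^ U (k * τ)) (*ᵖ-congʳ n₂ (*ᵖ-cong d-U (≈-refl {P})))) (≈-refl {x *ᵖ Q *ᵖ (X *ᵖ V)})))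
                 (*ᵖ-cong (≈-trans (*-d-^ V ((B ∸ suc k) * τ)) (*ᵖ-congʳ n₃ (*ᵖ-cong d-V (≈-refl {Q})))) (≈-refl {x *ᵖ P *ᵖ (X *ᵖ U)})) ⟩
          (n₁ *ᵖ (1ᵖ *ᵖ x)) *ᵖ (U *ᵖ V *ᵖ (P *ᵖ Q)) +ᵖ (n₂ *ᵖ (const (-ᵏ 1ᵏ) *ᵖ P)) *ᵖ (x *ᵖ Q *ᵖ (X *ᵖ V))
            +ᵖ (n₃ *ᵖ (const e *ᵖ Q)) *ᵖ (x *ᵖ P *ᵖ (X *ᵖ U))
            ≈⟨ collect (U *ᵖ V) (X *ᵖ V) (X *ᵖ U) ⟩
          m u *ᵖ L u ∎
          where
          open ≈-Reasoning
          x = X ^ᵖ exponent ij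
          P = U ^ᵖ (k * τ)
          Q = V ^ᵖ ((B ∸ suc k) * τ)
          n₁ = const (fromℕ (exponent ij))
          n₂ = const (fromℕ (k * τ))
          n₃ = const (fromℕ ((B ∸ suc k) * τ))
          collect : ∀ α β γ → (n₁ *ᵖ (1ᵖ *ᵖ x)) *ᵖ (α *ᵖ (P *ᵖ Q)) +ᵖ (n₂ *ᵖ (const (-ᵏ 1ᵏ) *ᵖ P)) *ᵖ (x *ᵖ Q *ᵖ β)
            +ᵖ (n₃ *ᵖ (const e *ᵖ Q)) *ᵖ (x *ᵖ P *ᵖ γ) ≈ᵖ
            x *ᵖ (P *ᵖ Q) *ᵖ (n₁ *ᵖ α +ᵖ n₂ *ᵖ (const (-ᵏ 1ᵏ) *ᵖ β) +ᵖ n₃ *ᵖ (const e *ᵖ γ))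
          collect α β γ = ≈-trans (+ᵖ-cong (+ᵖ-cong
              (solveᵖ 5 (λ n x α P Q → n :* (con (pos 1) :* x) :* (α :* (P :* Q)) := x :* (P :* Q) :* (n :* α)) ≈-refl n₁ x α P Q)
              (solveᵖ 6 (λ n u P x Q β → n :* (u :* P) :* (x :* Q :* β) := x :* (P :* Q) :* (n :* (u :* β))) ≈-refl n₂ (const (-ᵏ 1ᵏ)) P x Q β))
              (solveᵖ 6 (λ n v Q x P γ → n :* (v :* Q) :* (x :* P :* γ) := x :* (P :* Q) :* (n :* (v :* γ))) ≈-refl n₃ (const e) Q x P γ))
            (solveᵖ 4 (λ m a b c → m :* a :+ m :* b :+ m :* c := m :* (a :+ b :+ c)) ≈-refl
              (x *ᵖ (P *ᵖ Q)) (n₁ *ᵖ α) (n₂ *ᵖ (const (-ᵏ 1ᵏ) *ᵖ β)) (n₃ *ᵖ (const e *ᵖ γ)))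

        -- Applying the derivation R d/dX to `m u` s times multiplies it by `Θ s u`, whose degree
        -- grows by at most three at each step.
        Θ : ℕ → Index → Poly
        Θ zero u = 1ᵖ
        Θ (suc s) u = L u *ᵖ Θ s u +ᵖ R *ᵖ d (Θ s u)

        length-Θ : ∀ s u → length (Θ s u) ≤ suc (3 * s)
        length-Θ zero u = s≤s z≤n
        length-Θ (suc s) u@(k , ij) = length-+ (L u *ᵖ Θ s u) (R *ᵖ d (Θ s u))
          (subst (length (L u *ᵖ Θ s u) ≤_) (cong suc (sym (ℕₚ.*-suc 3 s))) (length-* (L u) (Θ s u) length-L (length-Θ s u)))
          (subst (length (R *ᵖ d (Θ s u)) ≤_) (cong suc (sym (ℕₚ.*-suc 3 s)))
            (length-* R (d (Θ s u)) (length-* X (U *ᵖ V) ℕₚ.≤-refl (length-* U V ℕₚ.≤-refl ℕₚ.≤-refl)) (length-d (Θ s u) (length-Θ s u))))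
          where
          quadratic : ∀ a f g → length f ≤ 2 → length g ≤ 2 → length (const a *ᵖ (f *ᵖ g)) ≤ 4
          quadratic a f g hf hg = ℕₚ.m≤n⇒m≤1+n (length-* (const a) (f *ᵖ g) ℕₚ.≤-refl (length-* f g hf hg))
          scaled : ∀ a b f g → length f ≤ 2 → length g ≤ 2 → length (const a *ᵖ (const b *ᵖ (f *ᵖ g))) ≤ 4
          scaled a b f g hf hg = ℕₚ.m≤n⇒m≤1+n (length-* (const a) (const b *ᵖ (f *ᵖ g)) ℕₚ.≤-refl
            (length-* (const b) (f *ᵖ g) ℕₚ.≤-refl (length-* f g hf hg)))
          length-L : length (L u) ≤ 4
          length-L = length-+ (const (fromℕ (exponent ij)) *ᵖ (U *ᵖ V) +ᵖ const (fromℕ (k * τ)) *ᵖ (const (-ᵏ 1ᵏ) *ᵖ (X *ᵖ V)))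
              (const (fromℕ ((B ∸ suc k) * τ)) *ᵖ (const e *ᵖ (X *ᵖ U)))
            (length-+ (const (fromℕ (exponent ij)) *ᵖ (U *ᵖ V)) (const (fromℕ (k * τ)) *ᵖ (const (-ᵏ 1ᵏ) *ᵖ (X *ᵖ V)))
              (quadratic (fromℕ (exponent ij)) U V ℕₚ.≤-refl ℕₚ.≤-refl)
              (scaled (fromℕ (k * τ)) (-ᵏ 1ᵏ) X V ℕₚ.≤-refl ℕₚ.≤-refl))
            (scaled (fromℕ ((B ∸ suc k) * τ)) e X U ℕₚ.≤-refl ℕₚ.≤-refl)

        -- On W the powers with exponents divisible by τ collapse, and the image of Ψ under s
        -- derivations becomes a common factor times the sum of the a(u) X^i `Θ s u`. The linear
        -- system asks every coefficient n of that sum to vanish.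
        row : ℕ × ℕ → Index → Carrier
        row (s , n) u@(k , (i , j)) = coef (X ^ᵖ i *ᵖ Θ s u) n

        rows : List (Index → Carrier)
        rows = map row (cartesianProduct (upTo D) (upTo (A + 3 * D)))

        _≟ⁱ_ : DecidableEquality Index
        _≟ⁱ_ = ≡-dec ℕₚ._≟_ (≡-dec ℕₚ._≟_ ℕₚ._≟_)

        low-unique : Unique low
        low-unique = Uniqueₚ.cartesianProduct⁺ (Uniqueₚ.upTo⁺ A) (Uniqueₚ.upTo⁺ B)

        length-low : length low ≡ A * B
        length-low = trans (length-cartesianProduct (upTo A) (upTo B)) (cong₂ _*_ (length-upTo A) (length-upTo B))

        solution = homogeneous-system _≟ⁱ_ indices (Uniqueₚ.cartesianProduct⁺ (Uniqueₚ.upTo⁺ B) low-unique) rows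
          (ℕₚ.≤-trans (ℕₚ.≤-reflexive (cong suc length-rows)) (ℕₚ.≤-trans few-conditions (ℕₚ.≤-reflexive (sym length-indices))))
          where
          length-rows : length rows ≡ D * (A + 3 * D)
          length-rows = trans (length-map row (cartesianProduct (upTo D) (upTo (A + 3 * D))))
            (trans (length-cartesianProduct (upTo D) (upTo (A + 3 * D))) (cong₂ _*_ (length-upTo D) (length-upTo (A + 3 * D))))
          length-indices : length indices ≡ A * (B * B)
          length-indices = trans (length-cartesianProduct (upTo B) low) (trans (cong₂ _*_ (length-upTo B) length-low) (eq A B))
            where
            eq : ∀ a b → b * (a * b) ≡ a * (b * b)
            eq = ℕ-ring

        a : Index → Carrier
        a = proj₁ solution

        Ψ : Poly
        Ψ = ∑ᵖ indices (λ u → const (a u) *ᵖ m u)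

        θΨ : ℕ → Poly
        θΨ s = ∑ᵖ indices (λ u → const (a u) *ᵖ (m u *ᵖ Θ s u))

        Ψ≈θΨ₀ : Ψ ≈ᵖ θΨ 0
        Ψ≈θΨ₀ = ∑ᵖ-cong indices (λ {u} _ → *ᵖ-congʳ (const (a u))
          (solveᵖ 1 (λ m → m := m :* con (pos 1)) ≈-refl (m u)))

        θΨ-suc : ∀ s → R *ᵖ d (θΨ s) ≈ᵖ θΨ (suc s)
        θΨ-suc s = ≈-trans (*ᵖ-congʳ R (d-∑ᵖ indices (λ u → const (a u) *ᵖ (m u *ᵖ Θ s u))))
          (≈-trans (*-distribˡ-∑ᵖ R indices (λ u → d (const (a u) *ᵖ (m u *ᵖ Θ s u)))) (∑ᵖ-cong indices (λ {u} _ → term u)))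
          where
          open ≈-Reasoning
          term : ∀ u → R *ᵖ d (const (a u) *ᵖ (m u *ᵖ Θ s u)) ≈ᵖ const (a u) *ᵖ (m u *ᵖ Θ (suc s) u)
          term u = begin
            R *ᵖ d (const (a u) *ᵖ (m u *ᵖ Θ s u))
              ≈⟨ *ᵖ-congʳ R (≈-trans (d-const* (a u) (m u *ᵖ Θ s u)) (*ᵖ-congʳ (const (a u)) (d-* (m u) (Θ s u)))) ⟩
            R *ᵖ (const (a u) *ᵖ (d (m u) *ᵖ Θ s u +ᵖ m u *ᵖ d (Θ s u)))
              ≈⟨ solveᵖ 6 (λ R a m' t m t' → R :* (a :* (m' :* t :+ m :* t')) := a :* ((R :* m') :* t :+ m :* (R :* t'))) ≈-refl
                   R (const (a u)) (d (m u)) (Θ s u) (m u) (d (Θ s u)) ⟩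
            const (a u) *ᵖ ((R *ᵖ d (m u)) *ᵖ Θ s u +ᵖ m u *ᵖ (R *ᵖ d (Θ s u)))
              ≈⟨ *ᵖ-congʳ (const (a u)) (+ᵖ-cong (*ᵖ-cong (R*d-m u) (≈-refl {Θ s u})) (≈-refl {m u *ᵖ (R *ᵖ d (Θ s u))})) ⟩
            const (a u) *ᵖ (m u *ᵖ L u *ᵖ Θ s u +ᵖ m u *ᵖ (R *ᵖ d (Θ s u)))
              ≈⟨ solveᵖ 5 (λ a m l t r → a :* (m :* l :* t :+ m :* r) := a :* (m :* (l :* t :+ r))) ≈-refl
                   (const (a u)) (m u) (L u) (Θ s u) (R *ᵖ d (Θ s u)) ⟩
            const (a u) *ᵖ (m u *ᵖ Θ (suc s) u) ∎

        reduced : ℕ → Index → Poly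
        reduced s u@(k , (i , j)) = const (a u) *ᵖ (X ^ᵖ i *ᵖ Θ s u)

        Q : ℕ → Poly
        Q s = ∑ᵖ indices (reduced s)

        Q≈0 : ∀ s → s < D → Q s ≈ᵖ []
        Q≈0 s s<D = coefwise vanish
          where
          length-Q : length (Q s) ≤ A + 3 * D
          length-Q = length-∑ᵖ indices (reduced s) bound
            where
            bound : ∀ {u} → u ∈ indices → length (reduced s u) ≤ A + 3 * D
            bound {u@(k , (i , j))} u∈ = ℕₚ.≤-trans
              (length-* (const (a u)) (X ^ᵖ i *ᵖ Θ s u) ℕₚ.≤-refl
                (length-* (X ^ᵖ i) (Θ s u) (length-^ X i ℕₚ.≤-refl) (length-Θ s u)))
              (ℕₚ.+-mono-≤ (∈-upTo⁻ (proj₁ (∈-cartesianProduct⁻ (upTo A) (upTo B) (proj₂ (∈-cartesianProduct⁻ (upTo B) low u∈)))))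
                (ℕₚ.*-monoʳ-≤ 3 (ℕₚ.<⇒≤ s<D)))
          vanish : ∀ n → coef (Q s) n ≡ 0ᵏ
          vanish n with ℕₚ.<-≤-connex n (A + 3 * D)
          ... | inj₂ large = coef-beyond (Q s) n (ℕₚ.≤-trans length-Q large)
          ... | inj₁ small = begin
            coef (Q s) n
              ≡⟨ coef-∑ᵖ n indices (reduced s) ⟩
            ∑ᵏ indices (λ u → coef (reduced s u) n)
              ≡⟨ ∑ᵏ-cong indices (λ {u} _ → coef-reduced u) ⟩
            ∑ᵏ indices (λ u → row (s , n) u *ᵏ a u)
              ≡⟨ All.lookup (proj₂ (proj₂ solution)) (∈-map⁺ row (∈-cartesianProduct⁺ (∈-upTo⁺ s<D) (∈-upTo⁺ small))) ⟩
            0ᵏ ∎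
            where
            open ≡-Reasoning
            coef-reduced : ∀ u → coef (reduced s u) n ≡ row (s , n) u *ᵏ a u
            coef-reduced u@(k , (i , j)) = trans (at (≈-sym (scale≈const* (a u) (X ^ᵖ i *ᵖ Θ s u))) n)
              (trans (coef-scale (a u) (X ^ᵖ i *ᵖ Θ s u) n) (*ᵏ-comm _ _))

        Ψ-vanishes : ∀ {x} → x ∈ W → Vanishes D x Ψ
        Ψ-vanishes {x} x∈W = vanishes-derivation R D R≢0 Ψ θΨ Ψ≈θΨ₀ θΨ-suc zeros
          where
          x≢0 = proj₁ (points x∈W)
          U≢0 = proj₁ (proj₂ (points x∈W))
          V≢0 = proj₁ (proj₂ (proj₂ (points x∈W)))
          x^τ≡1 = proj₁ (proj₂ (proj₂ (proj₂ (points x∈W))))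
          U^τ≡V^τ = proj₂ (proj₂ (proj₂ (proj₂ (points x∈W))))
          w = eval x U ^ᵏ τ
          R≢0 : eval x R ≢ 0ᵏ
          R≢0 z = *-nonzero x≢0 (*-nonzero U≢0 V≢0)
            (trans (sym (trans (eval-* x X (U *ᵖ V)) (cong₂ _*ᵏ_ (eval-X x) (eval-* x U V)))) z)
          power : ∀ y n → y ^ᵏ (n * τ) ≡ (y ^ᵏ τ) ^ᵏ n
          power y n = trans (cong (y ^ᵏ_) (ℕₚ.*-comm n τ)) (^-* y τ n)
          eval-UV : ∀ {k} → k < B → eval x (UV B k) ≡ w ^ᵏ (B ∸ 1)
          eval-UV {k} k<B = begin
            eval x (UV B k)
              ≡⟨ eval-* x (U ^ᵖ (k * τ)) (V ^ᵖ ((B ∸ suc k) * τ)) ⟩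
            eval x (U ^ᵖ (k * τ)) *ᵏ eval x (V ^ᵖ ((B ∸ suc k) * τ))
              ≡⟨ cong₂ _*ᵏ_ (trans (eval-^ x U (k * τ)) (power (eval x U) k))
                   (trans (eval-^ x V ((B ∸ suc k) * τ)) (trans (power (eval x V) (B ∸ suc k)) (cong (_^ᵏ (B ∸ suc k)) (sym U^τ≡V^τ)))) ⟩
            w ^ᵏ k *ᵏ w ^ᵏ (B ∸ suc k)
              ≡⟨ sym (^-+ w k (B ∸ suc k)) ⟩
            w ^ᵏ (k + (B ∸ suc k))
              ≡⟨ cong (w ^ᵏ_) (exponents B k k<B) ⟩
            w ^ᵏ (B ∸ 1) ∎
            where
            open ≡-Reasoning
            exponents : ∀ B k → k < B → k + (B ∸ suc k) ≡ B ∸ 1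
            exponents (suc B) k (s≤s k≤B) = ℕₚ.m+[n∸m]≡n k≤B
          eval-X^ : ∀ i j → eval x (X ^ᵖ (i + j * τ)) ≡ eval x (X ^ᵖ i)
          eval-X^ i j = begin
            eval x (X ^ᵖ (i + j * τ))        ≡⟨ eval-^ x X (i + j * τ) ⟩
            eval x X ^ᵏ (i + j * τ)          ≡⟨ ^-+ (eval x X) i (j * τ) ⟩
            eval x X ^ᵏ i *ᵏ eval x X ^ᵏ (j * τ)
              ≡⟨ cong₂ _*ᵏ_ (sym (eval-^ x X i)) (trans (cong (_^ᵏ (j * τ)) (eval-X x)) (trans (power x j) (trans (cong (_^ᵏ j) x^τ≡1) (1^ j)))) ⟩
            eval x (X ^ᵖ i) *ᵏ 1ᵏ            ≡⟨ *-identityʳ _ ⟩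
            eval x (X ^ᵖ i)                  ∎
            where open ≡-Reasoning
          term : ∀ s {u} → u ∈ indices → eval x (const (a u) *ᵖ (m u *ᵖ Θ s u)) ≡ w ^ᵏ (B ∸ 1) *ᵏ eval x (reduced s u)
          term s {u@(k , (i , j))} u∈ = begin
            eval x (const (a u) *ᵖ (m u *ᵖ Θ s u))
              ≡⟨ trans (eval-* x (const (a u)) (m u *ᵖ Θ s u)) (cong (eval x (const (a u)) *ᵏ_) (eval-* x (m u) (Θ s u))) ⟩
            eval x (const (a u)) *ᵏ (eval x (m u) *ᵏ eval x (Θ s u))
              ≡⟨ cong (λ z → eval x (const (a u)) *ᵏ (z *ᵏ eval x (Θ s u)))
                   (trans (eval-* x (X ^ᵖ (i + j * τ)) (UV B k)) (cong₂ _*ᵏ_ (eval-X^ i j)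
                     (eval-UV (∈-upTo⁻ (proj₁ (∈-cartesianProduct⁻ (upTo B) low u∈)))))) ⟩
            eval x (const (a u)) *ᵏ (eval x (X ^ᵖ i) *ᵏ w ^ᵏ (B ∸ 1) *ᵏ eval x (Θ s u))
              ≡⟨ solve 4 (λ a y w t → a :* (y :* w :* t) := w :* (a :* (y :* t))) refl _ _ (w ^ᵏ (B ∸ 1)) _ ⟩
            w ^ᵏ (B ∸ 1) *ᵏ (eval x (const (a u)) *ᵏ (eval x (X ^ᵖ i) *ᵏ eval x (Θ s u)))
              ≡⟨ cong (w ^ᵏ (B ∸ 1) *ᵏ_) (sym (trans (eval-* x (const (a u)) (X ^ᵖ i *ᵖ Θ s u))
                   (cong (eval x (const (a u)) *ᵏ_) (eval-* x (X ^ᵖ i) (Θ s u))))) ⟩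
            w ^ᵏ (B ∸ 1) *ᵏ eval x (reduced s u) ∎
            where open ≡-Reasoning
          zeros : ∀ s → s < D → eval x (θΨ s) ≡ 0ᵏ
          zeros s s<D = begin
            eval x (θΨ s)
              ≡⟨ eval-∑ᵖ x indices (λ u → const (a u) *ᵖ (m u *ᵖ Θ s u)) ⟩
            ∑ᵏ indices (λ u → eval x (const (a u) *ᵖ (m u *ᵖ Θ s u)))
              ≡⟨ ∑ᵏ-cong indices (term s) ⟩
            ∑ᵏ indices (λ u → w ^ᵏ (B ∸ 1) *ᵏ eval x (reduced s u))
              ≡⟨ sym (*-distribˡ-∑ᵏ (w ^ᵏ (B ∸ 1)) indices (λ u → eval x (reduced s u))) ⟩
            w ^ᵏ (B ∸ 1) *ᵏ ∑ᵏ indices (λ u → eval x (reduced s u))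
              ≡⟨ cong (w ^ᵏ (B ∸ 1) *ᵏ_) (trans (sym (eval-∑ᵖ x indices (reduced s))) (eval-cong x (Q≈0 s s<D))) ⟩
            w ^ᵏ (B ∸ 1) *ᵏ 0ᵏ
              ≡⟨ zeroʳ _ ⟩
            0ᵏ ∎
            where open ≡-Reasoning

        length-Ψ : length Ψ ≤ A + τ * (B + B)
        length-Ψ = length-∑ᵖ indices (λ u → const (a u) *ᵖ m u) bound
          where
          open ℕₚ.≤-Reasoning
          bound : ∀ {u} → u ∈ indices → length (const (a u) *ᵖ m u) ≤ A + τ * (B + B)
          bound {u@(k , (i , j))} u∈ = begin
            length (const (a u) *ᵖ m u)
              ≤⟨ length-* (const (a u)) (m u) ℕₚ.≤-refl (length-* (X ^ᵖ (i + j * τ)) (UV B k) (length-^ X (i + j * τ) ℕₚ.≤-refl)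
                   (length-* (U ^ᵖ (k * τ)) (V ^ᵖ ((B ∸ suc k) * τ)) (length-^ U (k * τ) ℕₚ.≤-refl)
                     (length-^ V ((B ∸ suc k) * τ) ℕₚ.≤-refl))) ⟩
            suc i + j * τ + (k * τ + (B ∸ suc k) * τ)
              ≡⟨ cong (suc i + j * τ +_) (sym (ℕₚ.*-distribʳ-+ τ k (B ∸ suc k))) ⟩
            suc i + j * τ + (k + (B ∸ suc k)) * τ
              ≤⟨ ℕₚ.+-mono-≤ (ℕₚ.+-mono-≤ (∈-upTo⁻ (proj₁ ij∈)) (ℕₚ.*-monoˡ-≤ τ (ℕₚ.<⇒≤ (∈-upTo⁻ (proj₂ ij∈)))))
                   (ℕₚ.*-monoˡ-≤ τ (exponents B k k<B)) ⟩
            A + B * τ + B * τ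
              ≡⟨ eq A B τ ⟩
            A + τ * (B + B) ∎
            where
            ij∈ = ∈-cartesianProduct⁻ (upTo A) (upTo B) (proj₂ (∈-cartesianProduct⁻ (upTo B) low u∈))
            k<B = ∈-upTo⁻ (proj₁ (∈-cartesianProduct⁻ (upTo B) low u∈))
            exponents : ∀ B k → k < B → k + (B ∸ suc k) ≤ B
            exponents (suc B) k (s≤s k≤B) = ℕₚ.≤-trans (ℕₚ.≤-reflexive (ℕₚ.m+[n∸m]≡n k≤B)) (ℕₚ.n≤1+n B)
            eq : ∀ A B t → A + B * t + B * t ≡ A + t * (B + B)
            eq = ℕ-ring

        exponent<p : ∀ {ij} → ij ∈ low → exponent ij < p
        exponent<p {i , j} ij∈ = ℕₚ.<-≤-trans
          (ℕₚ.+-mono-<-≤ (∈-upTo⁻ (proj₁ ij∈')) (ℕₚ.≤-trans (ℕₚ.*-monoˡ-≤ τ (ℕₚ.<⇒≤ (∈-upTo⁻ (proj₂ ij∈'))))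
            (ℕₚ.≤-trans (ℕₚ.≤-reflexive (ℕₚ.*-comm B τ)) (ℕₚ.*-monoʳ-≤ τ (ℕₚ.m≤m+n B B))))) low-degree
          where ij∈' = ∈-cartesianProduct⁻ (upTo A) (upTo B) ij∈

        exponent-injective : ∀ {ij ij'} → ij ∈ low → ij' ∈ low → exponent ij ≡ exponent ij' → ij ≡ ij'
        exponent-injective {i , j} {i' , j'} ij∈ ij'∈ eq = cong₂ _,_ i≡i'
          (ℕₚ.*-cancelʳ-≡ j j' τ (ℕₚ.+-cancelˡ-≡ i (j * τ) (j' * τ) (trans eq (cong (_+ j' * τ) (sym i≡i')))))
          where
          residue : ∀ {i j} → (i , j) ∈ low → (i + j * τ) % τ ≡ i
          residue {i} {j} ij∈ = trans ([m+kn]%n≡m%n i j τ)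
            (m<n⇒m%n≡m (ℕₚ.<-≤-trans (∈-upTo⁻ (proj₁ (∈-cartesianProduct⁻ (upTo A) (upTo B) ij∈))) A≤τ))
          i≡i' : i ≡ i'
          i≡i' = trans (sym (residue ij∈)) (trans (cong (_% τ) eq) (residue ij'∈))

        low-part : ℕ → Poly
        low-part k = ∑ᵖ low (monomial exponent (λ ij → a (k , ij)))

        low-part-sparse : ∀ k → Vanishes τ c (low-part k) → low-part k ≈ᵖ [] × (∀ {ij} → ij ∈ low → a (k , ij) ≡ 0ᵏ)
        low-part-sparse k v = ≈-trans (∑ᵖ-cong low (λ ij∈ → zero-term (coefficients ij∈))) (∑ᵖ-[] low) , coefficients
          where
          coefficients : ∀ {ij} → ij ∈ low → a (k , ij) ≡ 0ᵏ
          coefficients = sparse-vanishing exponent c≢0 low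
            (allPairs low-unique (λ i∈ j∈ i≢j e → i≢j (exponent-injective i∈ j∈ (fromℕ-injective (exponent<p i∈) (exponent<p j∈) e))))
            (λ ij → a (k , ij)) (vanishes-≤ (ℕₚ.≤-trans (ℕₚ.≤-reflexive length-low) AB≤τ) v)
          zero-term : ∀ {ij} → a (k , ij) ≡ 0ᵏ → monomial exponent (λ ij → a (k , ij)) ij ≈ᵖ []
          zero-term {ij} z = *ᵖ-cong {const (a (k , ij))} {[]} (coefwise λ { zero → z ; (suc n) → refl }) (≈-refl {X ^ᵖ exponent ij})
          ∑ᵖ-[] : {I : Set} (is : List I) → ∑ᵖ is (λ _ → []) ≈ᵖ []
          ∑ᵖ-[] [] = ≈-refl
          ∑ᵖ-[] (i ∷ is) = ∑ᵖ-[] is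

        Ψ≈UV-sum : Ψ ≈ᵖ UV-sum B low-part
        Ψ≈UV-sum = ≈-trans (∑ᵖ-product (upTo B) low (λ u → const (a u) *ᵖ m u)) (∑ᵖ-cong (upTo B) (λ {k} _ →
          ≈-trans (∑ᵖ-cong low (λ {ij} _ → solveᵖ 3 (λ a x w → a :* (x :* w) := w :* (a :* x)) ≈-refl
                     (const (a (k , ij))) (X ^ᵖ exponent ij) (UV B k)))
            (≈-sym (*-distribˡ-∑ᵖ (UV B k) low (monomial exponent (λ ij → a (k , ij)))))))

      -- Otherwise Ψ has more zeros, counted with order D, than its length allows and is zero;
      -- independence then makes every coefficient vanish, whereas the solution of the linear system
      -- is nontrivial.
      stepanov : length W * D < A + τ * (B + B)
      stepanov with ℕₚ.<-≤-connex (length W * D) (A + τ * (B + B))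
      ... | inj₁ bound = bound
      ... | inj₂ many = ⊥-elim (a≢0 (UV-independent B low-part (λ k → ∀ {ij} → ij ∈ low → a (k , ij) ≡ 0ᵏ) low-part-sparse
              (≈-trans (≈-sym Ψ≈UV-sum) (vanishing-everywhere D≤p uW Ψ-vanishes (ℕₚ.≤-trans length-Ψ many)))
              (∈-upTo⁻ (proj₁ u∈)) (proj₂ u∈)))
        where
        u∈ = ∈-cartesianProduct⁻ (upTo B) low (proj₁ (proj₂ (proj₁ (proj₂ solution))))
        a≢0 = proj₂ (proj₂ (proj₁ (proj₂ solution)))

-- Energy of sums of two and three elements in a group of norm-one elements.

∑-filter : {A : Set} {P : A → Set} (P? : ∀ x → Dec (P x)) (xs : List A) →
  ∑ xs (λ x → ⟪ P? x ⟫) ≡ length (filter P? xs)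
∑-filter P? [] = refl
∑-filter P? (x ∷ xs) with P? x
... | yes _ = cong suc (∑-filter P? xs)
... | no _ = ∑-filter P? xs

module Conjugation (𝔽 : FiniteField) where
  open FiniteField 𝔽

  module NormOneGroup (bar : Carrier → Carrier)
    (bar-+ : ∀ x y → bar (x +ᵏ y) ≡ bar x +ᵏ bar y) (bar-neg : ∀ x → bar (-ᵏ x) ≡ -ᵏ bar x)
    (bar-* : ∀ x y → bar (x *ᵏ y) ≡ bar x *ᵏ bar y) (bar-1 : bar 1ᵏ ≡ 1ᵏ) (bar-bar : ∀ x → bar (bar x) ≡ x)
    (G : List Carrier) (G-unique : Unique G) (norm-1 : ∀ {u} → u ∈ G → u *ᵏ bar u ≡ 1ᵏ)
    (G-power : ∀ {u} → u ∈ G → u ^ᵏ length G ≡ 1ᵏ) (0<τ : 0 < length G) where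
    open Collisions _≟_
    open import Data.List.Membership.DecPropositional _≟_ using (_∈?_)
    open import Data.List.Membership.Propositional.Properties
      using (∈-map⁺; ∈-cartesianProduct⁺; ∈-cartesianProduct⁻; ∈-deduplicate⁺; ∈-filter⁻)
    import Data.List.Relation.Unary.Unique.DecPropositional.Properties _≟_ as Uniqueₚ
    open import Data.Nat.Tactic.RingSolver using () renaming (solve-∀ to ℕ-ring)

    τ : ℕ
    τ = length G

    private instance
      τ-nonZero : NonZero τ
      τ-nonZero = >-nonZero 0<τ

    rep : Carrier → ℕ
    rep x = ∑ G (λ u → ∑ G (λ v → ⟪ x ≟ u +ᵏ v ⟫))

    private
      one-partner : ∀ x u → ∑ G (λ v → ⟪ x ≟ u +ᵏ v ⟫) ≤ 1
      one-partner x u = ∑-atMostOne (λ v → x ≟ u +ᵏ v) G-unique (λ e e' → +-cancelˡ (trans (sym e) e'))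

      one-negative : ∀ u → ∑ G (λ v → ⟪ u +ᵏ v ≟ 0ᵏ ⟫) ≤ 1
      one-negative u = ∑-atMostOne (λ v → u +ᵏ v ≟ 0ᵏ) G-unique (λ e e' → +-cancelˡ (trans e (sym e')))

      one-negative′ : ∀ u → ∑ G (λ v → ⟪ v +ᵏ u ≟ 0ᵏ ⟫) ≤ 1
      one-negative′ u = ∑-atMostOne (λ v → v +ᵏ u ≟ 0ᵏ) G-unique
        (λ e e' → +-cancelˡ (trans (+ᵏ-comm u _) (trans e (trans (sym e') (+ᵏ-comm _ u)))))

      -- Conjugation inverts elements of norm one: 1/u + 1/v = (u + v)/(u v).
      bar-sum : ∀ {u v} → u ∈ G → v ∈ G → bar (u +ᵏ v) *ᵏ (u *ᵏ v) ≡ u +ᵏ v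
      bar-sum {u} {v} u∈ v∈ = begin
        bar (u +ᵏ v) *ᵏ (u *ᵏ v)               ≡⟨ cong (_*ᵏ (u *ᵏ v)) (bar-+ u v) ⟩
        (bar u +ᵏ bar v) *ᵏ (u *ᵏ v)           ≡⟨ solve 4 (λ ū v̄ u v → (ū :+ v̄) :* (u :* v) := (v :* v̄) :* u :+ (u :* ū) :* v) refl (bar u) (bar v) u v ⟩
        (v *ᵏ bar v) *ᵏ u +ᵏ (u *ᵏ bar u) *ᵏ v ≡⟨ cong₂ (λ a b → a *ᵏ u +ᵏ b *ᵏ v) (norm-1 v∈) (norm-1 u∈) ⟩
        1ᵏ *ᵏ u +ᵏ 1ᵏ *ᵏ v                     ≡⟨ cong₂ _+ᵏ_ (*-identityˡ u) (*-identityˡ v) ⟩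
        u +ᵏ v                                 ∎
        where open ≡-Reasoning

      split : ∀ x u → x ≡ u +ᵏ (x +ᵏ -ᵏ u)
      split = solve 2 (λ x u → x := u :+ (x :+ :- u)) refl

      Summand : Carrier → Carrier → Set
      Summand x u = (x +ᵏ -ᵏ u) ∈ G

      summand? : ∀ x u → Dec (Summand x u)
      summand? x u = (x +ᵏ -ᵏ u) ∈? G

      -- u + v and its conjugate u⁻¹ + v⁻¹ determine the product u v, hence the pair {u, v}.
      two-summands : ∀ {x} → x ≢ 0ᵏ → ∀ {u u'} → u ∈ G → u' ∈ G → Summand x u → Summand x u' → u ≡ u' ⊎ u ≡ x +ᵏ -ᵏ u'
      two-summands {x} x≢0 {u} {u'} u∈ u'∈ v∈ v'∈ with u ≟ u'
      ... | yes u≡u' = inj₁ u≡u'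
      ... | no u≢u' = inj₂ (sym (x-y≡0⇒x≡y (trans (solve 3 (λ x u u' → x :+ :- u' :+ :- u := x :+ :- u :+ :- u') refl x u u')
          (*-cancelˡ-0 (u≢u' ∘ x-y≡0⇒x≡y) (*-cancelˡ-0 bar≢0 (begin
            bar x *ᵏ ((u +ᵏ -ᵏ u') *ᵏ (x +ᵏ -ᵏ u +ᵏ -ᵏ u'))
              ≡⟨ solve 4 (λ x̄ x u u' → x̄ :* ((u :+ :- u') :* (x :+ :- u :+ :- u')) :=
                   x̄ :* (u :* (x :+ :- u)) :+ :- (x̄ :* (u' :* (x :+ :- u')))) refl (bar x) x u u' ⟩
            bar x *ᵏ (u *ᵏ (x +ᵏ -ᵏ u)) +ᵏ -ᵏ (bar x *ᵏ (u' *ᵏ (x +ᵏ -ᵏ u')))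
              ≡⟨ cong₂ (λ a b → a +ᵏ -ᵏ b) (product u∈ v∈) (product u'∈ v'∈) ⟩
            x +ᵏ -ᵏ x
              ≡⟨ -‿inverseʳ x ⟩
            0ᵏ ∎))))))
        where
        open ≡-Reasoning
        product : ∀ {u} → u ∈ G → Summand x u → bar x *ᵏ (u *ᵏ (x +ᵏ -ᵏ u)) ≡ x
        product {u} u∈ v∈ = trans (cong (λ z → bar z *ᵏ (u *ᵏ (x +ᵏ -ᵏ u))) (split x u)) (trans (bar-sum u∈ v∈) (sym (split x u)))
        bar≢0 : bar x ≢ 0ᵏ
        bar≢0 z = x≢0 (trans (sym (product u∈ v∈)) (trans (cong (_*ᵏ _) z) (zeroˡ _)))

      partners≤ : ∀ x u → ∑ G (λ v → ⟪ x ≟ u +ᵏ v ⟫) ≤ ⟪ summand? x u ⟫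
      partners≤ x u with summand? x u
      ... | yes _ = one-partner x u
      ... | no ∉G = ℕₚ.≤-trans (∑-bound 0 G (λ {v} v∈ → ℕₚ.≤-reflexive (⟪⟫-no (x ≟ u +ᵏ v) (λ e → ∉G
          (subst (_∈ G) (trans (solve 2 (λ u v → v := u :+ v :+ :- u) refl u v) (cong (_+ᵏ -ᵏ u) (sym e))) v∈)))))
        (ℕₚ.≤-reflexive (ℕₚ.*-zeroʳ τ))

      rep≤2 : ∀ {x} → x ≢ 0ᵏ → rep x ≤ 2
      rep≤2 {x} x≢0 with Any.any? (summand? x) G
      ... | no none = ℕₚ.≤-trans (ℕₚ.≤-trans (∑-mono G (λ {u} _ → partners≤ x u))
            (∑-bound 0 G (λ {u} u∈ → ℕₚ.≤-reflexive (⟪⟫-no (summand? x u) (λ v∈ → none (lose u∈ v∈))))))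
          (ℕₚ.≤-trans (ℕₚ.≤-reflexive (ℕₚ.*-zeroʳ τ)) z≤n)
        where open import Data.List.Membership.Propositional using (lose)
      ... | yes some = begin
          rep x
            ≤⟨ ∑-mono G (λ {u} _ → partners≤ x u) ⟩
          ∑ G (λ u → ⟪ summand? x u ⟫)
            ≤⟨ ∑-mono G (λ u∈ → one-of-two u∈) ⟩
          ∑ G (λ u → ⟪ u ≟ u₁ ⟫ + ⟪ u ≟ x +ᵏ -ᵏ u₁ ⟫)
            ≡⟨ ∑-distrib-+ G _ _ ⟩
          ∑ G (λ u → ⟪ u ≟ u₁ ⟫) + ∑ G (λ u → ⟪ u ≟ x +ᵏ -ᵏ u₁ ⟫)
            ≤⟨ ℕₚ.+-mono-≤ (∑-atMostOne (_≟ u₁) G-unique (λ e e' → trans e (sym e')))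
                 (∑-atMostOne (_≟ (x +ᵏ -ᵏ u₁)) G-unique (λ e e' → trans e (sym e'))) ⟩
          2 ∎
        where
        open ℕₚ.≤-Reasoning
        open import Data.List.Membership.Propositional using (find)
        u₁ = proj₁ (find some)
        one-of-two : ∀ {u} → u ∈ G → ⟪ summand? x u ⟫ ≤ ⟪ u ≟ u₁ ⟫ + ⟪ u ≟ x +ᵏ -ᵏ u₁ ⟫
        one-of-two {u} u∈ with summand? x u
        ... | no _ = z≤n
        ... | yes v∈ with two-summands x≢0 u∈ (proj₁ (proj₂ (find some))) v∈ (proj₂ (proj₂ (find some)))
        ... | inj₁ e = ℕₚ.≤-trans (ℕₚ.≤-reflexive (sym (⟪⟫-yes (u ≟ u₁) e))) (ℕₚ.m≤m+n _ _)
        ... | inj₂ e = ℕₚ.≤-trans (ℕₚ.≤-reflexive (sym (⟪⟫-yes (u ≟ x +ᵏ -ᵏ u₁) e))) (ℕₚ.m≤n+m _ ⟪ u ≟ u₁ ⟫)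

      rep≤ : ∀ x → rep x ≤ 2 + τ * ⟪ x ≟ 0ᵏ ⟫
      rep≤ x with x ≟ 0ᵏ
      ... | no x≢0 = ℕₚ.≤-trans (rep≤2 x≢0) (ℕₚ.m≤m+n 2 _)
      ... | yes _ = ℕₚ.≤-trans (∑-bound 1 G (λ {u} _ → one-partner x u)) (ℕₚ.m≤n+m _ 2)

    pairs : List (Carrier × Carrier)
    pairs = cartesianProduct G G

    triples : List (Carrier × (Carrier × Carrier))
    triples = cartesianProduct G pairs

    sum₂ : Carrier × Carrier → Carrier
    sum₂ (u , v) = u +ᵏ v

    sum₃ : Carrier × (Carrier × Carrier) → Carrier
    sum₃ (w , uv) = w +ᵏ sum₂ uv

    2G 3G : List Carrier
    2G = deduplicate _≟_ (map sum₂ pairs)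
    3G = deduplicate _≟_ (map sum₃ triples)

    private
      length-pairs : length pairs ≡ τ * τ
      length-pairs = length-cartesianProduct G G

      length-triples : length triples ≡ τ * (τ * τ)
      length-triples = trans (length-cartesianProduct G pairs) (cong (τ *_) length-pairs)

      -- Two ordered representations at most for each of the τ² pairs, and up to τ more for the at
      -- most τ pairs with sum 0.
      energy₂ : collisions pairs sum₂ ≤ 3 * (τ * τ)
      energy₂ = begin
        collisions pairs sum₂
          ≡⟨ ∑-cong pairs (λ i → ∑-product G G _) ⟩
        ∑ pairs (λ i → rep (sum₂ i))
          ≤⟨ ∑-mono pairs (λ {i} _ → rep≤ (sum₂ i)) ⟩
        ∑ pairs (λ i → 2 + τ * ⟪ sum₂ i ≟ 0ᵏ ⟫)
          ≡⟨ ∑-distrib-+ pairs _ _ ⟩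
        ∑ pairs (λ i → 2) + ∑ pairs (λ i → τ * ⟪ sum₂ i ≟ 0ᵏ ⟫)
          ≡⟨ cong₂ _+_ (trans (∑-const 2 pairs) (cong (_* 2) length-pairs)) (sym (*-distribˡ-∑ τ pairs _)) ⟩
        τ * τ * 2 + τ * ∑ pairs (λ i → ⟪ sum₂ i ≟ 0ᵏ ⟫)
          ≡⟨ cong (λ k → τ * τ * 2 + τ * k) (∑-product G G _) ⟩
        τ * τ * 2 + τ * ∑ G (λ u → ∑ G (λ v → ⟪ u +ᵏ v ≟ 0ᵏ ⟫))
          ≤⟨ ℕₚ.+-monoʳ-≤ (τ * τ * 2) (ℕₚ.*-monoʳ-≤ τ (∑-bound 1 G (λ {u} _ → one-negative u))) ⟩
        τ * τ * 2 + τ * (τ * 1)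
          ≡⟨ eq τ ⟩
        3 * (τ * τ) ∎
        where
        open ℕₚ.≤-Reasoning
        eq : ∀ t → t * t * 2 + t * (t * 1) ≡ 3 * (t * t)
        eq = ℕ-ring

    2G-large : τ * τ ≤ 3 * length 2G
    2G-large = ℕₚ.*-cancelʳ-≤ _ _ (τ * τ) {{ℕₚ.m*n≢0 τ τ}} (begin
      τ * τ * (τ * τ)                      ≡⟨ cong₂ _*_ (sym length-pairs) (sym length-pairs) ⟩
      length pairs * length pairs          ≤⟨ length²≤image*collisions pairs sum₂ (Uniqueₚ.deduplicate-! (map sum₂ pairs))
                                                (λ i∈ → ∈-deduplicate⁺ _≟_ (∈-map⁺ sum₂ i∈)) ⟩
      length 2G * collisions pairs sum₂    ≤⟨ ℕₚ.*-monoʳ-≤ (length 2G) energy₂ ⟩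
      length 2G * (3 * (τ * τ))            ≡⟨ eq (length 2G) (τ * τ) ⟩
      3 * length 2G * (τ * τ)              ∎)
      where
      open ℕₚ.≤-Reasoning
      eq : ∀ s t → s * (3 * t) ≡ 3 * s * t
      eq = ℕ-ring

    -- Here h stands for the integer part of (τ/2)^(1/4), and 5 h τ ≤ p bounds the degree in
    -- Stepanov's method.
    module _ (p : ℕ) (characteristic : ∀ n → 0 < n → n < p → Polynomial.fromℕ 𝔽 n ≢ 0ᵏ)
             (h : ℕ) (2≤h : 2 ≤ h) (2h⁴≤τ : 2 * (h * h * (h * h)) ≤ τ) (5hτ≤p : 5 * (h * τ) ≤ p) where
      private
        module _ (c : Carrier) where
          Curve : Carrier → Set
          Curve w = (c +ᵏ -ᵏ w) ^ᵏ τ ≡ (bar c *ᵏ w +ᵏ -ᵏ 1ᵏ) ^ᵏ τ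

          curve? : ∀ w → Dec (Curve w)
          curve? w = (c +ᵏ -ᵏ w) ^ᵏ τ ≟ (bar c *ᵏ w +ᵏ -ᵏ 1ᵏ) ^ᵏ τ

          curve-points : List Carrier
          curve-points = filter curve? G

          module _ (norm≢1 : c *ᵏ bar c ≢ 1ᵏ) where
            norm-1⇒nonzero : ∀ {w} → w ∈ G → w ≢ 0ᵏ
            norm-1⇒nonzero w∈ refl = 1≢0 (trans (sym (norm-1 w∈)) (zeroˡ _))

            c≢w : ∀ {w} → w ∈ G → c +ᵏ -ᵏ w ≢ 0ᵏ
            c≢w w∈ e = norm≢1 (subst (λ z → z *ᵏ bar z ≡ 1ᵏ) (sym (x-y≡0⇒x≡y e)) (norm-1 w∈))

            bar-c*w≢1 : ∀ {w} → w ∈ G → bar c *ᵏ w +ᵏ -ᵏ 1ᵏ ≢ 0ᵏ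
            bar-c*w≢1 {w} w∈ e = norm≢1 (subst (λ z → z *ᵏ bar z ≡ 1ᵏ) (sym c≡w) (norm-1 w∈))
              where
              open ≡-Reasoning
              c*bar-w≡1 : c *ᵏ bar w ≡ 1ᵏ
              c*bar-w≡1 = begin
                c *ᵏ bar w               ≡⟨ cong (_*ᵏ bar w) (sym (bar-bar c)) ⟩
                bar (bar c) *ᵏ bar w     ≡⟨ sym (bar-* (bar c) w) ⟩
                bar (bar c *ᵏ w)         ≡⟨ cong bar (x-y≡0⇒x≡y e) ⟩
                bar 1ᵏ                   ≡⟨ bar-1 ⟩
                1ᵏ                       ∎
              c≡w : c ≡ w
              c≡w = begin
                c                        ≡⟨ sym (*-identityʳ c) ⟩
                c *ᵏ 1ᵏ                  ≡⟨ cong (c *ᵏ_) (sym (norm-1 w∈)) ⟩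
                c *ᵏ (w *ᵏ bar w)        ≡⟨ solve 3 (λ c w w̄ → c :* (w :* w̄) := (c :* w̄) :* w) refl c w (bar w) ⟩
                c *ᵏ bar w *ᵏ w          ≡⟨ cong (_*ᵏ w) c*bar-w≡1 ⟩
                1ᵏ *ᵏ w                  ≡⟨ *-identityˡ w ⟩
                w                        ∎

            -- If c = w + u + v then x = c - w satisfies x = x̄ u v, hence x^τ = x̄^τ = (x̄ w)^τ with x̄ w = c̄ w - 1.
            rep≤2*curve : ∀ {w} → w ∈ G → rep (c +ᵏ -ᵏ w) ≤ 2 * ⟪ curve? w ⟫
            rep≤2*curve {w} w∈ with curve? w
            ... | yes _ = rep≤2 (c≢w w∈)
            ... | no off = ℕₚ.≤-trans (∑-bound 0 G (λ {u} u∈ → ℕₚ.≤-trans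
                (∑-bound 0 G (λ {v} v∈ → ℕₚ.≤-reflexive (⟪⟫-no (_ ≟ _) (λ e → off (on-curve u∈ v∈ e)))))
                (ℕₚ.≤-reflexive (ℕₚ.*-zeroʳ τ)))) (ℕₚ.≤-reflexive (ℕₚ.*-zeroʳ τ))
              where
              on-curve : ∀ {u v} → u ∈ G → v ∈ G → c +ᵏ -ᵏ w ≡ u +ᵏ v → Curve w
              on-curve {u} {v} u∈ v∈ e = begin
                x ^ᵏ τ                                     ≡⟨ cong (_^ᵏ τ) (trans e (trans (sym (bar-sum u∈ v∈)) (cong (λ z → bar z *ᵏ (u *ᵏ v)) (sym e)))) ⟩
                (bar x *ᵏ (u *ᵏ v)) ^ᵏ τ                   ≡⟨ trans (^-distrib-* (bar x) (u *ᵏ v) τ) (cong (bar x ^ᵏ τ *ᵏ_) (^-distrib-* u v τ)) ⟩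
                bar x ^ᵏ τ *ᵏ (u ^ᵏ τ *ᵏ v ^ᵏ τ)           ≡⟨ cong₂ (λ a b → bar x ^ᵏ τ *ᵏ (a *ᵏ b)) (G-power u∈) (G-power v∈) ⟩
                bar x ^ᵏ τ *ᵏ (1ᵏ *ᵏ 1ᵏ)                   ≡⟨ cong (bar x ^ᵏ τ *ᵏ_) (trans (*-identityˡ 1ᵏ) (sym (G-power w∈))) ⟩
                bar x ^ᵏ τ *ᵏ w ^ᵏ τ                       ≡⟨ sym (^-distrib-* (bar x) w τ) ⟩
                (bar x *ᵏ w) ^ᵏ τ                          ≡⟨ cong (_^ᵏ τ) bar-x*w ⟩
                (bar c *ᵏ w +ᵏ -ᵏ 1ᵏ) ^ᵏ τ                 ∎
                where
                open ≡-Reasoning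
                x = c +ᵏ -ᵏ w
                bar-x*w : bar x *ᵏ w ≡ bar c *ᵏ w +ᵏ -ᵏ 1ᵏ
                bar-x*w = begin
                  bar x *ᵏ w                          ≡⟨ cong (_*ᵏ w) (trans (bar-+ c (-ᵏ w)) (cong (bar c +ᵏ_) (bar-neg w))) ⟩
                  (bar c +ᵏ -ᵏ bar w) *ᵏ w            ≡⟨ solve 3 (λ c̄ w̄ w → (c̄ :+ :- w̄) :* w := c̄ :* w :+ :- (w :* w̄)) refl (bar c) (bar w) w ⟩
                  bar c *ᵏ w +ᵏ -ᵏ (w *ᵏ bar w)       ≡⟨ cong (λ z → bar c *ᵏ w +ᵏ -ᵏ z) (norm-1 w∈) ⟩
                  bar c *ᵏ w +ᵏ -ᵏ 1ᵏ                 ∎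

            -- Stepanov with A = h³, B = 2 h, D = h². Then A B = 2 h⁴ is at most τ, A B² = 4 h⁵
            -- beats D (A + 3 D) = h⁵ + 3 h⁴ once h is at least 2, and (A + 2 B τ) / D is of order τ
            -- / h.
            few-curve-points : c ≢ 0ᵏ → length curve-points * h ≤ 5 * τ
            few-curve-points c≢0 = ℕₚ.*-cancelʳ-≤ _ _ h {{h-nonZero}} (begin
              length curve-points * h * h           ≡⟨ ℕₚ.*-assoc (length curve-points) h h ⟩
              length curve-points * (h * h)         ≤⟨ ℕₚ.<⇒≤ (stepanov τ 0<τ c (bar c) c≢0 ec≢1
                                                         (h * h * h) (2 * h) (h * h) AB≤τ 0<2h few low-degree D≤p
                                                         (Uniqueₚ.filter⁺ curve? G-unique) points) ⟩
              h * h * h + τ * (2 * h + 2 * h)       ≤⟨ ℕₚ.+-monoˡ-≤ _ (ℕₚ.*-monoˡ-≤ h h²≤τ) ⟩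
              τ * h + τ * (2 * h + 2 * h)           ≡⟨ e₀ τ h ⟩
              5 * τ * h                             ∎)
              where
              open ℕₚ.≤-Reasoning
              open Stepanov 𝔽 p characteristic
              h-nonZero : NonZero h
              h-nonZero = >-nonZero (ℕₚ.<-≤-trans (s≤s z≤n) 2≤h)
              instance
                _ = h-nonZero
                h²-nonZero : NonZero (h * h)
                h²-nonZero = ℕₚ.m*n≢0 h h
              ec≢1 : bar c *ᵏ c ≢ 1ᵏ
              ec≢1 e = norm≢1 (trans (*ᵏ-comm c (bar c)) e)
              e₀ : ∀ t h → t * h + t * (2 * h + 2 * h) ≡ 5 * t * h
              e₀ = ℕ-ring
              e₁ : ∀ h → h * h * h * (2 * h) ≡ 2 * (h * h * (h * h))
              e₁ = ℕ-ring
              AB≤τ : h * h * h * (2 * h) ≤ τ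
              AB≤τ = ℕₚ.≤-trans (ℕₚ.≤-reflexive (e₁ h)) 2h⁴≤τ
              h²≤τ : h * h ≤ τ
              h²≤τ = ℕₚ.≤-trans (ℕₚ.m≤m*n (h * h) (h * h)) (ℕₚ.≤-trans (ℕₚ.m≤n*m _ 2) 2h⁴≤τ)
              0<2h : 0 < 2 * h
              0<2h = ℕₚ.<-≤-trans (s≤s z≤n) (ℕₚ.≤-trans 2≤h (ℕₚ.m≤n*m h 2))
              low-degree : h * h * h + τ * (2 * h + 2 * h) ≤ p
              low-degree = begin
                h * h * h + τ * (2 * h + 2 * h)       ≤⟨ ℕₚ.+-monoˡ-≤ _ (ℕₚ.*-monoˡ-≤ h h²≤τ) ⟩
                τ * h + τ * (2 * h + 2 * h)           ≡⟨ e₀' τ h ⟩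
                5 * (h * τ)                           ≤⟨ 5hτ≤p ⟩
                p                                     ∎
                where
                e₀' : ∀ t h → t * h + t * (2 * h + 2 * h) ≡ 5 * (h * t)
                e₀' = ℕ-ring
              D≤p : h * h ≤ p
              D≤p = ℕₚ.≤-trans (ℕₚ.≤-trans (ℕₚ.m≤m*n (h * h) h) (ℕₚ.m≤m+n _ _)) low-degree
              few : h * h * (h * h * h + 3 * (h * h)) < h * h * h * (2 * h * (2 * h))
              few = begin-strict
                h * h * (h * h * h + 3 * (h * h))     ≡⟨ e₂ h ⟩
                h * h * h * h * (h + 3)               <⟨ ℕₚ.*-monoʳ-< (h * h * h * h) {{ℕₚ.m*n≢0 (h * h * h) h {{ℕₚ.m*n≢0 (h * h) h}}}} h+3<4h ⟩
                h * h * h * h * (4 * h)               ≡⟨ e₃ h ⟩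
                h * h * h * (2 * h * (2 * h))         ∎
                where
                e₂ : ∀ h → h * h * (h * h * h + 3 * (h * h)) ≡ h * h * h * h * (h + 3)
                e₂ = ℕ-ring
                e₃ : ∀ h → h * h * h * h * (4 * h) ≡ h * h * h * (2 * h * (2 * h))
                e₃ = ℕ-ring
                h+3<4h : h + 3 < 4 * h
                h+3<4h = begin-strict
                  h + 3              <⟨ ℕₚ.+-monoʳ-< h {3} {6} (s≤s (s≤s (s≤s (s≤s z≤n)))) ⟩
                  h + 3 * 2          ≤⟨ ℕₚ.+-monoʳ-≤ h (ℕₚ.*-monoʳ-≤ 3 2≤h) ⟩
                  4 * h              ∎
              points : ∀ {x} → x ∈ curve-points → x ≢ 0ᵏ × _ × _ × x ^ᵏ τ ≡ 1ᵏ × _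
              points {x} x∈ = norm-1⇒nonzero x∈G ,
                (λ z → c≢w x∈G (trans (sym (eval-U τ 0<τ c (bar c) c≢0 ec≢1 x)) z)) ,
                (λ z → bar-c*w≢1 x∈G (trans (sym (eval-V τ 0<τ c (bar c) c≢0 ec≢1 x)) z)) ,
                G-power x∈G ,
                trans (cong (_^ᵏ τ) (eval-U τ 0<τ c (bar c) c≢0 ec≢1 x))
                  (trans (proj₂ (∈-filter⁻ curve? {xs = G} x∈)) (cong (_^ᵏ τ) (sym (eval-V τ 0<τ c (bar c) c≢0 ec≢1 x))))
                where x∈G = proj₁ (∈-filter⁻ curve? {xs = G} x∈)

        rep₃ : Carrier → ℕ
        rep₃ c = ∑ triples (λ i → ⟪ c ≟ sum₃ i ⟫)

        rep₃≤∑rep : ∀ c → rep₃ c ≤ ∑ G (λ w → rep (c +ᵏ -ᵏ w))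
        rep₃≤∑rep c = begin
          rep₃ c
            ≡⟨ trans (∑-product G pairs _) (∑-cong G (λ w → ∑-product G G _)) ⟩
          ∑ G (λ w → ∑ G (λ u → ∑ G (λ v → ⟪ c ≟ w +ᵏ (u +ᵏ v) ⟫)))
            ≤⟨ ∑-mono G (λ {w} _ → ∑-mono G (λ {u} _ → ∑-mono G (λ {v} _ → ⟪⟫-mono (_ ≟ _) (_ ≟ _) (move w u v)))) ⟩
          ∑ G (λ w → rep (c +ᵏ -ᵏ w)) ∎
          where
          open ℕₚ.≤-Reasoning
          move : ∀ w u v → c ≡ w +ᵏ (u +ᵏ v) → c +ᵏ -ᵏ w ≡ u +ᵏ v
          move w u v e = trans (cong (_+ᵏ -ᵏ w) e) (solve 2 (λ w x → w :+ x :+ :- w := x) refl w (u +ᵏ v))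

        -- The bound that remains for exceptional c: two representations for each w, and up to τ
        -- more when w = c leaves the sum 0.
        rep₃≤3τ : ∀ c → rep₃ c ≤ 3 * τ
        rep₃≤3τ c = begin
          rep₃ c                                                 ≤⟨ rep₃≤∑rep c ⟩
          ∑ G (λ w → rep (c +ᵏ -ᵏ w))                            ≤⟨ ∑-mono G (λ {w} _ → rep≤ (c +ᵏ -ᵏ w)) ⟩
          ∑ G (λ w → 2 + τ * ⟪ c +ᵏ -ᵏ w ≟ 0ᵏ ⟫)                 ≡⟨ ∑-distrib-+ G _ _ ⟩
          ∑ G (λ w → 2) + ∑ G (λ w → τ * ⟪ c +ᵏ -ᵏ w ≟ 0ᵏ ⟫)     ≡⟨ cong₂ _+_ (∑-const 2 G) (sym (*-distribˡ-∑ τ G _)) ⟩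
          τ * 2 + τ * ∑ G (λ w → ⟪ c +ᵏ -ᵏ w ≟ 0ᵏ ⟫)
            ≤⟨ ℕₚ.+-monoʳ-≤ (τ * 2) (ℕₚ.*-monoʳ-≤ τ (∑-atMostOne (λ w → c +ᵏ -ᵏ w ≟ 0ᵏ) G-unique
                 (λ e e' → trans (sym (x-y≡0⇒x≡y e)) (x-y≡0⇒x≡y e')))) ⟩
          τ * 2 + τ * 1                                          ≡⟨ eq τ ⟩
          3 * τ                                                  ∎
          where
          open ℕₚ.≤-Reasoning
          eq : ∀ t → t * 2 + t * 1 ≡ 3 * t
          eq = ℕ-ring

        -- The values excluded in Stepanov's method, which divides by c and needs V to be nonzero at
        -- c.
        exceptional : Carrier → ℕ
        exceptional c = ⟪ c ≟ 0ᵏ ⟫ + ⟪ c *ᵏ bar c ≟ 1ᵏ ⟫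

        h*rep₃≤ : ∀ c → h * rep₃ c ≤ 10 * τ + h * (3 * τ) * exceptional c
        h*rep₃≤ c with c ≟ 0ᵏ | c *ᵏ bar c ≟ 1ᵏ
        ... | yes _ | e = ℕₚ.≤-trans (ℕₚ.*-monoʳ-≤ h (rep₃≤3τ c)) (ℕₚ.≤-trans (ℕₚ.m≤m*n _ (suc ⟪ e ⟫)) (ℕₚ.m≤n+m _ (10 * τ)))
        ... | no _ | yes _ = ℕₚ.≤-trans (ℕₚ.*-monoʳ-≤ h (rep₃≤3τ c)) (ℕₚ.≤-trans (ℕₚ.m≤m*n _ 1) (ℕₚ.m≤n+m _ (10 * τ)))
        ... | no c≢0 | no norm≢1 = ℕₚ.≤-trans (begin
            h * rep₃ c                                ≤⟨ ℕₚ.*-monoʳ-≤ h (rep₃≤∑rep c) ⟩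
            h * ∑ G (λ w → rep (c +ᵏ -ᵏ w))           ≤⟨ ℕₚ.*-monoʳ-≤ h (∑-mono G (λ w∈ → rep≤2*curve c norm≢1 w∈)) ⟩
            h * ∑ G (λ w → 2 * ⟪ curve? c w ⟫)        ≡⟨ cong (h *_) (trans (sym (*-distribˡ-∑ 2 G _)) (cong (2 *_) (∑-filter (curve? c) G))) ⟩
            h * (2 * length (curve-points c))         ≡⟨ e₁ h (length (curve-points c)) ⟩
            2 * (length (curve-points c) * h)         ≤⟨ ℕₚ.*-monoʳ-≤ 2 (few-curve-points c norm≢1 c≢0) ⟩
            2 * (5 * τ)                               ≡⟨ sym (ℕₚ.*-assoc 2 5 τ) ⟩
            10 * τ                                    ∎) (ℕₚ.m≤m+n _ _)
          where
          open ℕₚ.≤-Reasoning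
          e₁ : ∀ h l → h * (2 * l) ≡ 2 * (l * h)
          e₁ = ℕ-ring

        -- With elementary symmetric functions s₁ = c, s₂, s₃ of w, u, v the product of the pairwise
        -- sums is s₁ s₂ - s₃. Inversion by conjugation gives s₂ = c̄ s₃, so the product equals (c
        -- c̄ - 1) s₃.
        norm-1-sum : ∀ {w u v} → w ∈ G → u ∈ G → v ∈ G → let c = w +ᵏ (u +ᵏ v) in c *ᵏ bar c ≡ 1ᵏ →
          (w +ᵏ u) *ᵏ ((u +ᵏ v) *ᵏ (v +ᵏ w)) ≡ 0ᵏ
        norm-1-sum {w} {u} {v} w∈ u∈ v∈ e = begin
          (w +ᵏ u) *ᵏ ((u +ᵏ v) *ᵏ (v +ᵏ w))
            ≡⟨ solve 3 (λ w u v → (w :+ u) :* ((u :+ v) :* (v :+ w)) :=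
                 (w :+ (u :+ v)) :* (u :* v :+ w :* v :+ w :* u) :+ :- (w :* u :* v)) refl w u v ⟩
          c *ᵏ (u *ᵏ v +ᵏ w *ᵏ v +ᵏ w *ᵏ u) +ᵏ -ᵏ (w *ᵏ u *ᵏ v)
            ≡⟨ cong (λ z → c *ᵏ z +ᵏ -ᵏ (w *ᵏ u *ᵏ v)) elementary ⟩
          c *ᵏ (bar c *ᵏ (w *ᵏ u *ᵏ v)) +ᵏ -ᵏ (w *ᵏ u *ᵏ v)
            ≡⟨ solve 3 (λ c c̄ z → c :* (c̄ :* z) :+ :- z := (c :* c̄) :* z :+ :- z) refl c (bar c) (w *ᵏ u *ᵏ v) ⟩
          c *ᵏ bar c *ᵏ (w *ᵏ u *ᵏ v) +ᵏ -ᵏ (w *ᵏ u *ᵏ v)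
            ≡⟨ x≡y⇒x-y≡0 (trans (cong (_*ᵏ (w *ᵏ u *ᵏ v)) e) (*-identityˡ _)) ⟩
          0ᵏ ∎
          where
          open ≡-Reasoning
          c = w +ᵏ (u +ᵏ v)
          elementary : u *ᵏ v +ᵏ w *ᵏ v +ᵏ w *ᵏ u ≡ bar c *ᵏ (w *ᵏ u *ᵏ v)
          elementary = sym (begin
            bar c *ᵏ (w *ᵏ u *ᵏ v)
              ≡⟨ cong (_*ᵏ (w *ᵏ u *ᵏ v)) (trans (bar-+ w (u +ᵏ v)) (cong (bar w +ᵏ_) (bar-+ u v))) ⟩
            (bar w +ᵏ (bar u +ᵏ bar v)) *ᵏ (w *ᵏ u *ᵏ v)
              ≡⟨ solve 6 (λ w̄ ū v̄ w u v → (w̄ :+ (ū :+ v̄)) :* (w :* u :* v) :=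
                   (w :* w̄) :* (u :* v) :+ (u :* ū) :* (w :* v) :+ (v :* v̄) :* (w :* u)) refl (bar w) (bar u) (bar v) w u v ⟩
            (w *ᵏ bar w) *ᵏ (u *ᵏ v) +ᵏ (u *ᵏ bar u) *ᵏ (w *ᵏ v) +ᵏ (v *ᵏ bar v) *ᵏ (w *ᵏ u)
              ≡⟨ cong₂ _+ᵏ_ (cong₂ _+ᵏ_ (unit (norm-1 w∈)) (unit (norm-1 u∈))) (unit (norm-1 v∈)) ⟩
            u *ᵏ v +ᵏ w *ᵏ v +ᵏ w *ᵏ u ∎)
            where
            unit : ∀ {a b} → a ≡ 1ᵏ → a *ᵏ b ≡ b
            unit {b = b} a≡1 = trans (cong (_*ᵏ b) a≡1) (*-identityˡ b)

        -- An exceptional sum is 0 or has two opposite summands: four equations, each satisfied by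
        -- at most τ² triples.
        few-exceptional : ∑ triples (λ i → exceptional (sum₃ i)) ≤ 4 * (τ * τ)
        few-exceptional = begin
          ∑ triples (λ i → exceptional (sum₃ i))
            ≡⟨ trans (∑-product G pairs _) (∑-cong G (λ w → ∑-product G G _)) ⟩
          ∑ G (λ w → ∑ G (λ u → ∑ G (λ v → exceptional (w +ᵏ (u +ᵏ v)))))
            ≤⟨ ∑-mono G (λ w∈ → ∑-mono G (λ u∈ → ∑-mono G (λ v∈ → bound w∈ u∈ v∈))) ⟩
          ∑ G (λ w → ∑ G (λ u → ∑ G (λ v → ⟪ w +ᵏ (u +ᵏ v) ≟ 0ᵏ ⟫ + ⟪ u +ᵏ v ≟ 0ᵏ ⟫ + ⟪ v +ᵏ w ≟ 0ᵏ ⟫ + ⟪ w +ᵏ u ≟ 0ᵏ ⟫)))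
            ≤⟨ ∑-bound (4 * τ) G (λ {w} _ → inner w) ⟩
          τ * (4 * τ)
            ≡⟨ eq τ ⟩
          4 * (τ * τ) ∎
          where
          open ℕₚ.≤-Reasoning
          eq : ∀ t → t * (4 * t) ≡ 4 * (t * t)
          eq = ℕ-ring
          bound : ∀ {w u v} → w ∈ G → u ∈ G → v ∈ G → exceptional (w +ᵏ (u +ᵏ v)) ≤
            ⟪ w +ᵏ (u +ᵏ v) ≟ 0ᵏ ⟫ + ⟪ u +ᵏ v ≟ 0ᵏ ⟫ + ⟪ v +ᵏ w ≟ 0ᵏ ⟫ + ⟪ w +ᵏ u ≟ 0ᵏ ⟫
          bound {w} {u} {v} w∈ u∈ v∈ = subst (exceptional (w +ᵏ (u +ᵏ v)) ≤_)
            (reassociate ⟪ w +ᵏ (u +ᵏ v) ≟ 0ᵏ ⟫ ⟪ u +ᵏ v ≟ 0ᵏ ⟫ ⟪ v +ᵏ w ≟ 0ᵏ ⟫ ⟪ w +ᵏ u ≟ 0ᵏ ⟫)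
            (ℕₚ.+-monoʳ-≤ ⟪ w +ᵏ (u +ᵏ v) ≟ 0ᵏ ⟫ cases)
            where
            reassociate : ∀ a b c d → a + (b + c + d) ≡ a + b + c + d
            reassociate = ℕ-ring
            cases : ⟪ (w +ᵏ (u +ᵏ v)) *ᵏ bar (w +ᵏ (u +ᵏ v)) ≟ 1ᵏ ⟫ ≤ ⟪ u +ᵏ v ≟ 0ᵏ ⟫ + ⟪ v +ᵏ w ≟ 0ᵏ ⟫ + ⟪ w +ᵏ u ≟ 0ᵏ ⟫
            cases with u +ᵏ v ≟ 0ᵏ | v +ᵏ w ≟ 0ᵏ | w +ᵏ u ≟ 0ᵏ
            ... | yes _ | b | c = ℕₚ.≤-trans (⟪⟫≤1 (_ ≟ 1ᵏ)) (s≤s z≤n)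
            ... | no _ | yes _ | c = ℕₚ.≤-trans (⟪⟫≤1 (_ ≟ 1ᵏ)) (s≤s z≤n)
            ... | no _ | no _ | yes _ = ⟪⟫≤1 (_ ≟ 1ᵏ)
            ... | no a | no b | no c = ℕₚ.≤-reflexive (⟪⟫-no (_ ≟ 1ᵏ) (λ e →
                *-nonzero c (*-nonzero a b) (norm-1-sum w∈ u∈ v∈ e)))
          one-sum : ∀ w u → ∑ G (λ v → ⟪ w +ᵏ (u +ᵏ v) ≟ 0ᵏ ⟫) ≤ 1
          one-sum w u = ∑-atMostOne (λ v → w +ᵏ (u +ᵏ v) ≟ 0ᵏ) G-unique
            (λ e e' → +-cancelˡ (+-cancelˡ (trans e (sym e'))))
          inner : ∀ w → ∑ G (λ u → ∑ G (λ v → ⟪ w +ᵏ (u +ᵏ v) ≟ 0ᵏ ⟫ + ⟪ u +ᵏ v ≟ 0ᵏ ⟫ + ⟪ v +ᵏ w ≟ 0ᵏ ⟫ + ⟪ w +ᵏ u ≟ 0ᵏ ⟫)) ≤ 4 * τ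
          inner w = begin
            ∑ G (λ u → ∑ G (λ v → ⟪ w +ᵏ (u +ᵏ v) ≟ 0ᵏ ⟫ + ⟪ u +ᵏ v ≟ 0ᵏ ⟫ + ⟪ v +ᵏ w ≟ 0ᵏ ⟫ + ⟪ w +ᵏ u ≟ 0ᵏ ⟫))
              ≡⟨ ∑-cong G (λ u → trans (∑-distrib-+ G _ _) (cong₂ _+_ (trans (∑-distrib-+ G _ _) (cong (_+ _) (∑-distrib-+ G _ _))) (∑-const _ G))) ⟩
            ∑ G (λ u → ∑ G (λ v → ⟪ w +ᵏ (u +ᵏ v) ≟ 0ᵏ ⟫) + ∑ G (λ v → ⟪ u +ᵏ v ≟ 0ᵏ ⟫) + ∑ G (λ v → ⟪ v +ᵏ w ≟ 0ᵏ ⟫) + τ * ⟪ w +ᵏ u ≟ 0ᵏ ⟫)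
              ≤⟨ ∑-mono G (λ {u} _ → ℕₚ.+-monoˡ-≤ _ (ℕₚ.+-mono-≤ (ℕₚ.+-mono-≤ (one-sum w u) (one-negative u)) (one-negative′ w))) ⟩
            ∑ G (λ u → 3 + τ * ⟪ w +ᵏ u ≟ 0ᵏ ⟫)
              ≡⟨ trans (∑-distrib-+ G _ _) (cong₂ _+_ (∑-const 3 G) (sym (*-distribˡ-∑ τ G _))) ⟩
            τ * 3 + τ * ∑ G (λ u → ⟪ w +ᵏ u ≟ 0ᵏ ⟫)
              ≤⟨ ℕₚ.+-monoʳ-≤ (τ * 3) (ℕₚ.*-monoʳ-≤ τ (one-negative w)) ⟩
            τ * 3 + τ * 1
              ≡⟨ eq' τ ⟩
            4 * τ ∎
            where
            eq' : ∀ t → t * 3 + t * 1 ≡ 4 * t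
            eq' = ℕ-ring

        -- The τ³ triples contribute 10 τ / h each, and the at most 4 τ² exceptional ones 3 τ more.
        -- After multiplication by h ≤ τ this is (10 + 12) τ⁴.
        energy₃ : h * collisions triples sum₃ ≤ 22 * (τ * τ * (τ * τ))
        energy₃ = begin
          h * collisions triples sum₃
            ≡⟨ *-distribˡ-∑ h triples _ ⟩
          ∑ triples (λ i → h * rep₃ (sum₃ i))
            ≤⟨ ∑-mono triples (λ {i} _ → h*rep₃≤ (sum₃ i)) ⟩
          ∑ triples (λ i → 10 * τ + h * (3 * τ) * exceptional (sum₃ i))
            ≡⟨ trans (∑-distrib-+ triples _ _) (cong₂ _+_ (trans (∑-const _ triples) (cong (_* (10 * τ)) length-triples))
                 (sym (*-distribˡ-∑ (h * (3 * τ)) triples _))) ⟩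
          τ * (τ * τ) * (10 * τ) + h * (3 * τ) * ∑ triples (λ i → exceptional (sum₃ i))
            ≤⟨ ℕₚ.+-monoʳ-≤ (τ * (τ * τ) * (10 * τ)) (ℕₚ.*-mono-≤ (ℕₚ.*-monoˡ-≤ (3 * τ) h≤τ) few-exceptional) ⟩
          τ * (τ * τ) * (10 * τ) + τ * (3 * τ) * (4 * (τ * τ))
            ≡⟨ eq τ ⟩
          22 * (τ * τ * (τ * τ)) ∎
          where
          open ℕₚ.≤-Reasoning
          eq : ∀ t → t * (t * t) * (10 * t) + t * (3 * t) * (4 * (t * t)) ≡ 22 * (t * t * (t * t))
          eq = ℕ-ring
          h≤τ : h ≤ τ
          h≤τ = ℕₚ.≤-trans (ℕₚ.m≤m*n h (h * (h * h)) {{ℕₚ.m*n≢0 h (h * h) {{h≢0}} {{ℕₚ.m*n≢0 h h {{h≢0}} {{h≢0}}}}}})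
            (ℕₚ.≤-trans (ℕₚ.≤-reflexive (sym (ℕₚ.*-assoc h h (h * h)))) (ℕₚ.≤-trans (ℕₚ.m≤n*m _ 2) 2h⁴≤τ))
            where
            h≢0 : NonZero h
            h≢0 = >-nonZero (ℕₚ.<-≤-trans (s≤s z≤n) 2≤h)

      3G-large : h * (τ * τ) ≤ 22 * length 3G
      3G-large = ℕₚ.*-cancelʳ-≤ _ _ (τ * τ * (τ * τ)) {{ℕₚ.m*n≢0 (τ * τ) (τ * τ) {{ℕₚ.m*n≢0 τ τ}} {{ℕₚ.m*n≢0 τ τ}}}} (begin
        h * (τ * τ) * (τ * τ * (τ * τ))          ≡⟨ e₁ h τ ⟩
        h * (τ * (τ * τ) * (τ * (τ * τ)))        ≡⟨ cong (h *_) (sym (cong₂ _*_ length-triples length-triples)) ⟩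
        h * (length triples * length triples)    ≤⟨ ℕₚ.*-monoʳ-≤ h (length²≤image*collisions triples sum₃ (Uniqueₚ.deduplicate-! (map sum₃ triples))
                                                      (λ i∈ → ∈-deduplicate⁺ _≟_ (∈-map⁺ sum₃ i∈))) ⟩
        h * (length 3G * collisions triples sum₃)  ≡⟨ e₂ h (length 3G) _ ⟩
        length 3G * (h * collisions triples sum₃)  ≤⟨ ℕₚ.*-monoʳ-≤ (length 3G) energy₃ ⟩
        length 3G * (22 * (τ * τ * (τ * τ)))     ≡⟨ e₃ (length 3G) (τ * τ * (τ * τ)) ⟩
        22 * length 3G * (τ * τ * (τ * τ))       ∎)
        where
        open ℕₚ.≤-Reasoning
        e₁ : ∀ h t → h * (t * t) * (t * t * (t * t)) ≡ h * (t * (t * t) * (t * (t * t)))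
        e₁ = ℕ-ring
        e₂ : ∀ h l e → h * (l * e) ≡ l * (h * e)
        e₂ = ℕ-ring
        e₃ : ∀ l t → l * (22 * t) ≡ 22 * l * t
        e₃ = ℕ-ring

-- The prime field, built on the given arithmetic of `Fin p`.

module PrimeField (p : ℕ) .{{_ : NonZero p}} (p-prime : Prime p) where
  open import Data.Nat.DivMod using (_%_; _mod_; m%n<n; m<n⇒m%n≡m; %-distribˡ-+; %-distribˡ-*; [m+kn]%n≡m%n)
  open import Data.Nat.Primality using (prime⇒nonTrivial)
  open import Data.Nat.Coprimality using (prime⇒coprime; coprime-Bézout)
  open import Data.Nat.GCD using (module Bézout)
  open import Data.Fin.Base using (toℕ)
  open import Data.Fin.Properties as Finₚ using (toℕ-injective; toℕ-fromℕ<; toℕ<n)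
  open import Data.List.Base using (allFin)
  open import Data.List.Membership.Propositional.Properties using (∈-allFin)
  import Data.List.Relation.Unary.Unique.Propositional.Properties as Uniqueₚ
  open import Data.Nat.Tactic.RingSolver using () renaming (solve-∀ to ℕ-ring)

  toℕ-mod : ∀ n → toℕ (n mod p) ≡ n % p
  toℕ-mod n = toℕ-fromℕ< (m%n<n n p)

  mod-cong : ∀ {m n} → m % p ≡ n % p → m mod p ≡ n mod p
  mod-cong {m} {n} e = toℕ-injective (trans (toℕ-mod m) (trans e (sym (toℕ-mod n))))

  mod-toℕ : ∀ x → x ≡ toℕ x mod p
  mod-toℕ x = toℕ-injective (sym (trans (toℕ-mod (toℕ x)) (m<n⇒m%n≡m (toℕ<n x))))

  -- Negation as multiplication by p - 1, the way `det` subtracts, so that determinant one holds in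
  -- the field by definition.
  negF : F p → F p
  negF x = (toℕ x * (p ∸ 1)) mod p

  mod-+ : ∀ m n → addF p (m mod p) (n mod p) ≡ (m + n) mod p
  mod-+ m n = mod-cong (trans (cong₂ (λ a b → (a + b) % p) (toℕ-mod m) (toℕ-mod n)) (sym (%-distribˡ-+ m n p)))

  mod-* : ∀ m n → mulF p (m mod p) (n mod p) ≡ (m * n) mod p
  mod-* m n = mod-cong (trans (cong₂ (λ a b → (a * b) % p) (toℕ-mod m) (toℕ-mod n)) (sym (%-distribˡ-* m n p)))

  private
    -- Every element is the residue of a natural number, which reduces the ring laws to those of the
    -- naturals.
    residue : ∀ {P : F p → Set} → (∀ n → P (n mod p)) → ∀ x → P x
    residue {P} h x = subst P (sym (mod-toℕ x)) (h (toℕ x))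

    multiple : ∀ k → (k * p) mod p ≡ 0 mod p
    multiple k = mod-cong ([m+kn]%n≡m%n 0 k p)

    addF-assoc : ∀ x y z → addF p (addF p x y) z ≡ addF p x (addF p y z)
    addF-assoc = residue λ a → residue λ b → residue λ c → begin
      addF p (addF p (a mod p) (b mod p)) (c mod p)   ≡⟨ trans (cong (λ w → addF p w (c mod p)) (mod-+ a b)) (mod-+ (a + b) c) ⟩
      (a + b + c) mod p                               ≡⟨ cong (_mod p) (ℕₚ.+-assoc a b c) ⟩
      (a + (b + c)) mod p                             ≡⟨ sym (trans (cong (addF p (a mod p)) (mod-+ b c)) (mod-+ a (b + c))) ⟩
      addF p (a mod p) (addF p (b mod p) (c mod p))   ∎
      where open ≡-Reasoning

    mulF-assoc : ∀ x y z → mulF p (mulF p x y) z ≡ mulF p x (mulF p y z)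
    mulF-assoc = residue λ a → residue λ b → residue λ c → begin
      mulF p (mulF p (a mod p) (b mod p)) (c mod p)   ≡⟨ trans (cong (λ w → mulF p w (c mod p)) (mod-* a b)) (mod-* (a * b) c) ⟩
      (a * b * c) mod p                               ≡⟨ cong (_mod p) (ℕₚ.*-assoc a b c) ⟩
      (a * (b * c)) mod p                             ≡⟨ sym (trans (cong (mulF p (a mod p)) (mod-* b c)) (mod-* a (b * c))) ⟩
      mulF p (a mod p) (mulF p (b mod p) (c mod p))   ∎
      where open ≡-Reasoning

    addF-comm : ∀ x y → addF p x y ≡ addF p y x
    addF-comm x y = cong (_mod p) (ℕₚ.+-comm (toℕ x) (toℕ y))

    mulF-comm : ∀ x y → mulF p x y ≡ mulF p y x
    mulF-comm x y = cong (_mod p) (ℕₚ.*-comm (toℕ x) (toℕ y))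

    addF-identityˡ : ∀ x → addF p (0F p) x ≡ x
    addF-identityˡ = residue λ a → mod-+ 0 a

    mulF-identityˡ : ∀ x → mulF p (1F p) x ≡ x
    mulF-identityˡ = residue λ a → trans (mod-* 1 a) (cong (_mod p) (ℕₚ.*-identityˡ a))

    distribˡ : ∀ x y z → mulF p x (addF p y z) ≡ addF p (mulF p x y) (mulF p x z)
    distribˡ = residue λ a → residue λ b → residue λ c → begin
      mulF p (a mod p) (addF p (b mod p) (c mod p))   ≡⟨ trans (cong (mulF p (a mod p)) (mod-+ b c)) (mod-* a (b + c)) ⟩
      (a * (b + c)) mod p                             ≡⟨ cong (_mod p) (ℕₚ.*-distribˡ-+ a b c) ⟩
      (a * b + a * c) mod p                           ≡⟨ sym (trans (cong₂ (addF p) (mod-* a b) (mod-* a c)) (mod-+ (a * b) (a * c))) ⟩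
      addF p (mulF p (a mod p) (b mod p)) (mulF p (a mod p) (c mod p)) ∎
      where open ≡-Reasoning

    inverseʳ : ∀ x → addF p x (negF x) ≡ 0F p
    inverseʳ x = begin
      addF p x (negF x)                          ≡⟨ cong (λ w → addF p w (negF x)) (mod-toℕ x) ⟩
      addF p (toℕ x mod p) (negF x)              ≡⟨ mod-+ (toℕ x) (toℕ x * (p ∸ 1)) ⟩
      (toℕ x + toℕ x * (p ∸ 1)) mod p            ≡⟨ cong (_mod p) (sym (ℕₚ.*-suc (toℕ x) (p ∸ 1))) ⟩
      (toℕ x * suc (p ∸ 1)) mod p                ≡⟨ cong (λ k → (toℕ x * k) mod p) (ℕₚ.suc-pred p) ⟩
      (toℕ x * p) mod p                          ≡⟨ multiple (toℕ x) ⟩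
      0F p                                       ∎
      where open ≡-Reasoning

    ring : IsCommutativeRing _≡_ (addF p) (mulF p) negF (0F p) (1F p)
    ring = record
      { isRing = record
        { +-isAbelianGroup = record
          { isGroup = record
            { isMonoid = record
              { isSemigroup = record
                { isMagma = record { isEquivalence = isEquivalence ; ∙-cong = cong₂ (addF p) }
                ; assoc = addF-assoc }
              ; identity = addF-identityˡ , (λ x → trans (addF-comm x (0F p)) (addF-identityˡ x)) }
            ; inverse = (λ x → trans (addF-comm (negF x) x) (inverseʳ x)) , inverseʳ
            ; ⁻¹-cong = cong negF }
          ; comm = addF-comm }
        ; *-cong = cong₂ (mulF p)
        ; *-assoc = mulF-assoc
        ; *-identity = mulF-identityˡ , (λ x → trans (mulF-comm x (1F p)) (mulF-identityˡ x))
        ; distrib = distribˡ , (λ x y z → trans (mulF-comm (addF p y z) x) (trans (distribˡ x y z) (cong₂ (addF p) (mulF-comm x y) (mulF-comm x z)))) }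
      ; *-comm = mulF-comm }
      where open import Relation.Binary.PropositionalEquality using (isEquivalence)

    1<p : 1 < p
    1<p = nonTrivial⇒n>1 p {{prime⇒nonTrivial p-prime}}

  mod≡0⇒ : ∀ n → n < p → n mod p ≡ 0F p → n ≡ 0
  mod≡0⇒ n n<p e = begin
    n                ≡⟨ sym (m<n⇒m%n≡m n<p) ⟩
    n % p            ≡⟨ sym (toℕ-mod n) ⟩
    toℕ (n mod p)    ≡⟨ cong toℕ e ⟩
    toℕ (0F p)       ≡⟨ toℕ-mod 0 ⟩
    0 % p            ≡⟨ m<n⇒m%n≡m (ℕₚ.<-trans (s≤s z≤n) 1<p) ⟩
    0                ∎
    where open ≡-Reasoning

  private
    commutativeRingF : CommutativeRing 0ℓ 0ℓ
    commutativeRingF = record { isCommutativeRing = ring }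

    module Ring = RingSolver commutativeRingF

    inverseF : ∀ x → x ≢ 0F p → ∃ λ y → mulF p x y ≡ 1F p
    inverseF x x≢0 = bézout (coprime-Bézout (prime⇒coprime p-prime {{≢-nonZero a≢0}} (toℕ<n x)))
      where
      open ≡-Reasoning
      a = toℕ x
      a≢0 : a ≢ 0
      a≢0 e = x≢0 (trans (mod-toℕ x) (cong (_mod p) e))
      x*mod : ∀ y → mulF p x (y mod p) ≡ (y * a) mod p
      x*mod y = trans (cong (λ w → mulF p w (y mod p)) (mod-toℕ x)) (trans (mod-* a y) (cong (_mod p) (ℕₚ.*-comm a y)))
      bézout : Bézout.Identity 1 p a → ∃ λ y → mulF p x y ≡ 1F p
      bézout (Bézout.-+ k y e) = y mod p , trans (x*mod y) (trans (cong (_mod p) (sym e)) (mod-cong ([m+kn]%n≡m%n 1 k p)))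
      -- In this form of Bézout's identity 1 + y a is a multiple of p, so the inverse of a is -y.
      bézout (Bézout.+- k y e) = negF (y mod p) , (begin
        mulF p x (negF (y mod p))
          ≡⟨ Ring.solve 2 (λ x y → x :* :- y := con (pos 1) :+ :- (con (pos 1) :+ x :* y)) refl x (y mod p) ⟩
        addF p (1F p) (negF (addF p (1F p) (mulF p x (y mod p))))
          ≡⟨ cong (λ w → addF p (1F p) (negF w)) (trans (cong (addF p (1F p)) (x*mod y)) (trans (mod-+ 1 (y * a)) (trans (cong (_mod p) e) (multiple k)))) ⟩
        addF p (1F p) (negF (0F p))
          ≡⟨ Ring.solve 0 (con (pos 1) :+ :- con (pos 0) := con (pos 1)) refl ⟩
        1F p ∎)
        where open Ring using (_:=_)
      open Ring using (_:=_)

  primeField : FiniteField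
  primeField = record
    { Carrier = F p
    ; _+ᵏ_ = addF p ; _*ᵏ_ = mulF p ; -ᵏ_ = negF ; 0ᵏ = 0F p ; 1ᵏ = 1F p
    ; isCommutativeRing = ring
    ; _≟_ = Finₚ._≟_
    ; 1≢0 = λ e → ℕₚ.1+n≢0 (mod≡0⇒ 1 1<p e)
    ; inverse = inverseF
    ; elements = allFin p
    ; complete = ∈-allFin
    ; elements-unique = Uniqueₚ.allFin⁺ p }

  open Polynomial primeField using (fromℕ)

  fromℕ≡mod : ∀ n → fromℕ n ≡ n mod p
  fromℕ≡mod zero = refl
  fromℕ≡mod (suc n) = trans (cong (addF p (1F p)) (fromℕ≡mod n)) (mod-+ 1 n)

  primeField-characteristic : ∀ n → 0 < n → n < p → fromℕ n ≢ 0F p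
  primeField-characteristic n 0<n n<p e = ℕₚ.<⇒≢ 0<n (sym (mod≡0⇒ n n<p (trans (sym (fromℕ≡mod n)) e)))

-- 𝔽[t] / (t² - T t + 1), with (x , y) standing for x + y t.
module QuadraticExtension (𝔽 : FiniteField) (T : FiniteField.Carrier 𝔽)
  (irreducible : ∀ r s → FiniteField._+ᵏ_ 𝔽 r s ≡ T → FiniteField._*ᵏ_ 𝔽 r s ≢ FiniteField.1ᵏ 𝔽) where
  open FiniteField 𝔽
  import Data.List.Relation.Unary.Unique.Propositional.Properties as Uniqueₚ
  open import Data.List.Membership.Propositional.Properties using (∈-cartesianProduct⁺)
  open import Data.Product.Properties using (≡-dec)

  K : Set
  K = Carrier × Carrier

  add mul : K → K → K
  add (a , b) (c , d) = a +ᵏ c , b +ᵏ d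
  mul (a , b) (c , d) = a *ᵏ c +ᵏ -ᵏ (b *ᵏ d) , a *ᵏ d +ᵏ b *ᵏ c +ᵏ T *ᵏ (b *ᵏ d)

  -- `bar` is the nontrivial automorphism: it sends t to T - t, the other root, which is the inverse
  -- of t.
  neg bar : K → K
  neg (a , b) = -ᵏ a , -ᵏ b
  bar (a , b) = a +ᵏ T *ᵏ b , -ᵏ b

  0K 1K t : K
  0K = 0ᵏ , 0ᵏ
  1K = 1ᵏ , 0ᵏ
  t = 0ᵏ , 1ᵏ

  private
    mul-comm : ∀ x y → mul x y ≡ mul y x
    mul-comm (a , b) (c , d) = cong₂ _,_
      (solve 4 (λ a b c d → a :* c :+ :- (b :* d) := c :* a :+ :- (d :* b)) refl a b c d)
      (solve 5 (λ T a b c d → a :* d :+ b :* c :+ T :* (b :* d) := c :* b :+ d :* a :+ T :* (d :* b)) refl T a b c d)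

    mul-assoc : ∀ x y z → mul (mul x y) z ≡ mul x (mul y z)
    mul-assoc (a , b) (c , d) (e , f) = cong₂ _,_
      (solve 7 (λ T a b c d e f →
        (a :* c :+ :- (b :* d)) :* e :+ :- ((a :* d :+ b :* c :+ T :* (b :* d)) :* f) :=
        a :* (c :* e :+ :- (d :* f)) :+ :- (b :* (c :* f :+ d :* e :+ T :* (d :* f)))) refl T a b c d e f)
      (solve 7 (λ T a b c d e f →
        (a :* c :+ :- (b :* d)) :* f :+ (a :* d :+ b :* c :+ T :* (b :* d)) :* e :+ T :* ((a :* d :+ b :* c :+ T :* (b :* d)) :* f) :=
        a :* (c :* f :+ d :* e :+ T :* (d :* f)) :+ b :* (c :* e :+ :- (d :* f)) :+ T :* (b :* (c :* f :+ d :* e :+ T :* (d :* f))))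
        refl T a b c d e f)

    mul-identityˡ : ∀ x → mul 1K x ≡ x
    mul-identityˡ (a , b) = cong₂ _,_
      (solve 2 (λ a b → con (pos 1) :* a :+ :- (con (pos 0) :* b) := a) refl a b)
      (solve 3 (λ T a b → con (pos 1) :* b :+ con (pos 0) :* a :+ T :* (con (pos 0) :* b) := b) refl T a b)

    mul-distribˡ : ∀ x y z → mul x (add y z) ≡ add (mul x y) (mul x z)
    mul-distribˡ (a , b) (c , d) (e , f) = cong₂ _,_
      (solve 6 (λ a b c d e f → a :* (c :+ e) :+ :- (b :* (d :+ f)) :=
        a :* c :+ :- (b :* d) :+ (a :* e :+ :- (b :* f))) refl a b c d e f)
      (solve 7 (λ T a b c d e f → a :* (d :+ f) :+ b :* (c :+ e) :+ T :* (b :* (d :+ f)) :=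
        a :* d :+ b :* c :+ T :* (b :* d) :+ (a :* f :+ b :* e :+ T :* (b :* f))) refl T a b c d e f)

    ring : IsCommutativeRing _≡_ add mul neg 0K 1K
    ring = record
      { isRing = record
        { +-isAbelianGroup = record
          { isGroup = record
            { isMonoid = record
              { isSemigroup = record
                { isMagma = record { isEquivalence = isEquivalence ; ∙-cong = cong₂ add }
                ; assoc = λ x y z → cong₂ _,_ (+ᵏ-assoc _ _ _) (+ᵏ-assoc _ _ _) }
              ; identity = (λ x → cong₂ _,_ (+-identityˡ _) (+-identityˡ _)) , (λ x → cong₂ _,_ (+-identityʳ _) (+-identityʳ _)) }
            ; inverse = (λ x → cong₂ _,_ (-‿inverseˡ _) (-‿inverseˡ _)) , (λ x → cong₂ _,_ (-‿inverseʳ _) (-‿inverseʳ _))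
            ; ⁻¹-cong = cong neg }
          ; comm = λ x y → cong₂ _,_ (+ᵏ-comm _ _) (+ᵏ-comm _ _) }
        ; *-cong = cong₂ mul
        ; *-assoc = mul-assoc
        ; *-identity = mul-identityˡ , (λ x → trans (mul-comm x 1K) (mul-identityˡ x))
        ; distrib = mul-distribˡ , (λ x y z → trans (mul-comm (add y z) x) (trans (mul-distribˡ x y z) (cong₂ add (mul-comm x y) (mul-comm x z)))) }
      ; *-comm = mul-comm }
      where open import Relation.Binary.PropositionalEquality using (isEquivalence)

    norm : K → Carrier
    norm (x , y) = x *ᵏ x +ᵏ T *ᵏ (x *ᵏ y) +ᵏ y *ᵏ y

    -- A zero x + y t of the norm with y ≠ 0 gives the root -x/y of the characteristic polynomial.
    norm≢0 : ∀ z → z ≢ 0K → norm z ≢ 0ᵏ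
    norm≢0 (x , y) z≢0 N≡0 with y ≟ 0ᵏ
    ... | yes refl = *-nonzero x≢0 x≢0 (trans
          (solve 2 (λ T x → x :* x := x :* x :+ T :* (x :* con (pos 0)) :+ con (pos 0) :* con (pos 0)) refl T x) N≡0)
      where
      x≢0 : x ≢ 0ᵏ
      x≢0 x≡0 = z≢0 (cong (_, 0ᵏ) x≡0)
    ... | no y≢0 = irreducible (-ᵏ r) (T +ᵏ r) (solve 2 (λ T r → :- r :+ (T :+ r) := T) refl T r) (begin
        -ᵏ r *ᵏ (T +ᵏ r)
          ≡⟨ solve 4 (λ T x y i → :- (x :* i) :* (T :+ x :* i) :=
               (y :* i) :* (y :* i) :+ T :* (x :* i) :* (y :* i :+ :- con (pos 1))
                 :+ :- ((x :* x :+ T :* (x :* y) :+ y :* y) :* (i :* i))) refl T x y i ⟩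
        (y *ᵏ i) *ᵏ (y *ᵏ i) +ᵏ T *ᵏ (x *ᵏ i) *ᵏ (y *ᵏ i +ᵏ -ᵏ 1ᵏ) +ᵏ -ᵏ (norm (x , y) *ᵏ (i *ᵏ i))
          ≡⟨ cong₂ (λ u n → u *ᵏ u +ᵏ T *ᵏ (x *ᵏ i) *ᵏ (u +ᵏ -ᵏ 1ᵏ) +ᵏ -ᵏ (n *ᵏ (i *ᵏ i))) (proj₂ (inverse y y≢0)) N≡0 ⟩
        1ᵏ *ᵏ 1ᵏ +ᵏ T *ᵏ (x *ᵏ i) *ᵏ (1ᵏ +ᵏ -ᵏ 1ᵏ) +ᵏ -ᵏ (0ᵏ *ᵏ (i *ᵏ i))
          ≡⟨ solve 3 (λ T x i → con (pos 1) :* con (pos 1) :+ T :* (x :* i) :* (con (pos 1) :+ :- con (pos 1))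
               :+ :- (con (pos 0) :* (i :* i)) := con (pos 1)) refl T x i ⟩
        1ᵏ ∎)
      where
      open ≡-Reasoning
      i = proj₁ (inverse y y≢0)
      r = x *ᵏ i

    inverseK : ∀ z → z ≢ 0K → ∃ λ w → mul z w ≡ 1K
    inverseK z@(x , y) z≢0 = ((x +ᵏ T *ᵏ y) *ᵏ i , -ᵏ y *ᵏ i) , cong₂ _,_
        (trans (solve 4 (λ T x y i → x :* ((x :+ T :* y) :* i) :+ :- (y :* (:- y :* i)) :=
          (x :* x :+ T :* (x :* y) :+ y :* y) :* i) refl T x y i) (proj₂ (inverse (norm z) (norm≢0 z z≢0))))
        (solve 4 (λ T x y i → x :* (:- y :* i) :+ y :* ((x :+ T :* y) :* i) :+ T :* (y :* (:- y :* i)) := con (pos 0)) refl T x y i)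
      where i = proj₁ (inverse (norm z) (norm≢0 z z≢0))

  extension : FiniteField
  extension = record
    { Carrier = K
    ; _+ᵏ_ = add ; _*ᵏ_ = mul ; -ᵏ_ = neg ; 0ᵏ = 0K ; 1ᵏ = 1K
    ; isCommutativeRing = ring
    ; _≟_ = ≡-dec _≟_ _≟_
    ; 1≢0 = λ e → 1≢0 (cong proj₁ e)
    ; inverse = inverseK
    ; elements = cartesianProduct elements elements
    ; complete = λ (x , y) → ∈-cartesianProduct⁺ (complete x) (complete y)
    ; elements-unique = Uniqueₚ.cartesianProduct⁺ elements-unique elements-unique }

  extension-card : FiniteField.card extension ≡ card * card
  extension-card = length-cartesianProduct elements elements

  extension-fromℕ : ∀ n → Polynomial.fromℕ extension n ≡ (Polynomial.fromℕ 𝔽 n , 0ᵏ)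
  extension-fromℕ zero = refl
  extension-fromℕ (suc n) = trans (cong (add 1K) (extension-fromℕ n)) (cong (λ b → (1ᵏ +ᵏ Polynomial.fromℕ 𝔽 n , b)) (+-identityˡ 0ᵏ))

  bar-add : ∀ x y → bar (add x y) ≡ add (bar x) (bar y)
  bar-add (a , b) (c , d) = cong₂ _,_
    (solve 5 (λ T a b c d → a :+ c :+ T :* (b :+ d) := a :+ T :* b :+ (c :+ T :* d)) refl T a b c d)
    (solve 2 (λ b d → :- (b :+ d) := :- b :+ :- d) refl b d)

  bar-neg : ∀ x → bar (neg x) ≡ neg (bar x)
  bar-neg (a , b) = cong (_, -ᵏ (-ᵏ b)) (solve 3 (λ T a b → :- a :+ T :* :- b := :- (a :+ T :* b)) refl T a b)

  bar-mul : ∀ x y → bar (mul x y) ≡ mul (bar x) (bar y)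
  bar-mul (a , b) (c , d) = cong₂ _,_
    (solve 5 (λ T a b c d → a :* c :+ :- (b :* d) :+ T :* (a :* d :+ b :* c :+ T :* (b :* d)) :=
      (a :+ T :* b) :* (c :+ T :* d) :+ :- (:- b :* :- d)) refl T a b c d)
    (solve 5 (λ T a b c d → :- (a :* d :+ b :* c :+ T :* (b :* d)) :=
      (a :+ T :* b) :* :- d :+ :- b :* (c :+ T :* d) :+ T :* (:- b :* :- d)) refl T a b c d)

  bar-1 : bar 1K ≡ 1K
  bar-1 = cong₂ _,_ (solve 1 (λ T → con (pos 1) :+ T :* con (pos 0) := con (pos 1)) refl T)
    (solve 0 (:- con (pos 0) := con (pos 0)) refl)

  bar-bar : ∀ x → bar (bar x) ≡ x
  bar-bar (a , b) = cong₂ _,_ (solve 3 (λ T a b → a :+ T :* b :+ T :* :- b := a) refl T a b)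
    (solve 1 (λ b → :- (:- b) := b) refl b)

  t*bar-t : mul t (bar t) ≡ 1K
  t*bar-t = cong₂ _,_
    (solve 1 (λ T → con (pos 0) :* (con (pos 0) :+ T :* con (pos 1)) :+ :- (con (pos 1) :* :- con (pos 1)) := con (pos 1)) refl T)
    (solve 1 (λ T → con (pos 0) :* :- con (pos 1) :+ con (pos 1) :* (con (pos 0) :+ T :* con (pos 1))
      :+ T :* (con (pos 1) :* :- con (pos 1)) := con (pos 0)) refl T)

-- The orbit of a vector as a cyclic group in the quadratic extension.

module Orbit (p : ℕ) .{{_ : NonZero p}} (p-prime : Prime p) (A : Mat2 p) (det≡1 : InSL2 p A)
  (charPoly-irreducible : CharPolyIrreducible p A) where
  open PrimeField p p-prime
  open FiniteField primeField

  T : F p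
  T = trace p A

  open QuadraticExtension primeField T (λ r s r+s≡T rs≡1 → charPoly-irreducible (r , s , r+s≡T , trans rs≡1 (sym det≡1))) public
  open FiniteField extension using () renaming (_^ᵏ_ to _^ᴷ_; ^-+ to ^ᴷ-+; ^-* to ^ᴷ-*; 1^ to 1^ᴷ; ^-distrib-* to ^ᴷ-distrib-*; *-cancelˡ to *ᴷ-cancelˡ; *-identityʳ to *ᴷ-identityʳ; *-identityˡ to *ᴷ-identityˡ; ^-nonzero to ^ᴷ-nonzero)

  private
    α = proj₁ (proj₁ A)
    β = proj₂ (proj₁ A)
    γ = proj₁ (proj₂ A)
    δ = proj₂ (proj₂ A)

    determinant : α *ᵏ δ +ᵏ -ᵏ (β *ᵏ γ) ≡ 1ᵏ
    determinant = det≡1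

  infixl 7 _·A
  _·A : Vec2 p → Vec2 p
  b ·A = vecMul p b A

  -- The action of x + y t on row vectors, t acting as A.
  act : Vec2 p → K → Vec2 p
  act b (x , y) = x *ᵏ proj₁ b +ᵏ y *ᵏ proj₁ (b ·A) , x *ᵏ proj₂ b +ᵏ y *ᵏ proj₂ (b ·A)

  act-0 : ∀ b → act b 0K ≡ 0V p
  act-0 b = cong₂ _,_ (zero-sum _ _) (zero-sum _ _)
    where
    zero-sum : ∀ u v → 0ᵏ *ᵏ u +ᵏ 0ᵏ *ᵏ v ≡ 0ᵏ
    zero-sum = solve 2 (λ u v → con (pos 0) :* u :+ con (pos 0) :* v := con (pos 0)) refl

  act-1 : ∀ b → act b 1K ≡ b
  act-1 b = cong₂ _,_ (one-sum _ _) (one-sum _ _)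
    where
    one-sum : ∀ u v → 1ᵏ *ᵏ u +ᵏ 0ᵏ *ᵏ v ≡ u
    one-sum = solve 2 (λ u v → con (pos 1) :* u :+ con (pos 0) :* v := u) refl

  act-add : ∀ b z w → act b (add z w) ≡ addV p (act b z) (act b w)
  act-add b (x , y) (x' , y') = cong₂ _,_ (distribute _ _) (distribute _ _)
    where
    distribute : ∀ u v → (x +ᵏ x') *ᵏ u +ᵏ (y +ᵏ y') *ᵏ v ≡ x *ᵏ u +ᵏ y *ᵏ v +ᵏ (x' *ᵏ u +ᵏ y' *ᵏ v)
    distribute = solve 6 (λ x y x' y' u v → (x :+ x') :* u :+ (y :+ y') :* v := x :* u :+ y :* v :+ (x' :* u :+ y' :* v)) refl x y x' y'

  -- Cayley–Hamilton: b A² = T b A - b.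
  act-t : ∀ b z → act b (mul t z) ≡ act b z ·A
  act-t (b₁ , b₂) (x , y) = cong₂ _,_ first second
    where
    open ≡-Reasoning
    bA₁ = b₁ *ᵏ α +ᵏ b₂ *ᵏ γ
    bA₂ = b₁ *ᵏ β +ᵏ b₂ *ᵏ δ
    first : (0ᵏ *ᵏ x +ᵏ -ᵏ (1ᵏ *ᵏ y)) *ᵏ b₁ +ᵏ (0ᵏ *ᵏ y +ᵏ 1ᵏ *ᵏ x +ᵏ T *ᵏ (1ᵏ *ᵏ y)) *ᵏ bA₁ ≡
      (x *ᵏ b₁ +ᵏ y *ᵏ bA₁) *ᵏ α +ᵏ (x *ᵏ b₂ +ᵏ y *ᵏ bA₂) *ᵏ γ
    first = begin
      (0ᵏ *ᵏ x +ᵏ -ᵏ (1ᵏ *ᵏ y)) *ᵏ b₁ +ᵏ (0ᵏ *ᵏ y +ᵏ 1ᵏ *ᵏ x +ᵏ T *ᵏ (1ᵏ *ᵏ y)) *ᵏ bA₁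
        ≡⟨ solve 5 (λ x y T b bA → (con (pos 0) :* x :+ :- (con (pos 1) :* y)) :* b :+
             (con (pos 0) :* y :+ con (pos 1) :* x :+ T :* (con (pos 1) :* y)) :* bA := con (pos 1) :* (:- y :* b) :+ (x :+ T :* y) :* bA)
             refl x y T b₁ bA₁ ⟩
      1ᵏ *ᵏ (-ᵏ y *ᵏ b₁) +ᵏ (x +ᵏ T *ᵏ y) *ᵏ bA₁
        ≡⟨ cong (λ D → D *ᵏ (-ᵏ y *ᵏ b₁) +ᵏ (x +ᵏ T *ᵏ y) *ᵏ bA₁) (sym determinant) ⟩
      (α *ᵏ δ +ᵏ -ᵏ (β *ᵏ γ)) *ᵏ (-ᵏ y *ᵏ b₁) +ᵏ (x +ᵏ T *ᵏ y) *ᵏ bA₁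
        ≡⟨ solve 8 (λ x y b₁ b₂ α β γ δ → (α :* δ :+ :- (β :* γ)) :* (:- y :* b₁) :+ (x :+ (α :+ δ) :* y) :* (b₁ :* α :+ b₂ :* γ) :=
             (x :* b₁ :+ y :* (b₁ :* α :+ b₂ :* γ)) :* α :+ (x :* b₂ :+ y :* (b₁ :* β :+ b₂ :* δ)) :* γ) refl x y b₁ b₂ α β γ δ ⟩
      (x *ᵏ b₁ +ᵏ y *ᵏ bA₁) *ᵏ α +ᵏ (x *ᵏ b₂ +ᵏ y *ᵏ bA₂) *ᵏ γ ∎
    second : (0ᵏ *ᵏ x +ᵏ -ᵏ (1ᵏ *ᵏ y)) *ᵏ b₂ +ᵏ (0ᵏ *ᵏ y +ᵏ 1ᵏ *ᵏ x +ᵏ T *ᵏ (1ᵏ *ᵏ y)) *ᵏ bA₂ ≡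
      (x *ᵏ b₁ +ᵏ y *ᵏ bA₁) *ᵏ β +ᵏ (x *ᵏ b₂ +ᵏ y *ᵏ bA₂) *ᵏ δ
    second = begin
      (0ᵏ *ᵏ x +ᵏ -ᵏ (1ᵏ *ᵏ y)) *ᵏ b₂ +ᵏ (0ᵏ *ᵏ y +ᵏ 1ᵏ *ᵏ x +ᵏ T *ᵏ (1ᵏ *ᵏ y)) *ᵏ bA₂
        ≡⟨ solve 5 (λ x y T b bA → (con (pos 0) :* x :+ :- (con (pos 1) :* y)) :* b :+
             (con (pos 0) :* y :+ con (pos 1) :* x :+ T :* (con (pos 1) :* y)) :* bA := con (pos 1) :* (:- y :* b) :+ (x :+ T :* y) :* bA)
             refl x y T b₂ bA₂ ⟩
      1ᵏ *ᵏ (-ᵏ y *ᵏ b₂) +ᵏ (x +ᵏ T *ᵏ y) *ᵏ bA₂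
        ≡⟨ cong (λ D → D *ᵏ (-ᵏ y *ᵏ b₂) +ᵏ (x +ᵏ T *ᵏ y) *ᵏ bA₂) (sym determinant) ⟩
      (α *ᵏ δ +ᵏ -ᵏ (β *ᵏ γ)) *ᵏ (-ᵏ y *ᵏ b₂) +ᵏ (x +ᵏ T *ᵏ y) *ᵏ bA₂
        ≡⟨ solve 8 (λ x y b₁ b₂ α β γ δ → (α :* δ :+ :- (β :* γ)) :* (:- y :* b₂) :+ (x :+ (α :+ δ) :* y) :* (b₁ :* β :+ b₂ :* δ) :=
             (x :* b₁ :+ y :* (b₁ :* α :+ b₂ :* γ)) :* β :+ (x :* b₂ :+ y :* (b₁ :* β :+ b₂ :* δ)) :* δ) refl x y b₁ b₂ α β γ δ ⟩
      (x *ᵏ b₁ +ᵏ y *ᵏ bA₁) *ᵏ β +ᵏ (x *ᵏ b₂ +ᵏ y *ᵏ bA₂) *ᵏ δ ∎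

  vecMul-assoc : ∀ b (M N : Mat2 p) → vecMul p b (mulM p M N) ≡ vecMul p (vecMul p b M) N
  vecMul-assoc (x , y) ((a , b) , (c , d)) ((e , f) , (g , h)) = cong₂ _,_ (assoc e g) (assoc f h)
    where
    assoc : ∀ e g → x *ᵏ (a *ᵏ e +ᵏ b *ᵏ g) +ᵏ y *ᵏ (c *ᵏ e +ᵏ d *ᵏ g) ≡ (x *ᵏ a +ᵏ y *ᵏ c) *ᵏ e +ᵏ (x *ᵏ b +ᵏ y *ᵏ d) *ᵏ g
    assoc = solve 8 (λ x y a b c d e g → x :* (a :* e :+ b :* g) :+ y :* (c :* e :+ d :* g) :=
      (x :* a :+ y :* c) :* e :+ (x :* b :+ y :* d) :* g) refl x y a b c d

  vecMul-I : ∀ b → vecMul p b (I2 p) ≡ b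
  vecMul-I (x , y) = cong₂ _,_
    (solve 2 (λ x y → x :* con (pos 1) :+ y :* con (pos 0) := x) refl x y)
    (solve 2 (λ x y → x :* con (pos 0) :+ y :* con (pos 1) := y) refl x y)

  act-power : ∀ b n → act b (t ^ᴷ n) ≡ vecMul p b (powM p A n)
  act-power b zero = trans (act-1 b) (sym (vecMul-I b))
  act-power b (suc n) = trans (act-t b (t ^ᴷ n)) (trans (cong _·A (act-power b n)) (sym (vecMul-assoc b (powM p A n) A)))

  -- Multiplying a (A - r) = 0 by the adjugate of A - r gives χ(r) a = 0, and χ(r) ≠ 0 because the
  -- characteristic polynomial has no root.
  no-eigenvector : ∀ {a₁ a₂} r → a₁ *ᵏ α +ᵏ a₂ *ᵏ γ ≡ r *ᵏ a₁ → a₁ *ᵏ β +ᵏ a₂ *ᵏ δ ≡ r *ᵏ a₂ → (a₁ , a₂) ≡ 0V p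
  no-eigenvector {a₁} {a₂} r e₁ e₂ = cong₂ _,_ a₁≡0 a₂≡0
    where
    open ≡-Reasoning
    X = a₁ *ᵏ α +ᵏ a₂ *ᵏ γ +ᵏ -ᵏ (r *ᵏ a₁)
    Y = a₁ *ᵏ β +ᵏ a₂ *ᵏ δ +ᵏ -ᵏ (r *ᵏ a₂)
    χ = α *ᵏ δ +ᵏ -ᵏ (β *ᵏ γ) +ᵏ -ᵏ (r *ᵏ (T +ᵏ -ᵏ r))
    χ≢0 : χ ≢ 0ᵏ
    χ≢0 χ≡0 = charPoly-irreducible (r , T +ᵏ -ᵏ r , solve 2 (λ r T → r :+ (T :+ :- r) := T) refl r T , sym (x-y≡0⇒x≡y χ≡0))
    a₁≡0 : a₁ ≡ 0ᵏ
    a₁≡0 = *-cancelˡ-0 χ≢0 (begin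
      χ *ᵏ a₁
        ≡⟨ solve 7 (λ a₁ a₂ r α β γ δ → (α :* δ :+ :- (β :* γ) :+ :- (r :* (α :+ δ :+ :- r))) :* a₁ :=
             (a₁ :* α :+ a₂ :* γ :+ :- (r :* a₁)) :* (δ :+ :- r) :+ :- ((a₁ :* β :+ a₂ :* δ :+ :- (r :* a₂)) :* γ)) refl a₁ a₂ r α β γ δ ⟩
      X *ᵏ (δ +ᵏ -ᵏ r) +ᵏ -ᵏ (Y *ᵏ γ)
        ≡⟨ cong₂ (λ u v → u *ᵏ (δ +ᵏ -ᵏ r) +ᵏ -ᵏ (v *ᵏ γ)) (x≡y⇒x-y≡0 e₁) (x≡y⇒x-y≡0 e₂) ⟩
      0ᵏ *ᵏ (δ +ᵏ -ᵏ r) +ᵏ -ᵏ (0ᵏ *ᵏ γ)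
        ≡⟨ solve 2 (λ u v → con (pos 0) :* u :+ :- (con (pos 0) :* v) := con (pos 0)) refl (δ +ᵏ -ᵏ r) γ ⟩
      0ᵏ ∎)
    a₂≡0 : a₂ ≡ 0ᵏ
    a₂≡0 = *-cancelˡ-0 χ≢0 (begin
      χ *ᵏ a₂
        ≡⟨ solve 7 (λ a₁ a₂ r α β γ δ → (α :* δ :+ :- (β :* γ) :+ :- (r :* (α :+ δ :+ :- r))) :* a₂ :=
             (a₁ :* β :+ a₂ :* δ :+ :- (r :* a₂)) :* (α :+ :- r) :+ :- ((a₁ :* α :+ a₂ :* γ :+ :- (r :* a₁)) :* β)) refl a₁ a₂ r α β γ δ ⟩
      Y *ᵏ (α +ᵏ -ᵏ r) +ᵏ -ᵏ (X *ᵏ β)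
        ≡⟨ cong₂ (λ u v → u *ᵏ (α +ᵏ -ᵏ r) +ᵏ -ᵏ (v *ᵏ β)) (x≡y⇒x-y≡0 e₂) (x≡y⇒x-y≡0 e₁) ⟩
      0ᵏ *ᵏ (α +ᵏ -ᵏ r) +ᵏ -ᵏ (0ᵏ *ᵏ β)
        ≡⟨ solve 2 (λ u v → con (pos 0) :* u :+ :- (con (pos 0) :* v) := con (pos 0)) refl (α +ᵏ -ᵏ r) β ⟩
      0ᵏ ∎)

  cross : Vec2 p → Vec2 p → F p
  cross (u₁ , u₂) (v₁ , v₂) = u₁ *ᵏ v₂ +ᵏ -ᵏ (u₂ *ᵏ v₁)

  -- If a A were proportional to a, then a would be an eigenvector. Hence a and a A form a basis,
  -- and the action of the extension on row vectors is free and transitive off 0.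
  cyclic : ∀ a → a ≢ 0V p → cross a (a ·A) ≢ 0ᵏ
  cyclic a@(a₁ , a₂) a≢0 Δ≡0 with a₁ ≟ 0ᵏ | a₂ ≟ 0ᵏ
  ... | yes refl | yes refl = a≢0 refl
  ... | no a₁≢0 | _ = a≢0 (no-eigenvector (proj₁ (a ·A) *ᵏ i) (first (proj₁ (a ·A)) ) (second (proj₁ (a ·A)) (proj₂ (a ·A)) Δ≡0))
    where
    i = proj₁ (inverse a₁ a₁≢0)
    a₁i≡1 = proj₂ (inverse a₁ a₁≢0)
    first : ∀ c → c ≡ c *ᵏ i *ᵏ a₁
    first c = sym (trans (solve 3 (λ c i a → c :* i :* a := c :* (a :* i)) refl c i a₁) (trans (cong (c *ᵏ_) a₁i≡1) (*-identityʳ c)))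
    second : ∀ c d → a₁ *ᵏ d +ᵏ -ᵏ (a₂ *ᵏ c) ≡ 0ᵏ → d ≡ c *ᵏ i *ᵏ a₂
    second c d e = *-cancelˡ a₁≢0 (trans (x-y≡0⇒x≡y e)
      (trans (sym (trans (cong (a₂ *ᵏ_) (cong (c *ᵏ_) a₁i≡1)) (cong (a₂ *ᵏ_) (*-identityʳ c))))
        (solve 4 (λ a₁ a₂ c i → a₂ :* (c :* (a₁ :* i)) := a₁ :* (c :* i :* a₂)) refl a₁ a₂ c i)))
  ... | yes _ | no a₂≢0 = a≢0 (no-eigenvector (proj₂ (a ·A) *ᵏ i) (second (proj₁ (a ·A)) (proj₂ (a ·A)) Δ≡0) (first (proj₂ (a ·A))))
    where
    i = proj₁ (inverse a₂ a₂≢0)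
    a₂i≡1 = proj₂ (inverse a₂ a₂≢0)
    first : ∀ c → c ≡ c *ᵏ i *ᵏ a₂
    first c = sym (trans (solve 3 (λ c i a → c :* i :* a := c :* (a :* i)) refl c i a₂) (trans (cong (c *ᵏ_) a₂i≡1) (*-identityʳ c)))
    second : ∀ c d → a₁ *ᵏ d +ᵏ -ᵏ (a₂ *ᵏ c) ≡ 0ᵏ → c ≡ d *ᵏ i *ᵏ a₁
    second c d e = *-cancelˡ a₂≢0 (trans (sym (x-y≡0⇒x≡y e))
      (trans (sym (trans (cong (a₁ *ᵏ_) (cong (d *ᵏ_) a₂i≡1)) (cong (a₁ *ᵏ_) (*-identityʳ d))))
        (solve 4 (λ a₁ a₂ d i → a₁ :* (d :* (a₂ :* i)) := a₂ :* (d :* i :* a₁)) refl a₁ a₂ d i)))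

  module _ {a : Vec2 p} (a≢0 : a ≢ 0V p) where
    private
      a₁ = proj₁ a
      a₂ = proj₂ a
      b₁ = proj₁ (a ·A)
      b₂ = proj₂ (a ·A)
      Δ = cross a (a ·A)
      Δ≢0 = cyclic a a≢0
      i = proj₁ (inverse Δ Δ≢0)

    act-injective : ∀ {z w} → act a z ≡ act a w → z ≡ w
    act-injective {x , y} {x' , y'} e = cong₂ _,_
      (*-cancelˡ Δ≢0 (trans (cramer-x x y) (trans (cong (λ v → cross v (a ·A)) e) (sym (cramer-x x' y')))))
      (*-cancelˡ Δ≢0 (trans (cramer-y x y) (trans (cong (cross a) e) (sym (cramer-y x' y')))))
      where
      cramer-x : ∀ x y → Δ *ᵏ x ≡ cross (act a (x , y)) (a ·A)
      cramer-x x y = solve 6 (λ x y a₁ a₂ b₁ b₂ → (a₁ :* b₂ :+ :- (a₂ :* b₁)) :* x :=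
        (x :* a₁ :+ y :* b₁) :* b₂ :+ :- ((x :* a₂ :+ y :* b₂) :* b₁)) refl x y a₁ a₂ b₁ b₂
      cramer-y : ∀ x y → Δ *ᵏ y ≡ cross a (act a (x , y))
      cramer-y x y = solve 6 (λ x y a₁ a₂ b₁ b₂ → (a₁ :* b₂ :+ :- (a₂ :* b₁)) :* y :=
        a₁ :* (x :* a₂ :+ y :* b₂) :+ :- (a₂ :* (x :* a₁ :+ y :* b₁))) refl x y a₁ a₂ b₁ b₂

    act-surjective : ∀ v → ∃ λ z → act a z ≡ v
    act-surjective (v₁ , v₂) = (cross (v₁ , v₂) (a ·A) *ᵏ i , cross a (v₁ , v₂) *ᵏ i) , cong₂ _,_
      (trans (solve 7 (λ v₁ v₂ a₁ a₂ b₁ b₂ i →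
        (v₁ :* b₂ :+ :- (v₂ :* b₁)) :* i :* a₁ :+ (a₁ :* v₂ :+ :- (a₂ :* v₁)) :* i :* b₁ :=
        (a₁ :* b₂ :+ :- (a₂ :* b₁)) :* i :* v₁) refl v₁ v₂ a₁ a₂ b₁ b₂ i) (scaled v₁))
      (trans (solve 7 (λ v₁ v₂ a₁ a₂ b₁ b₂ i →
        (v₁ :* b₂ :+ :- (v₂ :* b₁)) :* i :* a₂ :+ (a₁ :* v₂ :+ :- (a₂ :* v₁)) :* i :* b₂ :=
        (a₁ :* b₂ :+ :- (a₂ :* b₁)) :* i :* v₂) refl v₁ v₂ a₁ a₂ b₁ b₂ i) (scaled v₂))
      where
      scaled : ∀ v → Δ *ᵏ i *ᵏ v ≡ v
      scaled v = trans (cong (_*ᵏ v) (proj₂ (inverse Δ Δ≢0))) (*-identityˡ v)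

  module _ {τ : ℕ} (order : IsOrder p A τ) where
    private
      e₁ : Vec2 p
      e₁ = 1ᵏ , 0ᵏ

      e₂ : Vec2 p
      e₂ = 0ᵏ , 1ᵏ

      e₁≢0 : e₁ ≢ 0V p
      e₁≢0 e = 1≢0 (cong proj₁ e)

      rows-determine : ∀ {M N : Mat2 p} → vecMul p e₁ M ≡ vecMul p e₁ N → vecMul p e₂ M ≡ vecMul p e₂ N → M ≡ N
      rows-determine {M} {N} r₁ r₂ = cong₂ _,_ (trans (sym (row₁ M)) (trans r₁ (row₁ N))) (trans (sym (row₂ M)) (trans r₂ (row₂ N)))
        where
        pick₁ : ∀ u v → 1ᵏ *ᵏ u +ᵏ 0ᵏ *ᵏ v ≡ u
        pick₁ = solve 2 (λ u v → con (pos 1) :* u :+ con (pos 0) :* v := u) refl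
        pick₂ : ∀ u v → 0ᵏ *ᵏ u +ᵏ 1ᵏ *ᵏ v ≡ v
        pick₂ = solve 2 (λ u v → con (pos 0) :* u :+ con (pos 1) :* v := v) refl
        row₁ : ∀ M → vecMul p e₁ M ≡ proj₁ M
        row₁ ((m₁ , m₂) , (m₃ , m₄)) = cong₂ _,_ (pick₁ m₁ m₃) (pick₁ m₂ m₄)
        row₂ : ∀ M → vecMul p e₂ M ≡ proj₂ M
        row₂ ((m₁ , m₂) , (m₃ , m₄)) = cong₂ _,_ (pick₂ m₁ m₃) (pick₂ m₂ m₄)

    t^τ≡1 : t ^ᴷ τ ≡ 1K
    t^τ≡1 = act-injective e₁≢0 (begin
      act e₁ (t ^ᴷ τ)              ≡⟨ act-power e₁ τ ⟩
      vecMul p e₁ (powM p A τ)     ≡⟨ cong (vecMul p e₁) (proj₁ (proj₂ order)) ⟩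
      vecMul p e₁ (I2 p)           ≡⟨ trans (vecMul-I e₁) (sym (act-1 e₁)) ⟩
      act e₁ 1K                    ∎)
      where open ≡-Reasoning

    t^n≢1 : ∀ n → 1 ≤ n → n < τ → t ^ᴷ n ≢ 1K
    t^n≢1 n 1≤n n<τ e = proj₂ (proj₂ order) n 1≤n n<τ (rows-determine (fixes e₁) (fixes e₂))
      where
      fixes : ∀ b → vecMul p b (powM p A n) ≡ vecMul p b (I2 p)
      fixes b = trans (sym (act-power b n)) (trans (cong (act b) e) (trans (act-1 b) (sym (vecMul-I b))))

    group : List K
    group = applyUpTo (λ n → t ^ᴷ suc n) τ

    t≢0 : t ≢ 0K
    t≢0 e = 1≢0 (cong proj₂ e)

    group-unique : Unique group
    group-unique = applyUpTo⁺₁ (λ n → t ^ᴷ suc n) τ distinct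
      where
      open import Data.List.Relation.Unary.Unique.Propositional.Properties using (applyUpTo⁺₁)
      distinct : ∀ {i j} → i < j → j < τ → t ^ᴷ suc i ≢ t ^ᴷ suc j
      distinct {i} {j} i<j j<τ e = t^n≢1 (j ∸ i) (ℕₚ.m<n⇒0<n∸m i<j) (ℕₚ.≤-<-trans (ℕₚ.m∸n≤m j i) j<τ)
        (*ᴷ-cancelˡ (^ᴷ-nonzero (suc i) t≢0) (begin
          mul (t ^ᴷ suc i) (t ^ᴷ (j ∸ i))   ≡⟨ sym (^ᴷ-+ t (suc i) (j ∸ i)) ⟩
          t ^ᴷ (suc i + (j ∸ i))            ≡⟨ cong (λ n → t ^ᴷ suc n) (ℕₚ.m+[n∸m]≡n (ℕₚ.<⇒≤ i<j)) ⟩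
          t ^ᴷ suc j                        ≡⟨ sym e ⟩
          t ^ᴷ suc i                        ≡⟨ sym (*ᴷ-identityʳ (t ^ᴷ suc i)) ⟩
          mul (t ^ᴷ suc i) 1K               ∎))
        where open ≡-Reasoning

    length-group : length group ≡ τ
    length-group = length-applyUpTo (λ n → t ^ᴷ suc n) τ
      where open import Data.List.Properties using (length-applyUpTo)

    Power : K → Set
    Power z = ∃ λ n → z ≡ t ^ᴷ n

    power-closed : ∀ {x y} → Power x → Power y → Power (mul x y)
    power-closed (m , e) (n , e') = m + n , trans (cong₂ mul e e') (sym (^ᴷ-+ t m n))

    group⇒power : ∀ {z} → z ∈ group → Power z
    group⇒power z∈ = let n , _ , e = ∈-applyUpTo⁻ (λ n → t ^ᴷ suc n) z∈ in suc n , e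
      where open import Data.List.Membership.Propositional.Properties using (∈-applyUpTo⁻)

    power-norm : ∀ {z} → Power z → mul z (bar z) ≡ 1K
    power-norm (n , refl) = begin
      mul (t ^ᴷ n) (bar (t ^ᴷ n))      ≡⟨ cong (mul (t ^ᴷ n)) (bar-power n) ⟩
      mul (t ^ᴷ n) (bar t ^ᴷ n)        ≡⟨ sym (^ᴷ-distrib-* t (bar t) n) ⟩
      mul t (bar t) ^ᴷ n               ≡⟨ cong (_^ᴷ n) t*bar-t ⟩
      1K ^ᴷ n                          ≡⟨ 1^ᴷ n ⟩
      1K                               ∎
      where
      open ≡-Reasoning
      bar-power : ∀ n → bar (t ^ᴷ n) ≡ bar t ^ᴷ n
      bar-power zero = bar-1
      bar-power (suc n) = trans (bar-mul t (t ^ᴷ n)) (cong (mul (bar t)) (bar-power n))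

    power-torsion : ∀ {z} → Power z → z ^ᴷ τ ≡ 1K
    power-torsion (n , refl) = begin
      (t ^ᴷ n) ^ᴷ τ     ≡⟨ sym (^ᴷ-* t n τ) ⟩
      t ^ᴷ (n * τ)      ≡⟨ cong (t ^ᴷ_) (ℕₚ.*-comm n τ) ⟩
      t ^ᴷ (τ * n)      ≡⟨ ^ᴷ-* t τ n ⟩
      (t ^ᴷ τ) ^ᴷ n     ≡⟨ cong (_^ᴷ n) t^τ≡1 ⟩
      1K ^ᴷ n           ≡⟨ 1^ᴷ n ⟩
      1K                ∎
      where open ≡-Reasoning

    power⇒orbit : ∀ a {z} → Power z → InOrbit p a A τ (act a z)
    power⇒orbit a (n , refl) = by-residue (n % τ) (m≡m%n+[m/n]*n n τ) (m%n<n n τ)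
      where
      open import Data.Nat.DivMod using (_%_; _/_; m≡m%n+[m/n]*n; m%n<n)
      instance
        τ-nonZero : NonZero τ
        τ-nonZero = >-nonZero (proj₁ order)
      periodic : ∀ r → t ^ᴷ (r + (n / τ) * τ) ≡ t ^ᴷ r
      periodic r = begin
        t ^ᴷ (r + (n / τ) * τ)                    ≡⟨ ^ᴷ-+ t r ((n / τ) * τ) ⟩
        mul (t ^ᴷ r) (t ^ᴷ ((n / τ) * τ))         ≡⟨ cong (mul (t ^ᴷ r)) (trans (^ᴷ-* t (n / τ) τ) (power-torsion (n / τ , refl))) ⟩
        mul (t ^ᴷ r) 1K                           ≡⟨ *ᴷ-identityʳ _ ⟩
        t ^ᴷ r                                    ∎
        where open ≡-Reasoning
      at-exponent : ∀ r → t ^ᴷ n ≡ t ^ᴷ r → vecMul p a (powM p A r) ≡ act a (t ^ᴷ n)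
      at-exponent r e = trans (sym (act-power a r)) (cong (act a) (sym e))
      by-residue : ∀ r → n ≡ r + (n / τ) * τ → r < τ → InOrbit p a A τ (act a (t ^ᴷ n))
      -- Exponents in the orbit start at 1, so the residue 0 is realised by τ.
      by-residue zero e _ = τ , proj₁ order , ℕₚ.≤-refl ,
        at-exponent τ (trans (cong (t ^ᴷ_) e) (trans (periodic 0) (sym t^τ≡1)))
      by-residue (suc r) e r<τ = suc r , s≤s z≤n , ℕₚ.<⇒≤ r<τ ,
        at-exponent (suc r) (trans (cong (t ^ᴷ_) e) (periodic (suc r)))

    open Sumsets extension Power power-closed using (Sums; nil; cons; AllSums)

    sums⇒sumset : ∀ a {k z} → Sums k z → InSumset p k (InOrbit p a A τ) (act a z)
    sums⇒sumset a nil = (λ ()) , (λ ()) , sym (act-0 a)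
    sums⇒sumset a (cons {g = g} {x = x} Pg s) =
      let f , orbit , sum≡ = sums⇒sumset a s
      in (λ { Fin.zero → act a g ; (Fin.suc i) → f i }) ,
         (λ { Fin.zero → power⇒orbit a Pg ; (Fin.suc i) → orbit i }) ,
         trans (cong (addV p (act a g)) sum≡) (sym (act-add a g x))
      where import Data.Fin.Base as Fin

    allSums⇒sumset : ∀ {a} → a ≢ 0V p → ∀ {k} → AllSums k → ∀ v → InSumset p k (InOrbit p a A τ) v
    allSums⇒sumset {a} a≢0 all v = let z , e = act-surjective a≢0 v
      in subst (InSumset p _ (InOrbit p a A τ)) e (sums⇒sumset a (all z))

-- Comparing powers of p and τ over the natural numbers.

module Powers where
  open import Data.Nat.Tactic.RingSolver using () renaming (solve-∀ to ℕ-ring)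
  open ℕₚ.≤-Reasoning

  ^-distribʳ-* : ∀ n x y → (x * y) ^ n ≡ x ^ n * y ^ n
  ^-distribʳ-* zero x y = refl
  ^-distribʳ-* (suc n) x y = trans (cong (x * y *_) (^-distribʳ-* n x y)) (interchange x y (x ^ n) (y ^ n))
    where
    interchange : ∀ a b c d → a * b * (c * d) ≡ a * c * (b * d)
    interchange = ℕ-ring

  ^-cancelʳ-≤ : ∀ n .{{_ : NonZero n}} {x y} → x ^ n ≤ y ^ n → x ≤ y
  ^-cancelʳ-≤ n {x} {y} h = ℕₚ.≮⇒≥ (λ y<x → ℕₚ.<⇒≱ (ℕₚ.^-monoˡ-< n y<x) h)

  -- If τ^f ≤ C p^e, then p^(f a) ≤ τ^(f b) ≤ C^b p^(e b). The strict inequality e b < f a leaves a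
  -- spare factor p, which exceeds C^b.
  power-comparison : ∀ {p τ} C a b e f → p ^ a ≤ τ ^ b → e * b < f * a → C ^ b < p → C * p ^ e < τ ^ f
  power-comparison {p} {τ} C a b e f p^a≤τ^b eb<fa C^b<p = ℕₚ.≰⇒> λ τ^f≤Cp^e → ℕₚ.<-irrefl refl (begin-strict
    p ^ (f * a)                ≡⟨ trans (cong (p ^_) (ℕₚ.*-comm f a)) (sym (ℕₚ.^-*-assoc p a f)) ⟩
    (p ^ a) ^ f                ≤⟨ ℕₚ.^-monoˡ-≤ f p^a≤τ^b ⟩
    (τ ^ b) ^ f                ≡⟨ trans (ℕₚ.^-*-assoc τ b f) (trans (cong (τ ^_) (ℕₚ.*-comm b f)) (sym (ℕₚ.^-*-assoc τ f b))) ⟩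
    (τ ^ f) ^ b                ≤⟨ ℕₚ.^-monoˡ-≤ b τ^f≤Cp^e ⟩
    (C * p ^ e) ^ b            ≡⟨ ^-distribʳ-* b C (p ^ e) ⟩
    C ^ b * (p ^ e) ^ b        ≡⟨ cong (C ^ b *_) (ℕₚ.^-*-assoc p e b) ⟩
    C ^ b * p ^ (e * b)        <⟨ ℕₚ.*-monoˡ-< (p ^ (e * b)) {{ℕₚ.m^n≢0 p (e * b)}} C^b<p ⟩
    p ^ suc (e * b)            ≤⟨ ℕₚ.^-monoʳ-≤ p eb<fa ⟩
    p ^ (f * a)                ∎)
    where
    instance
      p-nonZero : NonZero p
      p-nonZero = >-nonZero (ℕₚ.≤-<-trans z≤n C^b<p)

  -- τ ≥ p^(5/11 + ε) together with k + 3 > 45 / (11 ε), free of ε.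
  order-exponent : ∀ {p τ} .{{_ : NonZero p}} m n .{{_ : NonZero n}} k c → p ^ (5 * n + 11 * m) ≤ τ ^ (11 * n) →
    45 * n < 11 * m * (k + 3) → k + 3 ≤ c → p ^ (5 * c + 45) ≤ τ ^ (11 * c)
  order-exponent {p} {τ} m n k c h 45n< k+3≤c = ^-cancelʳ-≤ n (begin
    (p ^ (5 * c + 45)) ^ n           ≡⟨ ℕₚ.^-*-assoc p (5 * c + 45) n ⟩
    p ^ ((5 * c + 45) * n)           ≤⟨ ℕₚ.^-monoʳ-≤ p exponents ⟩
    p ^ ((5 * n + 11 * m) * c)       ≡⟨ sym (ℕₚ.^-*-assoc p (5 * n + 11 * m) c) ⟩
    (p ^ (5 * n + 11 * m)) ^ c       ≤⟨ ℕₚ.^-monoˡ-≤ c h ⟩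
    (τ ^ (11 * n)) ^ c               ≡⟨ trans (ℕₚ.^-*-assoc τ (11 * n) c) (trans (cong (τ ^_) (swap n c)) (sym (ℕₚ.^-*-assoc τ (11 * c) n))) ⟩
    (τ ^ (11 * c)) ^ n               ∎)
    where
    swap : ∀ n c → 11 * n * c ≡ 11 * c * n
    swap = ℕ-ring
    expand : ∀ c n → (5 * c + 45) * n ≡ 5 * n * c + 45 * n
    expand = ℕ-ring
    exponents : (5 * c + 45) * n ≤ (5 * n + 11 * m) * c
    exponents = begin
      (5 * c + 45) * n                 ≡⟨ expand c n ⟩
      5 * n * c + 45 * n               ≤⟨ ℕₚ.+-monoʳ-≤ (5 * n * c) (ℕₚ.≤-trans (ℕₚ.<⇒≤ 45n<) (ℕₚ.*-monoʳ-≤ (11 * m) k+3≤c)) ⟩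
      5 * n * c + 11 * m * c           ≡⟨ sym (ℕₚ.*-distribʳ-+ c (5 * n) (11 * m)) ⟩
      (5 * n + 11 * m) * c             ∎

  abstract
    -- Larger than every C^b that has to be absorbed; as a power of 1000 it is compared with C^b
    -- through C ≤ 1000^i and i b ≤ 10000. The number is abstract so that it is never evaluated.
    threshold : ℕ
    threshold = suc (1000 ^ 10000)

    threshold-bound : ∀ C i b → C ≤ 1000 ^ i → i * b ≤ 10000 → ∀ {p} → threshold ≤ p → C ^ b < p
    threshold-bound C i b C≤ ib≤ large = ℕₚ.≤-trans (s≤s (begin
      C ^ b                   ≤⟨ ℕₚ.^-monoˡ-≤ b C≤ ⟩
      (1000 ^ i) ^ b          ≡⟨ ℕₚ.^-*-assoc 1000 i b ⟩
      1000 ^ (i * b)          ≤⟨ ℕₚ.^-monoʳ-≤ 1000 ib≤ ⟩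
      1000 ^ 10000            ∎)) large

  floor-fourth-root : ∀ τ → ∃ λ h → 2 * (h * h * (h * h)) ≤ τ × τ < 2 * (suc h * suc h * (suc h * suc h))
  floor-fourth-root zero = 0 , z≤n , s≤s z≤n
  floor-fourth-root (suc τ) with floor-fourth-root τ
  ... | h , lower , upper with ℕₚ.≤-<-connex (2 * (suc h * suc h * (suc h * suc h))) (suc τ)
  ... | inj₂ upper' = h , ℕₚ.m≤n⇒m≤1+n lower , upper'
  ... | inj₁ reached = suc h , reached , ℕₚ.≤-<-trans upper
    (ℕₚ.*-monoʳ-< 2 (ℕₚ.*-mono-< (ℕₚ.*-mono-< next next) (ℕₚ.*-mono-< next next)))
    where
    next : suc h < suc (suc h)
    next = ℕₚ.≤-refl

  -- The size condition of `cover-chain` with q = p² and |2G| ≥ τ²/3 inserted. For r = t + s it asks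
  -- for τ beyond p^((r + 3)/(2 r + 4)), up to a constant.
  chain-condition : ∀ {p τ S} t s → τ * τ ≤ 3 * S → let N = 2 + (suc (2 * t) + suc (2 * s)) in
    3 ^ N * 2 ^ (t + s) * p ^ (2 * (t + s + 3)) < τ ^ (2 * N) →
    (2 * (p * p)) ^ (t + s) * (p * p * (p * p) * (p * p)) < S * S * (S ^ suc (2 * t) * S ^ suc (2 * s))
  chain-condition {p} {τ} {S} t s τ²≤3S large = ℕₚ.*-cancelˡ-< (3 ^ N) _ _ (begin-strict
    3 ^ N * ((2 * q) ^ r * (q * q * q))
      ≡⟨ cong (λ z → 3 ^ N * (z * (q * q * q))) (^-distribʳ-* r 2 q) ⟩
    3 ^ N * (2 ^ r * q ^ r * (q * q * q))
      ≡⟨ regroup (3 ^ N) (2 ^ r) (q ^ r) q ⟩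
    3 ^ N * 2 ^ r * (q ^ r * q ^ 3)
      ≡⟨ cong (3 ^ N * 2 ^ r *_) (trans (sym (ℕₚ.^-distribˡ-+-* q r 3)) (square-power p (r + 3))) ⟩
    3 ^ N * 2 ^ r * p ^ (2 * (r + 3))
      <⟨ large ⟩
    τ ^ (2 * N)
      ≡⟨ sym (square-power τ N) ⟩
    (τ * τ) ^ N
      ≤⟨ ℕₚ.^-monoˡ-≤ N τ²≤3S ⟩
    (3 * S) ^ N
      ≡⟨ ^-distribʳ-* N 3 S ⟩
    3 ^ N * S ^ N
      ≡⟨ cong (3 ^ N *_) (trans (ℕₚ.^-distribˡ-+-* S 2 (suc (2 * t) + suc (2 * s)))
           (cong₂ _*_ (cong (S *_) (ℕₚ.*-identityʳ S)) (ℕₚ.^-distribˡ-+-* S (suc (2 * t)) (suc (2 * s))))) ⟩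
    3 ^ N * (S * S * (S ^ suc (2 * t) * S ^ suc (2 * s))) ∎)
    where
    N = 2 + (suc (2 * t) + suc (2 * s))
    r = t + s
    q = p * p
    regroup : ∀ c d x q → c * (d * x * (q * q * q)) ≡ c * d * (x * (q * (q * (q * 1))))
    regroup = ℕ-ring
    square-power : ∀ x n → (x * x) ^ n ≡ x ^ (2 * n)
    square-power x n = trans (cong (_^ n) (cong (x *_) (sym (ℕₚ.*-identityʳ x)))) (ℕₚ.^-*-assoc x 2 n)

  double-exceeds : ∀ {p S} .{{_ : NonZero p}} → 2 * p < S → 2 * (p * p) + S < S * S
  double-exceeds {p} {S} 2p<S = begin-strict
    2 * (p * p) + S          ≡⟨ cong (_+ S) (sym (ℕₚ.*-assoc 2 p p)) ⟩
    2 * p * p + S            <⟨ ℕₚ.+-monoˡ-< S (ℕₚ.*-monoʳ-< (2 * p) {{ℕₚ.m*n≢0 2 p}} (ℕₚ.≤-<-trans (ℕₚ.m≤n*m p 2) 2p<S)) ⟩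
    2 * p * S + S            ≡⟨ ℕₚ.+-comm (2 * p * S) S ⟩
    suc (2 * p) * S          ≤⟨ ℕₚ.*-monoˡ-≤ S 2p<S ⟩
    S * S                    ∎

  -- Eighth powers: h⁴ ≤ τ gives (h τ)⁸ ≤ τ¹⁰ ≤ (b p)⁵, well below p⁸, and the constant a⁸ b⁵ is at
  -- most p.
  product-fits : ∀ a b C {p τ h} .{{_ : NonZero p}} → h * h * (h * h) ≤ τ → τ * τ ≤ b * p →
    a * a * (a * a) * (a * a * (a * a)) * (b * (b * b * b * b)) ≡ C → C ≤ p → a * (h * τ) ≤ p
  product-fits a b C {p} {τ} {h} h⁴≤τ τ²≤bp refl C≤p = ^-cancelʳ-≤ 8 (begin
    (a * (h * τ)) ^ 8
      ≡⟨ e₁ a h τ ⟩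
    a⁸ * (h⁴ * h⁴ * (τ * τ * (τ * τ) * (τ * τ) * (τ * τ)))
      ≤⟨ ℕₚ.*-monoʳ-≤ a⁸ (ℕₚ.*-monoˡ-≤ _ (ℕₚ.*-mono-≤ h⁴≤τ h⁴≤τ)) ⟩
    a⁸ * (τ * τ * (τ * τ * (τ * τ) * (τ * τ) * (τ * τ)))
      ≤⟨ ℕₚ.*-monoʳ-≤ a⁸ (ℕₚ.*-mono-≤ τ²≤bp (ℕₚ.*-mono-≤ (ℕₚ.*-mono-≤ (ℕₚ.*-mono-≤ τ²≤bp τ²≤bp) τ²≤bp) τ²≤bp)) ⟩
    a⁸ * (b * p * (b * p * (b * p) * (b * p) * (b * p)))
      ≡⟨ e₂ a⁸ b p ⟩
    a⁸ * (b * (b * b * b * b)) * p ^ 5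
      ≤⟨ ℕₚ.*-monoˡ-≤ (p ^ 5) C≤p ⟩
    p ^ 6
      ≤⟨ ℕₚ.^-monoʳ-≤ p (ℕₚ.≤ᵇ⇒≤ 6 8 tt) ⟩
    p ^ 8 ∎)
    where
    h⁴ = h * h * (h * h)
    a⁸ = a * a * (a * a) * (a * a * (a * a))
    e₁ : ∀ c h t → let x = c * (h * t) in x * (x * (x * (x * (x * (x * (x * (x * 1))))))) ≡
      c * c * (c * c) * (c * c * (c * c)) * (h * h * (h * h) * (h * h * (h * h)) * (t * t * (t * t) * (t * t) * (t * t)))
    e₁ = ℕ-ring
    e₂ : ∀ a b p → a * (b * p * (b * p * (b * p) * (b * p) * (b * p))) ≡ a * (b * (b * b * b * b)) * (p * (p * (p * (p * (p * 1)))))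
    e₂ = ℕ-ring

  -- Fourth powers: (h τ²)⁴ is at least τ⁹ / a, so the comparison reduces to that of τ⁹ with p⁴.
  product-exceeds : ∀ a b C {p τ h} → τ ≤ a * (h * h * (h * h)) → a * (b * b * (b * b)) ≡ C → C * p ^ 4 < τ ^ 9 →
    b * p < h * (τ * τ)
  product-exceeds a b C {p} {τ} {h} τ≤ah⁴ refl large = ℕₚ.≰⇒> λ small → ℕₚ.<⇒≱ large (begin
    τ ^ 9
      ≡⟨ e₁ τ ⟩
    τ * (τ * τ * (τ * τ) * (τ * τ * (τ * τ)))
      ≤⟨ ℕₚ.*-monoˡ-≤ _ τ≤ah⁴ ⟩
    a * (h * h * (h * h)) * (τ * τ * (τ * τ) * (τ * τ * (τ * τ)))
      ≡⟨ e₂ a h τ ⟩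
    a * (h * (τ * τ) * (h * (τ * τ)) * (h * (τ * τ) * (h * (τ * τ))))
      ≤⟨ ℕₚ.*-monoʳ-≤ a (ℕₚ.*-mono-≤ (ℕₚ.*-mono-≤ small small) (ℕₚ.*-mono-≤ small small)) ⟩
    a * (b * p * (b * p) * (b * p * (b * p)))
      ≡⟨ e₃ a b p ⟩
    a * (b * b * (b * b)) * p ^ 4 ∎)
    where
    e₁ : ∀ t → t * (t * (t * (t * (t * (t * (t * (t * (t * 1)))))))) ≡ t * (t * t * (t * t) * (t * t * (t * t)))
    e₁ = ℕ-ring
    e₂ : ∀ a h t → a * (h * h * (h * h)) * (t * t * (t * t) * (t * t * (t * t))) ≡
      a * (h * (t * t) * (h * (t * t)) * (h * (t * t) * (h * (t * t))))
    e₂ = ℕ-ring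
    e₃ : ∀ a b p → a * (b * p * (b * p) * (b * p * (b * p))) ≡ a * (b * b * (b * b)) * (p * (p * (p * (p * 1))))
    e₃ = ℕ-ring

-- Covering the plane with k terms, range by range.

module Covering (p : ℕ) .{{_ : NonZero p}} (p-prime : Prime p) (A : Mat2 p) (det≡1 : InSL2 p A)
  (charPoly-irreducible : CharPolyIrreducible p A) (τ : ℕ) (order : IsOrder p A τ) (large : Powers.threshold ≤ p) where
  open Powers
  open PrimeField p p-prime using (primeField; primeField-characteristic)
  open Orbit p p-prime A det≡1 charPoly-irreducible
  open FiniteField extension using (card)
  open import Data.List.Membership.Propositional.Properties using (∈-map⁻; ∈-cartesianProduct⁻; ∈-deduplicate⁻)
  open import Data.List.Properties using (length-tabulate)
  open import Data.Nat.Tactic.RingSolver using () renaming (solve-∀ to ℕ-ring)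
  open Sumsets extension (Power order) (power-closed order) public
  open SumSubset

  private
    G : List K
    G = group order

    |G|≡τ : length G ≡ τ
    |G|≡τ = length-group order

    0<τ : 0 < τ
    0<τ = proj₁ order

    card≡p² : card ≡ p * p
    card≡p² = trans extension-card (cong (λ n → n * n) (length-tabulate {n = p} (λ i → i)))

    characteristic : ∀ n → 0 < n → n < p → Polynomial.fromℕ extension n ≢ 0K
    characteristic n 0<n n<p e = primeField-characteristic n 0<n n<p (cong proj₁ (trans (sym (extension-fromℕ n)) e))

    G-torsion : ∀ {u} → u ∈ G → FiniteField._^ᵏ_ extension u (length G) ≡ 1K
    G-torsion {u} u∈ = subst (λ n → FiniteField._^ᵏ_ extension u n ≡ 1K) (sym |G|≡τ) (power-torsion order (group⇒power order u∈))

    module N = Conjugation.NormOneGroup extension bar bar-add bar-neg bar-mul bar-1 bar-bar G (group-unique order)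
      (λ u∈ → power-norm order (group⇒power order u∈)) G-torsion (subst (0 <_) (sym |G|≡τ) 0<τ)

    power-t : Power order t
    power-t = 1 , sym (FiniteField.*-identityʳ extension t)

    small : ∀ C i b → C ≤ 1000 ^ i → i * b ≤ 10000 → C ^ b < p
    small C i b C≤ ib≤ = threshold-bound C i b C≤ ib≤ large

    2<p : 2 < p
    2<p = subst (_< p) (ℕₚ.*-identityʳ 2) (small 2 1 1 (ℕₚ.≤ᵇ⇒≤ _ _ tt) (ℕₚ.≤ᵇ⇒≤ _ _ tt))

    odd : ∀ x → add x x ≡ 0K → x ≡ 0K
    odd x e = *-cancelˡ-0 (characteristic 2 (s≤s z≤n) 2<p)
      (trans (solve 1 (λ x → (con (pos 1) :+ (con (pos 1) :+ con (pos 0))) :* x := x :+ x) refl x) e)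
      where open FiniteField extension using (*-cancelˡ-0; solve; _:=_)

    1G : SumSubset 1
    1G = record { points = G ; unique = group-unique order ; sums = λ x∈ → Sums-singleton (group⇒power order x∈) }

    2G : SumSubset 2
    2G = record
      { points = N.2G
      ; unique = deduplicate-! (map N.sum₂ N.pairs)
      ; sums = λ x∈ → let (u , v) , uv∈ , x≡ = ∈-map⁻ N.sum₂ (∈-deduplicate⁻ _ _ x∈)
                          u∈ , v∈ = ∈-cartesianProduct⁻ G G uv∈
                      in subst (Sums 2) (sym x≡) (cons (group⇒power order u∈) (Sums-singleton (group⇒power order v∈))) }
      where open import Data.List.Relation.Unary.Unique.DecPropositional.Properties (FiniteField._≟_ extension) using (deduplicate-!)

    3G : SumSubset 3
    3G = record
      { points = N.3G
      ; unique = deduplicate-! (map N.sum₃ N.triples)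
      ; sums = λ x∈ → let (w , uv) , wuv∈ , x≡ = ∈-map⁻ N.sum₃ (∈-deduplicate⁻ _ _ x∈)
                          w∈ , uv∈ = ∈-cartesianProduct⁻ G N.pairs wuv∈
                          u∈ , v∈ = ∈-cartesianProduct⁻ G G uv∈
                      in subst (Sums 3) (sym x≡) (cons (group⇒power order w∈)
                           (cons (group⇒power order u∈) (Sums-singleton (group⇒power order v∈)))) }
      where open import Data.List.Relation.Unary.Unique.DecPropositional.Properties (FiniteField._≟_ extension) using (deduplicate-!)

    S : ℕ
    S = size 2G

    τ²≤3S : τ * τ ≤ 3 * S
    τ²≤3S = subst (λ n → n * n ≤ 3 * S) |G|≡τ N.2G-large

  cover-by-chain : ∀ t s → index s ≤ index t → index t ≤ 4 + index s →
    (let N = 2 + (suc (2 * t) + suc (2 * s)) in 3 ^ N * 2 ^ (t + s) * p ^ (2 * (t + s + 3)) < τ ^ (2 * N)) →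
    AllSums (4 + index t + index s)
  cover-by-chain t s s≤t t≤4+s bound = from 2G τ²≤3S
    where
    from : (X : SumSubset 2) → τ * τ ≤ 3 * size X → AllSums (4 + index t + index s)
    from X τ²≤3X = cover-chain power-t X t s s≤t t≤4+s
      (subst (λ q → (2 * q) ^ (t + s) * (q * q * q) < size X * size X * (size X ^ suc (2 * t) * size X ^ suc (2 * s))) (sym card≡p²)
        (chain-condition {p} {τ} {size X} t s τ²≤3X bound))

  -- The set 1G·2G + 2G + 2G: a product with 1G costs only two terms, which gives 1 · 2 + 2 + 2 = 6.
  cover-6 : 27 * p ^ 6 < τ ^ 7 → AllSums 6
  cover-6 bound = cover-product 1G 2G 2G 2G
    (subst (λ q → q * q * q < size 1G * S * S * S) (sym card≡p²) (ℕₚ.*-cancelˡ-< 27 _ _ (begin-strict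
      27 * (p * p * (p * p) * (p * p))              ≡⟨ e₁ p ⟩
      27 * p ^ 6                                    <⟨ bound ⟩
      τ ^ 7                                         ≡⟨ e₂ τ ⟩
      τ * (τ * τ) * (τ * τ) * (τ * τ)               ≤⟨ ℕₚ.*-mono-≤ (ℕₚ.*-mono-≤ (ℕₚ.*-monoʳ-≤ τ τ²≤3S) τ²≤3S) τ²≤3S ⟩
      τ * (3 * S) * (3 * S) * (3 * S)               ≡⟨ e₃ τ S ⟩
      27 * (τ * S * S * S)                          ≡⟨ cong (λ n → 27 * (n * S * S * S)) (sym |G|≡τ) ⟩
      27 * (size 1G * S * S * S)                    ∎)))
    where
    open ℕₚ.≤-Reasoning
    e₁ : ∀ p → 27 * (p * p * (p * p) * (p * p)) ≡ 27 * (p * (p * (p * (p * (p * (p * 1))))))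
    e₁ = ℕ-ring
    e₂ : ∀ t → t * (t * (t * (t * (t * (t * (t * 1)))))) ≡ t * (t * t) * (t * t) * (t * t)
    e₂ = ℕ-ring
    e₃ : ∀ t s → t * (3 * s) * (3 * s) * (3 * s) ≡ 27 * (t * s * s * s)
    e₃ = ℕ-ring

  -- The set X = 2G·2G + 1G uses five terms and 2G·2G + 2G + X eleven. The first bound serves when X
  -- fills more than half of the field, the second when X has merely grown.
  cover-11 : 54 * p ^ 4 < τ ^ 6 → 486 * p ^ 8 < τ ^ 11 → AllSums 11
  cover-11 bound₁ bound₂ = cover-product 2G 2G 2G X
    (subst (λ q → q * q * q < S * S * S * size X) (sym card≡p²)
      (sufficient (subst (λ q → q < size X + size X ⊎ S * S * size 1G ≤ 2 * q * size X) card≡p² (proj₂ (grow 2G 2G 1G)))))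
    where
    open ℕₚ.≤-Reasoning
    X = proj₁ (grow 2G 2G 1G)
    q = p * p
    2q²<S³ : 2 * (q * q) < S * S * S
    2q²<S³ = ℕₚ.*-cancelˡ-< 27 _ _ (begin-strict
      27 * (2 * (q * q))                    ≡⟨ e₁ p ⟩
      54 * p ^ 4                            <⟨ bound₁ ⟩
      τ ^ 6                                 ≡⟨ e₂ τ ⟩
      τ * τ * (τ * τ) * (τ * τ)             ≤⟨ ℕₚ.*-mono-≤ (ℕₚ.*-mono-≤ τ²≤3S τ²≤3S) τ²≤3S ⟩
      3 * S * (3 * S) * (3 * S)             ≡⟨ e₃ S ⟩
      27 * (S * S * S)                      ∎)
      where
      e₁ : ∀ p → 27 * (2 * (p * p * (p * p))) ≡ 54 * (p * (p * (p * (p * 1))))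
      e₁ = ℕ-ring
      e₂ : ∀ t → t * (t * (t * (t * (t * (t * 1))))) ≡ t * t * (t * t) * (t * t)
      e₂ = ℕ-ring
      e₃ : ∀ s → 3 * s * (3 * s) * (3 * s) ≡ 27 * (s * s * s)
      e₃ = ℕ-ring
    2q⁴<S⁵τ : 2 * (q * q * (q * q)) < S * S * S * (S * S * τ)
    2q⁴<S⁵τ = ℕₚ.*-cancelˡ-< 243 _ _ (begin-strict
      243 * (2 * (q * q * (q * q)))                              ≡⟨ e₁ p ⟩
      486 * p ^ 8                                                <⟨ bound₂ ⟩
      τ ^ 11                                                     ≡⟨ e₂ τ ⟩
      τ * τ * (τ * τ) * (τ * τ) * (τ * τ * (τ * τ) * τ)          ≤⟨ ℕₚ.*-mono-≤ (ℕₚ.*-mono-≤ (ℕₚ.*-mono-≤ τ²≤3S τ²≤3S) τ²≤3S)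
                                                                      (ℕₚ.*-monoˡ-≤ τ (ℕₚ.*-mono-≤ τ²≤3S τ²≤3S)) ⟩
      3 * S * (3 * S) * (3 * S) * (3 * S * (3 * S) * τ)          ≡⟨ e₃ S τ ⟩
      243 * (S * S * S * (S * S * τ))                            ∎)
      where
      e₁ : ∀ p → 243 * (2 * (p * p * (p * p) * (p * p * (p * p)))) ≡ 486 * (p * (p * (p * (p * (p * (p * (p * (p * 1))))))))
      e₁ = ℕ-ring
      e₂ : ∀ t → t * (t * (t * (t * (t * (t * (t * (t * (t * (t * (t * 1)))))))))) ≡ t * t * (t * t) * (t * t) * (t * t * (t * t) * t)
      e₂ = ℕ-ring
      e₃ : ∀ s t → 3 * s * (3 * s) * (3 * s) * (3 * s * (3 * s) * t) ≡ 243 * (s * s * s * (s * s * t))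
      e₃ = ℕ-ring
    sufficient : q < size X + size X ⊎ S * S * size 1G ≤ 2 * q * size X → q * q * q < S * S * S * size X
    sufficient (inj₁ q<2X) = ℕₚ.*-cancelˡ-< 2 _ _ (begin-strict
      2 * (q * q * q)                       ≡⟨ sym (ℕₚ.*-assoc 2 (q * q) q) ⟩
      2 * (q * q) * q                       ≤⟨ ℕₚ.*-monoˡ-≤ q (ℕₚ.<⇒≤ 2q²<S³) ⟩
      S * S * S * q                         <⟨ ℕₚ.*-monoʳ-< (S * S * S) {{>-nonZero (ℕₚ.≤-<-trans z≤n 2q²<S³)}} q<2X ⟩
      S * S * S * (size X + size X)         ≡⟨ e (S * S * S) (size X) ⟩
      2 * (S * S * S * size X)              ∎)
      where
      e : ∀ s x → s * (x + x) ≡ 2 * (s * x)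
      e = ℕ-ring
    sufficient (inj₂ S²τ≤2qX) = ℕₚ.*-cancelˡ-< (2 * q) _ _ (begin-strict
      2 * q * (q * q * q)                   ≡⟨ e₁ q ⟩
      2 * (q * q * (q * q))                 <⟨ 2q⁴<S⁵τ ⟩
      S * S * S * (S * S * τ)               ≡⟨ cong (λ n → S * S * S * (S * S * n)) (sym |G|≡τ) ⟩
      S * S * S * (S * S * size 1G)         ≤⟨ ℕₚ.*-monoʳ-≤ (S * S * S) S²τ≤2qX ⟩
      S * S * S * (2 * q * size X)          ≡⟨ e₂ (S * S * S) (2 * q) (size X) ⟩
      2 * q * (S * S * S * size X)          ∎)
      where
      e₁ : ∀ q → 2 * q * (q * q * q) ≡ 2 * (q * q * (q * q))
      e₁ = ℕ-ring
      e₂ : ∀ s k x → s * (k * x) ≡ k * (s * x)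
      e₂ = ℕ-ring

  cover-eight-large : ∀ {i} (X : SumSubset i) → 2 * p < size X → AllSums ((i + i) * (i + i) + (i + i) * (i + i))
  cover-eight-large X 2p<X = cover-eight odd X
    (subst (λ q → 2 * q + size X < size X * size X) (sym card≡p²) (double-exceeds {p} {size X} 2p<X))

  -- From |2G| ≥ τ²/3 > 2 p, Glibichuk's argument applies with i = 2: (2 + 2)² + (2 + 2)² = 32.
  cover-32 : 6 * p < τ * τ → AllSums 32
  cover-32 bound = cover-eight-large 2G (ℕₚ.*-cancelˡ-< 3 _ _ (begin-strict
      3 * (2 * p)       ≡⟨ sym (ℕₚ.*-assoc 3 2 p) ⟩
      6 * p             <⟨ bound ⟩
      τ * τ             ≤⟨ τ²≤3S ⟩
      3 * S             ∎))
    where open ℕₚ.≤-Reasoning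

  -- The range in which 2G may be too small and 3G takes over. The upper bound on τ keeps the degree
  -- in Stepanov's method below p.
  module _ (p⁵≤τ¹¹ : p ^ 5 ≤ τ ^ 11) (τ²≤6p : τ * τ ≤ 6 * p) where
    private
      open ℕₚ.≤-Reasoning
      h = proj₁ (floor-fourth-root τ)
      2h⁴≤τ : 2 * (h * h * (h * h)) ≤ τ
      2h⁴≤τ = proj₁ (proj₂ (floor-fourth-root τ))
      τ<2[1+h]⁴ : τ < 2 * (suc h * suc h * (suc h * suc h))
      τ<2[1+h]⁴ = proj₂ (proj₂ (floor-fourth-root τ))

      -- Since τ is below 2 (1 + h)⁴, a value h ≤ 1 would force τ < 32.
      31<τ : 31 < τ
      31<τ = subst (31 <_) (ℕₚ.*-identityʳ τ) (power-comparison {p} {τ} 31 5 11 0 1 p⁵≤τ¹¹ (ℕₚ.<ᵇ⇒< _ _ tt) (small 31 1 11 (ℕₚ.≤ᵇ⇒≤ _ _ tt) (ℕₚ.≤ᵇ⇒≤ _ _ tt)))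

      2≤h : 2 ≤ h
      2≤h = ℕₚ.≰⇒> (λ h≤1 → ℕₚ.<⇒≱ 31<τ (ℕₚ.≤-pred (ℕₚ.<-≤-trans τ<2[1+h]⁴
        (ℕₚ.*-monoʳ-≤ 2 (ℕₚ.*-mono-≤ (ℕₚ.*-mono-≤ (s≤s h≤1) (s≤s h≤1)) (ℕₚ.*-mono-≤ (s≤s h≤1) (s≤s h≤1)))))))

      5hτ≤p : 5 * (h * τ) ≤ p
      5hτ≤p = product-fits 5 6 3037500000 {p} {τ} {h} (ℕₚ.≤-trans (ℕₚ.m≤n*m (h * h * (h * h)) 2) 2h⁴≤τ) τ²≤6p refl
        (ℕₚ.<⇒≤ (subst (_< p) (ℕₚ.*-identityʳ 3037500000) (small 3037500000 4 1 (ℕₚ.≤ᵇ⇒≤ _ _ tt) (ℕₚ.≤ᵇ⇒≤ _ _ tt))))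

      hτ²≤22|3G| : h * (τ * τ) ≤ 22 * size 3G
      hτ²≤22|3G| = subst (λ n → h * (n * n) ≤ 22 * size 3G) |G|≡τ (N.3G-large p characteristic h 2≤h
        (subst (2 * (h * h * (h * h)) ≤_) (sym |G|≡τ) 2h⁴≤τ) (subst (λ n → 5 * (h * n) ≤ p) (sym |G|≡τ) 5hτ≤p))

      τ≤32h⁴ : τ ≤ 32 * (h * h * (h * h))
      τ≤32h⁴ = begin
        τ                                            ≤⟨ ℕₚ.<⇒≤ τ<2[1+h]⁴ ⟩
        2 * (suc h * suc h * (suc h * suc h))        ≤⟨ ℕₚ.*-monoʳ-≤ 2 (ℕₚ.*-mono-≤ (ℕₚ.*-mono-≤ 1+h≤2h 1+h≤2h) (ℕₚ.*-mono-≤ 1+h≤2h 1+h≤2h)) ⟩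
        2 * (2 * h * (2 * h) * (2 * h * (2 * h)))    ≡⟨ e h ⟩
        32 * (h * h * (h * h))                       ∎
        where
        1+h≤2h : suc h ≤ 2 * h
        1+h≤2h = ℕₚ.≤-trans (ℕₚ.+-monoˡ-≤ h (ℕₚ.≤-trans (s≤s z≤n) 2≤h)) (ℕₚ.≤-reflexive (cong (h +_) (sym (ℕₚ.+-identityʳ h))))
        e : ∀ h → 2 * (2 * h * (2 * h) * (2 * h * (2 * h))) ≡ 32 * (h * h * (h * h))
        e = ℕ-ring

      -- 44 = 2 · 22: the factor 22 is lost in `3G-large`, and 2 p is the size that Glibichuk's
      -- argument asks for. The exponents fit because 9 · 5 > 4 · 11.
      44p<hτ² : 44 * p < h * (τ * τ)
      44p<hτ² = product-exceeds 32 44 119939072 {p} {τ} {h} τ≤32h⁴ refl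
        (power-comparison {p} {τ} 119939072 5 11 4 9 p⁵≤τ¹¹ (ℕₚ.<ᵇ⇒< _ _ tt) (small 119939072 3 11 (ℕₚ.≤ᵇ⇒≤ _ _ tt) (ℕₚ.≤ᵇ⇒≤ _ _ tt)))

      2p<|3G| : 2 * p < size 3G
      2p<|3G| = ℕₚ.*-cancelˡ-< 22 _ _ (begin-strict
        22 * (2 * p)       ≡⟨ sym (ℕₚ.*-assoc 22 2 p) ⟩
        44 * p             <⟨ 44p<hτ² ⟩
        h * (τ * τ)        ≤⟨ hτ²≤22|3G| ⟩
        22 * size 3G       ∎)

    cover-72-small : AllSums 72
    cover-72-small = cover-eight-large 3G 2p<|3G|

  cover-72 : p ^ 5 ≤ τ ^ 11 → AllSums 72
  cover-72 p⁵≤τ¹¹ = by-size (ℕₚ.<-≤-connex (6 * p) (τ * τ))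
    where
    by-size : 6 * p < τ * τ ⊎ τ * τ ≤ 6 * p → AllSums 72
    by-size (inj₁ 6p<τ²) = AllSums-≤ power-t {32} {72} (ℕₚ.≤ᵇ⇒≤ 32 72 tt) (cover-32 6p<τ²)
    by-size (inj₂ τ²≤6p) = cover-72-small p⁵≤τ¹¹ τ²≤6p

  module _ (m n : ℕ) .{{_ : NonZero n}} (τ-large : p ^ (5 * n + 11 * m) ≤ τ ^ (11 * n))
           (k : ℕ) (45n<11m[k+3] : 45 * n < 11 * m * (k + 3)) where
    private
      -- With c the right end of a range of k, the order is at least p^(5/11 + 45/(11 (c + 3))).
      exponent-from : ∀ c → k ≤ c → p ^ (5 * (c + 3) + 45) ≤ τ ^ (11 * (c + 3))
      exponent-from c k≤c = order-exponent m n k (c + 3) τ-large 45n<11m[k+3] (ℕₚ.+-monoˡ-≤ 3 k≤c)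

      raise : ∀ {l} → l ≤ k → AllSums l → AllSums k
      raise = AllSums-≤ power-t

      -- The numerical conditions enter as Boolean tests on numerals, so that evaluation settles
      -- each range.
      between : ∀ c C i e f → k ≤ c → IsTrue (e * (11 * (c + 3)) <ᵇ f * (5 * (c + 3) + 45)) →
        IsTrue (C ≤ᵇ 1000 ^ i) → IsTrue (i * (11 * (c + 3)) ≤ᵇ 10000) → C * p ^ e < τ ^ f
      between c C i e f k≤c eb<fa C≤ ib≤ = power-comparison {p} {τ} C (5 * (c + 3) + 45) (11 * (c + 3)) e f (exponent-from c k≤c)
        (ℕₚ.<ᵇ⇒< _ _ eb<fa) (small C i (11 * (c + 3)) (ℕₚ.≤ᵇ⇒≤ _ _ C≤) (ℕₚ.≤ᵇ⇒≤ _ _ ib≤))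

      by-chain : ∀ t s c i → k ≤ c → 4 + index t + index s ≤ k →
        let N = 2 + (suc (2 * t) + suc (2 * s)) in
        IsTrue (index s ≤ᵇ index t) → IsTrue (index t ≤ᵇ 4 + index s) →
        IsTrue (2 * (t + s + 3) * (11 * (c + 3)) <ᵇ 2 * N * (5 * (c + 3) + 45)) →
        IsTrue (3 ^ N * 2 ^ (t + s) ≤ᵇ 1000 ^ i) → IsTrue (i * (11 * (c + 3)) ≤ᵇ 10000) → AllSums k
      by-chain t s c i k≤c ≤k s≤t t≤4+s eb<fa C≤ ib≤ = raise ≤k (cover-by-chain t s (ℕₚ.≤ᵇ⇒≤ _ _ s≤t) (ℕₚ.≤ᵇ⇒≤ _ _ t≤4+s)
        (between c (3 ^ N * 2 ^ (t + s)) i (2 * (t + s + 3)) (2 * N) k≤c eb<fa C≤ ib≤))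
        where N = 2 + (suc (2 * t) + suc (2 * s))

      at-or-below : ∀ l → (l ≤ k → AllSums k) → (k ≤ pred l → AllSums k) → AllSums k
      at-or-below l above below = [ below ∘ ℕₚ.<⇒≤pred , above ]′ (ℕₚ.<-≤-connex k l)

      -- Here the lower bound on the order is weakened to p^(5/11), at which 3G is already larger
      -- than 2 p or 2G is.
      72-terms : 72 ≤ k → AllSums k
      72-terms 72≤k = raise 72≤k (cover-72 (^-cancelʳ-≤ n {p ^ 5} {τ ^ 11} (begin
        (p ^ 5) ^ n                   ≡⟨ ℕₚ.^-*-assoc p 5 n ⟩
        p ^ (5 * n)                   ≤⟨ ℕₚ.^-monoʳ-≤ p (ℕₚ.m≤m+n (5 * n) (11 * m)) ⟩
        p ^ (5 * n + 11 * m)          ≤⟨ τ-large ⟩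
        τ ^ (11 * n)                  ≡⟨ sym (ℕₚ.^-*-assoc τ 11 n) ⟩
        (τ ^ 11) ^ n                  ∎)))
        where open ℕₚ.≤-Reasoning

      -- At c = 71 the exponent of the order is 415/814, just above the 1/2 that makes 2G larger
      -- than 2 p.
      32-terms : k ≤ 71 → 32 ≤ k → AllSums k
      32-terms k≤71 32≤k = raise 32≤k (cover-32 (subst₂ _<_ (cong (6 *_) (ℕₚ.*-identityʳ p)) (cong (τ *_) (ℕₚ.*-identityʳ τ))
        (between 71 6 1 1 2 k≤71 tt tt tt)))
        where open import Relation.Binary.PropositionalEquality using (subst₂)

      -- For k = 11 the exponent 115/154 falls short of the 3/4 that eight terms demand, and twelve
      -- are too many; the requirement 8/11 of `cover-11` fills this gap.
      11-terms : k ≤ 11 → 11 ≤ k → AllSums k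
      11-terms k≤11 11≤k = raise 11≤k (cover-11 (between 11 54 1 4 6 k≤11 tt tt tt) (between 11 486 1 8 11 k≤11 tt tt tt))

      -- Only k = 7 is left, with exponent 19/22 against the required 6/7; one term is spare.
      6-terms : 6 < k → k ≤ 7 → AllSums k
      6-terms 6<k k≤7 = raise (ℕₚ.<⇒≤ 6<k) (cover-6 (between 7 27 1 6 7 k≤7 tt tt tt))

    -- In each range of k the inequality 45 n < 11 m (k + 3) bounds τ from below by a fixed power of p.
    cover-k : 6 < k → AllSums k
    cover-k 6<k =
      at-or-below 72 72-terms λ k≤71 →
      at-or-below 32 (32-terms k≤71) λ k≤31 →
      at-or-below 28 (λ ≤k → by-chain 3 2 31 3 k≤31 ≤k tt tt tt tt tt) λ k≤27 →
      at-or-below 24 (λ ≤k → by-chain 2 2 27 3 k≤27 ≤k tt tt tt tt tt) λ k≤23 →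
      at-or-below 20 (λ ≤k → by-chain 2 1 23 3 k≤23 ≤k tt tt tt tt tt) λ k≤19 →
      at-or-below 16 (λ ≤k → by-chain 1 1 19 3 k≤19 ≤k tt tt tt tt tt) λ k≤15 →
      at-or-below 12 (λ ≤k → by-chain 1 0 15 3 k≤15 ≤k tt tt tt tt tt) λ k≤11 →
      at-or-below 11 (11-terms k≤11) λ k≤10 →
      at-or-below 8 (λ ≤k → by-chain 0 0 10 3 k≤10 ≤k tt tt tt tt tt) λ k≤7 →
      6-terms 6<k k≤7

-- The number ε is m/n, and the bound on τ is raised to the power 11 n. A real ε can be lowered to a
-- rational one that admits the same integers k, since the condition on k is strict.
theorem3p2 : (m n : ℕ) → .{{NonZero m}} → .{{NonZero n}} →
    Σ ℕ λ p₀ →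
    (p : ℕ) → .{{_ : NonZero p}} → Prime p → p₀ ≤ p →
    (A : Mat2 p) → InSL2 p A → CharPolyIrreducible p A →
    (τ : ℕ) → IsOrder p A τ → p ^ (5 * n + 11 * m) ≤ τ ^ (11 * n) →
    (a : Vec2 p) → a ≢ 0V p →
    (k : ℕ) → 45 * n < 11 * m * (k + 3) → 6 < k →
    (v : Vec2 p) → InSumset p k (InOrbit p a A τ) v
-- One numerical threshold serves every ε, because the constants to be absorbed come from finitely
-- many ranges of k.
theorem3p2 m n = Powers.threshold , λ p p-prime large A det≡1 irreducible τ order τ-large a a≢0 k 45n<11m[k+3] 6<k →
  Orbit.allSums⇒sumset p p-prime A det≡1 irreducible order a≢0
    (Covering.cover-k p p-prime A det≡1 irreducible τ order large m n τ-large k 45n<11m[k+3] 6<k)
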